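{- Given (i) a pair $(G,\tau)$, where $G$ is a graph of order $n(G)$ and $\tau:V(G)\to\mathbb{N}_0$ is a threshold function for $G$ with $\tau(u)\le d_G(u)$ and $\tau(u)\in\{0,1,d_G(u)\}$ for every vertex $u$ of $G$, and (ii) a nice tree decomposition $\left(T,(X_t)_{t\in V(T)}\right)$ of $G$ of width $w$, where $T$ has order $n(T)$, the minimum order of a non-monotone target set for $(G,\tau)$ can be determined in time $$2^{5w}\cdot n(T)\cdot \mathrm{poly}(n(G)).$$
   Context: Graphs are finite, simple, and undirected. $\mathbb{N}=\{1,2,3,\ldots\}$ and $\mathbb{N}_0=\{0,1,2,\ldots\}$. $d_G(u)$ is the degree of $u$ in $G$ and $N_G(u)$ is the set of neighbors of $u$. The order of a graph is its number of vertices, and the order of a set is its cardinality. $\mathrm{poly}(n)$ denotes a quantity bounded by some fixed polynomial in $n$. A threshold function for $G$ is a function $\tau:V(G)\to\mathbb{N}_0$. For $X\subseteq V(G)$, the non-monotone activation process on $(G,\tau)$ starting with $X$ is the sequence $(Y_s)_{s\in\mathbb{N}_0}$ with $Y_0=X$ and $Y_s=\{u\in V(G):|N_G(u)\cap Y_{s-1}|\ge\tau(u)\}$ for every $s\in\mathbb{N}$. The set $X$ is a non-monotone target set for $(G,\tau)$ if there is some $s_0\in\mathbb{N}_0$ such that $Y_s=V(G)$ for every $s\ge s_0$. A tree decomposition of $G$ is a pair $\left(T,(X_t)_{t\in V(T)}\right)$, where $T$ is a tree; $X_t\subseteq V(G)$ for every node $t$ of $T$; for every vertex $u$ of $G$,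 the set $\{t\in V(T):u\in X_t\}$ induces a non-empty subtree of $T$; and for every edge $uv$ of $G$ there is some node $t$ of $T$ with $u,v\in X_t$. Its width is $\max\{|X_t|:t\in V(T)\}-1$. The tree decomposition is nice if $T$ is a rooted binary tree and every node $t$ of $T$ is of one of the following types: - leaf node: $t$ is a leaf of $T$ and $X_t=\emptyset$; - join node: $t$ has two children $t'$ and $t''$, and $X_t=X_{t'}=X_{t''}$; - introduce node: $t$ has a unique child $t'$, $|X_t\setminus X_{t'}|=1$ and $|X_{t'}\setminus X_t|=0$; - forget node: $t$ has a unique child $t'$, $|X_{t'}\setminus X_t|=1$ and $|X_t\setminus X_{t'}|=0$. -}

module Defs where

open import Data.Bool using (Bool; true; false)
open import Data.Fin using (Fin; zero; suc)
open import Data.Fin.Subset using (Subset; ⊥; ⊤; _∈_; _∉_; _∩_; _─_; ∣_∣)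
open import Data.Nat using (ℕ; zero; suc; _+_; _*_; _∸_; _^_; _⊔_; _≤_; _≥_; _≤?_)
open import Data.Product using (Σ-syntax; ∃-syntax; _×_; proj₁)
open import Data.Sum using (_⊎_)
open import Data.Vec using (Vec; []; _∷_; lookup; map; tabulate)
open import Relation.Binary.Construct.Closure.Equivalence using (EqClosure)
open import Relation.Binary.PropositionalEquality using (_≡_)
open import Relation.Nullary.Decidable using (⌊_⌋)

-- Since graphs are inputs of an algorithm, the vertex set is Fin n and
-- adjacency is given by the (decidable) neighbourhoods.

record Graph (n : ℕ) : Set where
  field
    N      : Fin n → Subset n
    irrefl : ∀ u → u ∉ N u
    sym    : ∀ {u v} → v ∈ N u → u ∈ N v

open Graph public using (N)

deg : ∀ {n} → Graph n → Fin n → ℕ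
deg G u = ∣ N G u ∣

Threshold : ℕ → Set
Threshold n = Fin n → ℕ

record Restricted {n} (G : Graph n) (τ : Threshold n) : Set where
  field
    ≤-deg  : ∀ u → τ u ≤ deg G u
    values : ∀ u → τ u ≡ 0 ⊎ τ u ≡ 1 ⊎ τ u ≡ deg G u

activation : ∀ {n} → Graph n → Threshold n → Subset n → ℕ → Subset n
activation G τ X zero    = X
activation G τ X (suc s) =
  tabulate λ u → ⌊ τ u ≤? ∣ N G u ∩ activation G τ X s ∣ ⌋

IsTargetSet : ∀ {n} → Graph n → Threshold n → Subset n → Set
IsTargetSet G τ X = ∃[ s₀ ] (∀ s → s ≥ s₀ → activation G τ X s ≡ ⊤)

IsMinimumOrder : ∀ {n} → Graph n → Threshold n → ℕ → Set
IsMinimumOrder G τ k =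
  (∃[ X ] (IsTargetSet G τ X × ∣ X ∣ ≡ k)) ×
  (∀ X → IsTargetSet G τ X → k ≤ ∣ X ∣)

-- Rooted trees in which every node has at most two children, together
-- with a bag at each node.

data BagTree (n : ℕ) : Set where
  node₀ : Subset n → BagTree n
  node₁ : Subset n → BagTree n → BagTree n
  node₂ : Subset n → BagTree n → BagTree n → BagTree n

rootBag : ∀ {n} → BagTree n → Subset n
rootBag (node₀ X)     = X
rootBag (node₁ X _)   = X
rootBag (node₂ X _ _) = X

order : ∀ {n} → BagTree n → ℕ
order (node₀ _)     = 1
order (node₁ _ T)   = 1 + order T
order (node₂ _ T U) = 1 + (order T + order U)

maxBag : ∀ {n} → BagTree n → ℕ
maxBag (node₀ X)     = ∣ X ∣
maxBag (node₁ X T)   = ∣ X ∣ ⊔ maxBag T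
maxBag (node₂ X T U) = ∣ X ∣ ⊔ (maxBag T ⊔ maxBag U)

-- The truncation only matters if every bag is empty. For a tree
-- decomposition this means n = 0, where the width is 0 here instead
-- of -1; a time bound 2 ^ (5 * w) * order T * poly n is insensitive to
-- this because it allows an arbitrary constant factor at n = 0.

width : ∀ {n} → BagTree n → ℕ
width T = maxBag T ∸ 1

data Node {n} : BagTree n → Set where
  root  : ∀ {T} → Node T
  only  : ∀ {X T} → Node T → Node (node₁ X T)
  left  : ∀ {X T U} → Node T → Node (node₂ X T U)
  right : ∀ {X T U} → Node U → Node (node₂ X T U)

bag : ∀ {n} {T : BagTree n} → Node T → Subset n
bag {T = T} root = rootBag T
bag (only t)     = bag t
bag (left t)     = bag t
bag (right t)    = bag t

-- ParentOf s t: s is the parent of t. The edges of the tree are these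
-- pairs, taken in either direction.

data ParentOf {n} : {T : BagTree n} → Node T → Node T → Set where
  root-only  : ∀ {X T}   → ParentOf {T = node₁ X T} root (only root)
  root-left  : ∀ {X T U} → ParentOf {T = node₂ X T U} root (left root)
  root-right : ∀ {X T U} → ParentOf {T = node₂ X T U} root (right root)
  only  : ∀ {X T} {s t : Node T} →
          ParentOf s t → ParentOf {T = node₁ X T} (only s) (only t)
  left  : ∀ {X T U} {s t : Node T} →
          ParentOf s t → ParentOf {T = node₂ X T U} (left s) (left t)
  right : ∀ {X T U} {s t : Node U} →
          ParentOf s t → ParentOf {T = node₂ X T U} (right s) (right t)

-- The nodes whose bag contains u, and paths in the subgraph they induce.

Occurrence : ∀ {n} → BagTree n → Fin n → Set
Occurrence T u = Σ[ t ∈ Node T ] u ∈ bag t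

Linked : ∀ {n} (T : BagTree n) (u : Fin n) → Occurrence T u → Occurrence T u → Set
Linked T u = EqClosure λ s t → ParentOf (proj₁ s) (proj₁ t)

record IsTreeDecomposition {n} (G : Graph n) (T : BagTree n) : Set where
  field
    nonempty  : ∀ u → Occurrence T u
    connected : ∀ u (s t : Occurrence T u) → Linked T u s t
    edges     : ∀ {u v} → v ∈ N G u → Σ[ t ∈ Node T ] (u ∈ bag t × v ∈ bag t)

data Nice {n} : BagTree n → Set where
  leaf      : ∀ {X} → X ≡ ⊥ → Nice (node₀ X)
  join      : ∀ {X T U} → X ≡ rootBag T → X ≡ rootBag U →
              Nice T → Nice U → Nice (node₂ X T U)
  introduce : ∀ {X T} → ∣ X ─ rootBag T ∣ ≡ 1 → ∣ rootBag T ─ X ∣ ≡ 0 →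
              Nice T → Nice (node₁ X T)
  forget    : ∀ {X T} → ∣ rootBag T ─ X ∣ ≡ 1 → ∣ X ─ rootBag T ∣ ≡ 0 →
              Nice T → Nice (node₁ X T)

-- Model of computation: first-order recursive programs whose only data
-- are binary trees (cons cells), as in Lisp or in Jones' languages F and
-- WHILE. Call-by-value and administrative normal form. With cells
-- shared through pointers, each evaluation step costs a random access
-- machine an amount of work depending on the fixed program only, so
-- running time here bounds running time on such a machine up to a
-- constant factor.

data Data : Set where
  nil  : Data
  cons : Data → Data → Data

-- Terms over functions with the given arities, with v variables in scope
-- (de Bruijn indices). In `match x e₀ e₁`, variables 0 and 1 of e₁ are
-- the two components of x; in `bind e e′`, variable 0 of e′ is the value
-- of e.

data Term {m} (arity : Fin m → ℕ) (v : ℕ) : Set where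
  var   : Fin v → Term arity v
  nil   : Term arity v
  cons  : Fin v → Fin v → Term arity v
  match : Fin v → Term arity v → Term arity (2 + v) → Term arity v
  bind  : Term arity v → Term arity (1 + v) → Term arity v
  call  : (f : Fin m) → Vec (Fin v) (arity f) → Term arity v

record Program : Set where
  field
    functions : ℕ
    arity     : Fin functions → ℕ
    body      : (f : Fin functions) → Term arity (arity f)
    main      : Term arity 1

-- P ⨾ ρ ⊢ e ⇓ d ⟨ t ⟩: in environment ρ, the term e of P evaluates to d
-- in exactly t steps.

infix 4 _⨾_⊢_⇓_⟨_⟩

data _⨾_⊢_⇓_⟨_⟩ (P : Program) {v} (ρ : Vec Data v) :
     Term (Program.arity P) v → Data → ℕ → Set where

  var : ∀ {x} → P ⨾ ρ ⊢ var x ⇓ lookup ρ x ⟨ 1 ⟩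

  nil : P ⨾ ρ ⊢ nil ⇓ nil ⟨ 1 ⟩

  cons : ∀ {x y} → P ⨾ ρ ⊢ cons x y ⇓ cons (lookup ρ x) (lookup ρ y) ⟨ 1 ⟩

  match-nil : ∀ {x e₀ e₁ d t} →
    lookup ρ x ≡ nil →
    P ⨾ ρ ⊢ e₀ ⇓ d ⟨ t ⟩ →
    P ⨾ ρ ⊢ match x e₀ e₁ ⇓ d ⟨ 1 + t ⟩

  match-cons : ∀ {x e₀ e₁ a b d t} →
    lookup ρ x ≡ cons a b →
    P ⨾ a ∷ b ∷ ρ ⊢ e₁ ⇓ d ⟨ t ⟩ →
    P ⨾ ρ ⊢ match x e₀ e₁ ⇓ d ⟨ 1 + t ⟩

  bind : ∀ {e e′ a d t t′} →
    P ⨾ ρ ⊢ e ⇓ a ⟨ t ⟩ →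
    P ⨾ a ∷ ρ ⊢ e′ ⇓ d ⟨ t′ ⟩ →
    P ⨾ ρ ⊢ bind e e′ ⇓ d ⟨ 1 + (t + t′) ⟩

  call : ∀ {f xs d t} →
    P ⨾ map (lookup ρ) xs ⊢ Program.body P f ⇓ d ⟨ t ⟩ →
    P ⨾ ρ ⊢ call f xs ⇓ d ⟨ 1 + t ⟩

Run : Program → Data → Data → ℕ → Set
Run P input output t = P ⨾ input ∷ [] ⊢ Program.main P ⇓ output ⟨ t ⟩

-- Encoding of inputs and outputs. Numbers are unary; all numbers
-- involved are at most n, so this is harmless up to a factor poly n. A
-- graph is given by its adjacency matrix, a bag by its characteristic
-- vector, a tree node by its bag and the list of its children.

encodeℕ : ℕ → Data
encodeℕ zero    = nil
encodeℕ (suc k) = cons nil (encodeℕ k)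

encodeBool : Bool → Data
encodeBool false = nil
encodeBool true  = cons nil nil

encodeVec : ∀ {A : Set} {k} → (A → Data) → Vec A k → Data
encodeVec enc []       = nil
encodeVec enc (x ∷ xs) = cons (enc x) (encodeVec enc xs)

encodeSubset : ∀ {n} → Subset n → Data
encodeSubset = encodeVec encodeBool

encodeGraph : ∀ {n} → Graph n → Data
encodeGraph G = encodeVec encodeSubset (tabulate (N G))

encodeThreshold : ∀ {n} → Threshold n → Data
encodeThreshold τ = encodeVec encodeℕ (tabulate τ)

encodeTree : ∀ {n} → BagTree n → Data
encodeTree (node₀ X)     = cons (encodeSubset X) nil
encodeTree (node₁ X T)   = cons (encodeSubset X) (cons (encodeTree T) nil)
encodeTree (node₂ X T U) =
  cons (encodeSubset X) (cons (encodeTree T) (cons (encodeTree U) nil))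

encodeInput : ∀ {n} → Graph n → Threshold n → BagTree n → Data
encodeInput G τ T = cons (encodeGraph G) (cons (encodeThreshold τ) (encodeTree T))

-- Every polynomial is bounded by one of the form c * n ^ k + c.

PolynomiallyBounded : (ℕ → ℕ) → Set
PolynomiallyBounded p = ∃[ c ] ∃[ k ] (∀ n → p n ≤ c * n ^ k + c)

{-# OPTIONS --safe #-}
{-
Call a vertex zero, OR or AND according to whether its threshold is 0, 1, or at
least 2 (and hence the degree). Write Y₁ for the first step of the process from X,
and call a walk all of whose vertices except possibly the last are OR vertices an
OR walk. Then X is a target set if and only if

 (1) every AND vertex with an AND neighbour belongs to X, and so do its neighbours;
 (2) every OR vertex all of whose neighbours are AND vertices has a neighbour whose
     neighbourhood is contained in X, and one whose neighbourhood is contained in Y₁;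
 (3) for every OR vertex u and each parity, some OR walk of that parity from u ends
     in X, unless such a walk ends at a zero vertex or next to one after an OR vertex.

The conditions are necessary because inactivity otherwise survives at every second
step, bouncing between a vertex and its neighbours; they are sufficient because
activity survives in the same way.

The conditions amount to marks at the vertices, claiming membership in X, in Y₁ and
in Y₂, that are checked along edges, and to demands for suitably marked vertices. A
demand of type (3) is shared by all vertices from which the same vertices are reached
by OR walks. A dynamic program over the tree decomposition only needs the marks of the
vertices in a bag and which of their demands are met below. A vertex has at most
27 ≤ 2⁵ labels that consist of its marks and, for each demand, of the place where it is
met (left child, right child or current bag, or not yet), so a node with bags of size
at most w + 1 costs 32^(w + 1) times a polynomial; this also covers join nodes, since a
label determines the states of both children.
-}
module Submission where

open import Defs
open import Data.Bool using (Bool; true; false; _∧_; _∨_; not; if_then_else_)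
open import Data.Bool.Properties using (not-involutive; T?; T-≡) renaming (_≟_ to _≟ᵇ_)
open import Data.Empty using (⊥; ⊥-elim)
open import Data.Fin using (Fin; zero; suc; toℕ; _↑ˡ_; _↑ʳ_; splitAt)
open import Data.Fin.Properties using (splitAt-↑ˡ; splitAt-↑ʳ; any?; all?; ¬∀⟶∃¬)
open import Data.Fin.Subset using (Subset; ∣_∣; _─_; _∩_) renaming (_∈_ to _∈ₛ_; ⊤ to full)
open import Data.List using (List; []; _∷_; filterᵇ; length; map; _++_)
open import Data.List.Membership.Propositional using (_∈_)
open import Data.List.Membership.Propositional.Properties using (∈-++⁺ˡ; ∈-++⁺ʳ; ∈-map⁺; ∈-filter⁺)
open import Data.List.Relation.Unary.Any using (here; there)
open import Data.Maybe using (Maybe; just; nothing)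
open import Data.Maybe.Properties using (just-injective)
open import Data.Nat using (ℕ; zero; suc; _+_; _*_; _^_; _≤_; z≤n; s≤s; _⊓_; _⊔_; _<_; _≤?_)
open import Data.Nat.Properties
open import Data.Nat.Tactic.RingSolver using (solve-∀)
open import Data.Product using (_×_; _,_; proj₁; proj₂; ∃-syntax; Σ-syntax)
open import Data.Sum using ([_,_]′; _⊎_; inj₁; inj₂)
open import Data.Unit using (⊤; tt)
open import Data.Vec using (Vec; []; _∷_; lookup; tabulate; foldr′; replicate; _[_]=_)
open import Data.Vec.Properties using (lookup∘tabulate; tabulate-cong; lookup-replicate; tabulate∘lookup; lookup-zipWith; []=⇒lookup; lookup⇒[]=)
open import Function using (_∘_; id; case_of_; Equivalence)
open import Relation.Binary.Construct.Closure.ReflexiveTransitive using (ε; _◅_; _◅◅_)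
open import Relation.Binary.Construct.Closure.Symmetric using (fwd; bwd)
open import Relation.Binary.PropositionalEquality using (_≡_; refl; sym; trans; cong; subst; cong₂; _≢_; subst₂)
open import Relation.Nullary using (Dec; yes; no; contradiction; ¬_)
open import Relation.Nullary.Decidable using (_×-dec_; _→-dec_; _⊎-dec_; decidable-stable; toWitness; fromWitness)

-- Dynamic programs for conditions about walks usually record how the vertices of a bag are
-- connected below it, and the partitions of a bag outnumber every power c^w. Here OR walks depend
-- on the graph and the thresholds but not on X. Reachability is therefore computed from the input,
-- and a label only says where each demand is met. A bag vertex can speak for a forgotten vertex
-- because an edge between OR vertices can be traversed both ways: its ends reach the same vertices,
-- with opposite parities. A bag vertex that keeps no record of such a demand is one that visibly
-- meets it.
--
-- The bound 2^(5w) has to hold for the exact steps of a program. Hence the algorithm is written in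
-- a total language with recursion on cons cells, whose compiled code has a step count given by
-- recursion on the source, and mostly in typed expressions above it, where loops run over the
-- vertices and polynomial bounds compose. Tables are tries indexed by keys: searching a list of
-- exponentially many entries for every label would multiply the exponential factor into itself.

private
  variable
    A : Set
    r : Bool
    k l m n v w : ℕ

-- A total language and its compiler

mutual
  data Tm : Bool → ℕ → Set where
    var   : ∀ {r v} → Fin v → Tm r v
    nil   : ∀ {r v} → Tm r v
    cons  : ∀ {r v} → Tm r v → Tm r v → Tm r v
    match : ∀ {r v} → Tm r v → Tm r v → Tm r (2 + v) → Tm r v
    call  : ∀ {r v k} → Tm false k → Args r v k → Tm r v
    rec   : ∀ {r v} → Tm r v → Tm r v → Tm false (1 + v) → Tm true (3 + v) → Tm r v
    selfˡ selfʳ : ∀ {v} → Tm true v → Tm true v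

  data Args (r : Bool) (v : ℕ) : ℕ → Set where
    []  : Args r v 0
    _∷_ : ∀ {k} → Tm r v → Args r v k → Args r v (suc k)

-- The outcomes of the recursive calls on the two components of the current cell, as functions of
-- the new parameter: values for `Data`, costs for `ℕ`. The index `false` admits no recursive calls.
Self : Bool → Set → Set
Self false A = ⊤
Self true  A = (Data → A) × (Data → A)

matchD : {A : Set} → Data → A → (Data → Data → A) → A
matchD nil        x f = x
matchD (cons a b) x f = f a b

mutual
  ⟦_⟧ : ∀ {r v} → Tm r v → Vec Data v → Self r Data → Data
  ⟦ var x ⟧ ρ s = lookup ρ x
  ⟦ nil ⟧ ρ s = nil
  ⟦ cons t u ⟧ ρ s = cons (⟦ t ⟧ ρ s) (⟦ u ⟧ ρ s)
  ⟦ match t u w ⟧ ρ s = matchD (⟦ t ⟧ ρ s) (⟦ u ⟧ ρ s) λ a b → ⟦ w ⟧ (a ∷ b ∷ ρ) s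
  ⟦ call t ts ⟧ ρ s = ⟦ t ⟧ (⟦ ts ⟧* ρ s) tt
  ⟦ rec t u w c ⟧ ρ s = recV w c ρ (⟦ t ⟧ ρ s) (⟦ u ⟧ ρ s)
  ⟦ selfˡ t ⟧ ρ s = proj₁ s (⟦ t ⟧ ρ s)
  ⟦ selfʳ t ⟧ ρ s = proj₂ s (⟦ t ⟧ ρ s)

  ⟦_⟧* : ∀ {r v k} → Args r v k → Vec Data v → Self r Data → Vec Data k
  ⟦ [] ⟧* ρ s = []
  ⟦ t ∷ ts ⟧* ρ s = ⟦ t ⟧ ρ s ∷ ⟦ ts ⟧* ρ s

  recV : ∀ {v} → Tm false (1 + v) → Tm true (3 + v) → Vec Data v → Data → Data → Data
  recV w c ρ nil        p = ⟦ w ⟧ (p ∷ ρ) tt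
  recV w c ρ (cons a b) p = ⟦ c ⟧ (a ∷ b ∷ p ∷ ρ) (recV w c ρ a , recV w c ρ b)

mutual
  -- This is the exact number of steps of the compiled code, so each constant counts the
  -- instructions that `comp` emits.
  cost : ∀ {r v} → Tm r v → Vec Data v → Self r Data → Self r ℕ → ℕ
  cost (var x) ρ s κ = 2 + toℕ x
  cost nil ρ s κ = 1
  cost (cons t u) ρ s κ = 1 + (cost t ρ s κ + (1 + (cost u ρ s κ + 1)))
  cost (match t u w) ρ s κ =
    1 + (cost t ρ s κ +
      (1 + matchD (⟦ t ⟧ ρ s) (cost u ρ s κ) λ a b → 4 + cost w (a ∷ b ∷ ρ) s κ))
  cost (call t ts) ρ s κ = 1 + (cost* ts ρ s κ + cost t (⟦ ts ⟧* ρ s) tt tt)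
  cost (rec t u w c) ρ s κ =
    1 + (cost t ρ s κ + (1 + (cost u ρ s κ + (1 + recC w c ρ (⟦ t ⟧ ρ s) (⟦ u ⟧ ρ s)))))
  cost (selfˡ t) ρ s κ = 1 + (cost t ρ s κ + (1 + proj₁ κ (⟦ t ⟧ ρ s)))
  cost (selfʳ t) ρ s κ = 1 + (cost t ρ s κ + (1 + proj₂ κ (⟦ t ⟧ ρ s)))

  cost* : ∀ {r v k} → Args r v k → Vec Data v → Self r Data → Self r ℕ → ℕ
  cost* [] ρ s κ = 1
  cost* (t ∷ ts) ρ s κ = 1 + (cost* ts ρ s κ + (1 + (cost t ρ s κ + 1)))

  recC : ∀ {v} → Tm false (1 + v) → Tm true (3 + v) → Vec Data v → Data → Data → ℕ
  recC w c ρ nil        p = 3 + cost w (p ∷ ρ) tt tt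
  recC w c ρ (cons a b) p =
    7 + cost c (a ∷ b ∷ p ∷ ρ) (recV w c ρ a , recV w c ρ b) (recC w c ρ a , recC w c ρ b)

mutual
  -- Only `rec` becomes a function of the target program, since the callee of a `call` is compiled
  -- in place. Hence this number is the number of functions.
  loops : ∀ {r v} → Tm r v → ℕ
  loops (var x) = 0
  loops nil = 0
  loops (cons t u) = loops t + loops u
  loops (match t u w) = loops t + (loops u + loops w)
  loops (call t ts) = loops t + loops* ts
  loops (rec t u w c) = suc (loops t + (loops u + (loops w + loops c)))
  loops (selfˡ t) = loops t
  loops (selfʳ t) = loops t

  loops* : ∀ {r v k} → Args r v k → ℕ
  loops* [] = 0
  loops* (t ∷ ts) = loops t + loops* ts

split : ∀ {a b} {B : Set} → (Fin a → B) → (Fin b → B) → Fin (a + b) → B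
split {a} f g i = [ f , g ]′ (splitAt a i)

split-↑ˡ : ∀ {a b} {B : Set} (f : Fin a → B) (g : Fin b → B) i → split f g (i ↑ˡ b) ≡ f i
split-↑ˡ {a} {b} f g i = cong [ f , g ]′ (splitAt-↑ˡ a i b)

split-↑ʳ : ∀ {a b} {B : Set} (f : Fin a → B) (g : Fin b → B) i → split f g (a ↑ʳ i) ≡ g i
split-↑ʳ {a} {b} f g i = cong [ f , g ]′ (splitAt-↑ʳ a b i)

Code : ℕ → ℕ → Set
Code m w = Term {m} (λ _ → 3) w

-- Where a loop body finds its own function and the data for its recursive
-- calls: the environment of the loop and the two components of the current
-- cell.
record Frame (m w : ℕ) : Set where
  constructor frame
  field
    fun        : Fin m
    env hd tl  : Fin w

Frame? : Bool → ℕ → ℕ → Set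
Frame? false m w = ⊤
Frame? true  m w = Frame m w

↑_ : ∀ {r m w} → Frame? r m w → Frame? r m (suc w)
↑_ {false} L = tt
↑_ {true} (frame f e a b) = frame f (suc e) (suc a) (suc b)

fetch : ∀ {m v w} → Fin v → Fin w → Code m w
fetch zero    e = match e nil (var zero)
fetch (suc x) e = match e nil (fetch x (suc zero))

module _ {m : ℕ} where
  mutual
    -- `ι` places the loops of the term among all functions. The single target variable `e` holds
    -- the whole source environment as a list, so intermediate results never shift the source
    -- variables.
    comp : (t : Tm r v) → (Fin (loops t) → Fin m) → Frame? r m w → Fin w → Code m w
    comp (var x) ι L e = fetch x e
    comp nil ι L e = nil
    comp (cons t u) ι L e =
      bind (comp t (ι ∘ (_↑ˡ loops u)) L e)
      (bind (comp u (ι ∘ (loops t ↑ʳ_)) (↑ L) (suc e))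
      (cons (suc zero) zero))
    comp (match t u w) ι L e =
      bind (comp t (ι ∘ (_↑ˡ _)) L e)
      (match zero (comp u (ι ∘ (loops t ↑ʳ_) ∘ (_↑ˡ _)) (↑ L) (suc e))
        (bind (cons (suc zero) (suc (suc (suc e))))
        (bind (cons (suc zero) zero)
        (comp w (ι ∘ (loops t ↑ʳ_) ∘ (loops u ↑ʳ_)) (↑ ↑ ↑ ↑ ↑ L) zero))))
    comp (call t ts) ι L e =
      bind (comp* ts (ι ∘ (loops t ↑ʳ_)) L e)
      (comp t (ι ∘ (_↑ˡ _)) tt zero)
    comp (rec t u w c) ι L e =
      bind (comp t (ι ∘ suc ∘ (_↑ˡ _)) L e)
      (bind (comp u (ι ∘ suc ∘ (loops t ↑ʳ_) ∘ (_↑ˡ _)) (↑ L) (suc e))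
      (call (ι zero) (suc (suc e) ∷ suc zero ∷ zero ∷ [])))
    comp (selfˡ t) ι L e =
      bind (comp t ι L e) (call (Frame.fun L) (suc (Frame.env L) ∷ suc (Frame.hd L) ∷ zero ∷ []))
    comp (selfʳ t) ι L e =
      bind (comp t ι L e) (call (Frame.fun L) (suc (Frame.env L) ∷ suc (Frame.tl L) ∷ zero ∷ []))

    comp* : (ts : Args r v k) → (Fin (loops* ts) → Fin m) → Frame? r m w → Fin w → Code m w
    comp* [] ι L e = nil
    comp* (t ∷ ts) ι L e =
      bind (comp* ts (ι ∘ (loops t ↑ʳ_)) L e)
      (bind (comp t (ι ∘ (_↑ˡ _)) (↑ L) (suc e))
      (cons zero (suc zero)))

  -- The three arguments of a loop function are the environment, the data recursed on and the
  -- parameter. Both branches first extend the environment by what their code expects.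
  loop : (w : Tm false (1 + v)) (c : Tm true (3 + v)) → (Fin (loops w) → Fin m) →
         (Fin (loops c) → Fin m) → Fin m → Code m 3
  loop w c ι ι′ f =
    match (suc zero)
      (bind (cons (suc (suc zero)) zero) (comp w ι tt zero))
      (bind (cons (suc (suc (suc (suc zero)))) (suc (suc zero)))
      (bind (cons (suc (suc zero)) zero)
      (bind (cons (suc (suc zero)) zero)
      (comp c ι′ (frame f (suc (suc (suc (suc (suc zero))))) (suc (suc (suc zero)))
                          (suc (suc (suc (suc zero))))) zero))))

  mutual
    bodies : (t : Tm r v) → (Fin (loops t) → Fin m) → Fin (loops t) → Code m 3
    bodies (var x) ι ()
    bodies nil ι ()
    bodies (cons t u) ι = split (bodies t (ι ∘ (_↑ˡ _))) (bodies u (ι ∘ (loops t ↑ʳ_)))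
    bodies (match t u w) ι =
      split (bodies t (ι ∘ (_↑ˡ _)))
      (split (bodies u (ι ∘ (loops t ↑ʳ_) ∘ (_↑ˡ _)))
             (bodies w (ι ∘ (loops t ↑ʳ_) ∘ (loops u ↑ʳ_))))
    bodies (call t ts) ι = split (bodies t (ι ∘ (_↑ˡ _))) (bodies* ts (ι ∘ (loops t ↑ʳ_)))
    bodies (rec t u w c) ι zero =
      loop w c (ι ∘ suc ∘ (loops t ↑ʳ_) ∘ (loops u ↑ʳ_) ∘ (_↑ˡ _))
               (ι ∘ suc ∘ (loops t ↑ʳ_) ∘ (loops u ↑ʳ_) ∘ (loops w ↑ʳ_)) (ι zero)
    bodies (rec t u w c) ι (suc i) =
      split (bodies t (ι ∘ suc ∘ (_↑ˡ _)))
      (split (bodies u (ι ∘ suc ∘ (loops t ↑ʳ_) ∘ (_↑ˡ _)))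
      (split (bodies w (ι ∘ suc ∘ (loops t ↑ʳ_) ∘ (loops u ↑ʳ_) ∘ (_↑ˡ _)))
             (bodies c (ι ∘ suc ∘ (loops t ↑ʳ_) ∘ (loops u ↑ʳ_) ∘ (loops w ↑ʳ_))))) i
    bodies (selfˡ t) ι = bodies t ι
    bodies (selfʳ t) ι = bodies t ι

    bodies* : (ts : Args r v k) → (Fin (loops* ts) → Fin m) → Fin (loops* ts) → Code m 3
    bodies* [] ι ()
    bodies* (t ∷ ts) ι = split (bodies t (ι ∘ (_↑ˡ _))) (bodies* ts (ι ∘ (loops t ↑ʳ_)))

compile : Tm false 1 → Program
compile t = record
  { functions = loops t
  ; arity     = λ _ → 3
  ; body      = bodies t id
  ; main      = bind nil (bind (cons (suc zero) zero) (comp t id tt zero))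
  }

encodeEnv : Vec Data v → Data
encodeEnv = encodeVec id

module _ {m : ℕ} (body : Fin m → Code m 3) (main : Code m 1) where

  private
    P : Program
    P = record { functions = m ; arity = λ _ → 3 ; body = body ; main = main }

  -- The invariant of compilation inside a loop body: calls through the frame have the promised
  -- values and costs at every parameter. Outside loop bodies there is nothing to promise.
  FrameOK : ∀ {w} (r : Bool) → Vec Data w → Frame? r m w → Self r Data → Self r ℕ → Set
  FrameOK false σ L s κ = ⊤
  FrameOK true σ (frame f e a b) (φ , ψ) (κ , μ) =
    (∀ p → P ⨾ lookup σ e ∷ lookup σ a ∷ p ∷ [] ⊢ body f ⇓ φ p ⟨ κ p ⟩) ×
    (∀ p → P ⨾ lookup σ e ∷ lookup σ b ∷ p ∷ [] ⊢ body f ⇓ ψ p ⟨ μ p ⟩)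

  ↑OK : ∀ {w} r {σ : Vec Data w} {L s κ d} → FrameOK r σ L s κ → FrameOK r (d ∷ σ) (↑ L) s κ
  ↑OK false x = tt
  ↑OK true  x = x

  fetch-ok : ∀ {w} (x : Fin v) (e : Fin w) (σ : Vec Data w) (ρ : Vec Data v) →
             lookup σ e ≡ encodeEnv ρ → P ⨾ σ ⊢ fetch x e ⇓ lookup ρ x ⟨ 2 + toℕ x ⟩
  fetch-ok zero    e σ (d ∷ ρ) eq = match-cons eq var
  fetch-ok (suc x) e σ (d ∷ ρ) eq = match-cons eq (fetch-ok x (suc zero) _ ρ refl)

  Linked′ : ∀ {a} → (Fin a → Fin m) → (Fin a → Code m 3) → Set
  Linked′ ι B = ∀ i → body (ι i) ≡ B i

  linkˡ : ∀ {a b} {ι : Fin (a + b) → Fin m} (f : Fin a → Code m 3) (g : Fin b → Code m 3) →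
          Linked′ ι (split f g) → Linked′ (ι ∘ (_↑ˡ b)) f
  linkˡ f g H i = trans (H _) (split-↑ˡ f g i)

  linkʳ : ∀ {a b} {ι : Fin (a + b) → Fin m} (f : Fin a → Code m 3) (g : Fin b → Code m 3) →
          Linked′ ι (split f g) → Linked′ (ι ∘ (a ↑ʳ_)) g
  linkʳ f g H i = trans (H _) (split-↑ʳ f g i)

  mutual
    comp-ok : ∀ {w} (t : Tm r v) {ι} → Linked′ ι (bodies t ι) →
              {L : Frame? r m w} {e : Fin w} {σ : Vec Data w} {ρ : Vec Data v}
              {s : Self r Data} {κ : Self r ℕ} →
              FrameOK r σ L s κ → lookup σ e ≡ encodeEnv ρ →
              P ⨾ σ ⊢ comp t ι L e ⇓ ⟦ t ⟧ ρ s ⟨ cost t ρ s κ ⟩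
    comp-ok (var x) H F eq = fetch-ok x _ _ _ eq
    comp-ok nil H F eq = nil
    comp-ok {r = r} (cons t u) H F eq =
      bind (comp-ok t (linkˡ _ _ H) F eq)
      (bind (comp-ok u (linkʳ (bodies t _) _ H) (↑OK r F) eq) cons)
    comp-ok {r = r} (match t u w) H {L} {e} {σ} {ρ} {s} {κ} F eq =
      bind (comp-ok t (linkˡ _ _ H) F eq) (branch (⟦ t ⟧ ρ s))
      where
      H′ = linkʳ (bodies t _) _ H
      branch : ∀ d → P ⨾ d ∷ σ ⊢ _ ⇓ matchD d (⟦ u ⟧ ρ s) (λ a b → ⟦ w ⟧ (a ∷ b ∷ ρ) s)
               ⟨ 1 + matchD d (cost u ρ s κ) (λ a b → 4 + cost w (a ∷ b ∷ ρ) s κ) ⟩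
      branch nil = match-nil refl (comp-ok u (linkˡ _ _ H′) (↑OK r F) eq)
      branch (cons a b) = match-cons refl (bind cons (bind cons
        (comp-ok w (linkʳ (bodies u _) _ H′) (↑OK r (↑OK r (↑OK r (↑OK r (↑OK r F)))))
          (cong (λ z → cons a (cons b z)) eq))))
    comp-ok (call t ts) H F eq =
      bind (comp*-ok ts (linkʳ (bodies t _) _ H) F eq) (comp-ok t (linkˡ _ _ H) tt refl)
    comp-ok {r = r} (rec t u w c) {ι} H {σ = σ} {ρ} {s} F eq =
      bind (comp-ok t (linkˡ _ _ (H ∘ suc)) F eq)
      (bind (comp-ok u (linkˡ _ _ H₁) (↑OK r F) eq)
      (call (subst (λ z → P ⨾ z ∷ _ ⊢ _ ⇓ _ ⟨ _ ⟩) (sym eq)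
              (loop-ok (ι zero) (H zero) (linkˡ _ _ H₂) (linkʳ (bodies w _) _ H₂) (⟦ t ⟧ ρ s) (⟦ u ⟧ ρ s)))))
      where
      H₁ = linkʳ (bodies t _) _ (H ∘ suc)
      H₂ = linkʳ (bodies u _) _ H₁
      loop-ok : ∀ {ι₁ ι₂} (f : Fin m) → body f ≡ loop w c ι₁ ι₂ f →
                Linked′ ι₁ (bodies w ι₁) → Linked′ ι₂ (bodies c ι₂) → ∀ d p →
                P ⨾ encodeEnv ρ ∷ d ∷ p ∷ [] ⊢ body f ⇓ recV w c ρ d p ⟨ recC w c ρ d p ⟩
      loop-ok f eq₀ Hw Hc nil p = subst (λ z → P ⨾ _ ⊢ z ⇓ _ ⟨ _ ⟩) (sym eq₀)
        (match-nil refl (bind cons (comp-ok w Hw tt refl)))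
      loop-ok f eq₀ Hw Hc (cons a b) p = subst (λ z → P ⨾ _ ⊢ z ⇓ _ ⟨ _ ⟩) (sym eq₀)
        (match-cons refl (bind cons (bind cons (bind cons
          -- The frame of the body is justified by the induction hypotheses for the two components.
          (comp-ok c Hc (loop-ok f eq₀ Hw Hc a , loop-ok f eq₀ Hw Hc b) refl)))))
    comp-ok (selfˡ t) H F eq = bind (comp-ok t H F eq) (call (proj₁ F _))
    comp-ok (selfʳ t) H F eq = bind (comp-ok t H F eq) (call (proj₂ F _))

    comp*-ok : ∀ {w} (ts : Args r v k) {ι} → Linked′ ι (bodies* ts ι) →
               {L : Frame? r m w} {e : Fin w} {σ : Vec Data w} {ρ : Vec Data v}
               {s : Self r Data} {κ : Self r ℕ} →
               FrameOK r σ L s κ → lookup σ e ≡ encodeEnv ρ →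
               P ⨾ σ ⊢ comp* ts ι L e ⇓ encodeEnv (⟦ ts ⟧* ρ s) ⟨ cost* ts ρ s κ ⟩
    comp*-ok [] H F eq = nil
    comp*-ok {r = r} (t ∷ ts) H F eq =
      bind (comp*-ok ts (linkʳ (bodies t _) _ H) F eq)
      (bind (comp-ok t (linkˡ _ _ H) (↑OK r F) eq) cons)

compile-ok : (t : Tm false 1) (d : Data) →
             Run (compile t) d (⟦ t ⟧ (d ∷ []) tt) (4 + cost t (d ∷ []) tt tt)
compile-ok t d = bind nil (bind cons (comp-ok _ _ t (λ _ → refl) tt refl))

-- Typed expressions of polynomial cost

-- The base is 1 + n instead of n because its powers are monotone in the exponent even at n = 0,
-- which is what sums need.
Poly : (ℕ → ℕ) → Set
Poly p = ∃[ c ] ∃[ k ] (∀ n → p n ≤ c * (1 + n) ^ k)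

polyConst : ∀ a → Poly (λ _ → a)
polyConst a = a , 0 , λ n → ≤-reflexive (sym (*-identityʳ a))

polyId : Poly id
polyId = 1 , 1 , λ n → ≤-trans (n≤1+n n) (≤-reflexive (sym (trans (*-identityˡ _) (*-identityʳ (suc n)))))

^-grow : ∀ n k l → (1 + n) ^ k ≤ (1 + n) ^ (k + l)
^-grow n k l = ^-monoʳ-≤ (1 + n) (m≤m+n k l)

poly+ : ∀ {p q} → Poly p → Poly q → Poly (λ n → p n + q n)
poly+ {p} {q} (c , k , f) (d , l , g) = c + d , k + l , λ n → begin
  p n + q n                                   ≤⟨ +-mono-≤ (f n) (g n) ⟩
  c * (1 + n) ^ k + d * (1 + n) ^ l           ≤⟨ +-mono-≤ (*-monoʳ-≤ c (^-grow n k l))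
                                                   (*-monoʳ-≤ d (subst (λ z → (1 + n) ^ l ≤ (1 + n) ^ z)
                                                         (+-comm l k) (^-grow n l k))) ⟩
  c * (1 + n) ^ (k + l) + d * (1 + n) ^ (k + l) ≡⟨ *-distribʳ-+ ((1 + n) ^ (k + l)) c d ⟨
  (c + d) * (1 + n) ^ (k + l)                 ∎
  where open ≤-Reasoning

poly* : ∀ {p q} → Poly p → Poly q → Poly (λ n → p n * q n)
poly* {p} {q} (c , k , f) (d , l , g) = c * d , k + l , λ n → begin
  p n * q n                               ≤⟨ *-mono-≤ (f n) (g n) ⟩
  (c * (1 + n) ^ k) * (d * (1 + n) ^ l)   ≡⟨ swap c _ d _ ⟩
  (c * d) * ((1 + n) ^ k * (1 + n) ^ l)   ≡⟨ cong (c * d *_) (^-distribˡ-+-* (1 + n) k l) ⟨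
  (c * d) * (1 + n) ^ (k + l)             ∎
  where
  open ≤-Reasoning
  swap : ∀ a b c d → (a * b) * (c * d) ≡ (a * c) * (b * d)
  swap = solve-∀

Poly⇒PolynomiallyBounded : ∀ {p} → Poly p → PolynomiallyBounded p
-- The factor 2 ^ k pays for replacing 1 + n by n when n is positive; the additive constant covers n
-- = 0.
Poly⇒PolynomiallyBounded {p} (c , k , f) = c * 2 ^ k , k , λ n → ≤-trans (f n) (bound n)
  where
  open ≤-Reasoning
  bound : ∀ n → c * (1 + n) ^ k ≤ c * 2 ^ k * n ^ k + c * 2 ^ k
  bound zero = begin
    c * 1 ^ k      ≤⟨ *-monoʳ-≤ c (^-monoˡ-≤ k (s≤s z≤n)) ⟩
    c * 2 ^ k      ≤⟨ m≤n+m _ _ ⟩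
    _              ∎
  bound (suc n) = begin
    c * (2 + n) ^ k           ≤⟨ *-monoʳ-≤ c (^-monoˡ-≤ k le) ⟩
    c * (2 * suc n) ^ k       ≡⟨ cong (c *_) (^-distribʳ-* k 2 (suc n)) ⟩
    c * (2 ^ k * suc n ^ k)   ≡⟨ *-assoc c _ _ ⟨
    c * 2 ^ k * suc n ^ k     ≤⟨ m≤m+n _ _ ⟩
    _                         ∎
    where
    le : 2 + n ≤ 2 * suc n
    le = s≤s (subst (suc n ≤_) (sym (+-suc n (n + 0))) (s≤s (m≤m+n n _)))
    ^-distribʳ-* : ∀ k a b → (a * b) ^ k ≡ a ^ k * b ^ k
    ^-distribʳ-* zero a b = refl
    ^-distribʳ-* (suc k) a b = trans (cong (a * b *_) (^-distribʳ-* k a b)) (sw a b (a ^ k) (b ^ k))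
      where
      sw : ∀ a b c d → (a * b) * (c * d) ≡ (a * c) * (b * d)
      sw = solve-∀

-- `raw` is for data without an a priori bound on their size, such as tables. `nat` carries no
-- arithmetic because thresholds are only compared with 0 and 1.
data Ty : Set where
  bool fin nat raw : Ty
  bits : ℕ → Ty
  vec  : Ty → Ty
  _⊗_  : Ty → Ty → Ty

⟪_⟫ : Ty → ℕ → Set
⟪ bool ⟫   n = Bool
⟪ fin ⟫    n = Fin n
⟪ nat ⟫    n = ℕ
⟪ raw ⟫    n = Data
⟪ bits k ⟫ n = Vec Bool k
⟪ vec τ ⟫  n = Vec (⟪ τ ⟫ n) n
⟪ σ ⊗ τ ⟫  n = ⟪ σ ⟫ n × ⟪ τ ⟫ n

enc : ∀ {n} τ → ⟪ τ ⟫ n → Data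
enc bool     b       = encodeBool b
enc fin      i       = encodeℕ (toℕ i)
enc nat      k       = encodeℕ k
enc raw      d       = d
enc (bits k) bs      = encodeVec encodeBool bs
enc (vec τ)  xs      = encodeVec (enc τ) xs
enc (σ ⊗ τ)  (x , y) = cons (enc σ x) (enc τ y)

infixr 5 _∷_

data Env (n : ℕ) : ∀ {k} → Vec Ty k → Set where
  []  : Env n []
  _∷_ : ∀ {k τ} {Γ : Vec Ty k} → ⟪ τ ⟫ n → Env n Γ → Env n (τ ∷ Γ)

value : ∀ {n k} {Γ : Vec Ty k} → Env n Γ → (x : Fin k) → ⟪ lookup Γ x ⟫ n
value (a ∷ ρ) zero    = a
value (a ∷ ρ) (suc x) = value ρ x

encs : ∀ {n k} {Γ : Vec Ty k} → Env n Γ → Vec Data k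
encs []            = []
encs (_∷_ {τ = τ} a ρ) = enc τ a ∷ encs ρ

lookup-encs : ∀ {n k} {Γ : Vec Ty k} (ρ : Env n Γ) x →
              lookup (encs ρ) x ≡ enc (lookup Γ x) (value ρ x)
lookup-encs (a ∷ ρ) zero    = refl
lookup-encs (a ∷ ρ) (suc x) = lookup-encs ρ x

-- The list of all vertices, available to every compiled expression as its
-- variable zero; it drives all loops.
indices : ℕ → Data
indices n = encodeVec (enc {n} fin) (tabulate id)

record Prim {k} (Δ : Vec Ty k) (τ : Ty) : Set where
  field
    fun      : ∀ {n} → Env n Δ → ⟪ τ ⟫ n
    tm       : Tm false (suc k)
    tm-ok    : ∀ {n} (ρ : Env n Δ) → ⟦ tm ⟧ (indices n ∷ encs ρ) tt ≡ enc τ (fun ρ)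
    bound    : ℕ → ℕ
    bound-ok : ∀ {n} (ρ : Env n Δ) → cost tm (indices n ∷ encs ρ) tt tt ≤ bound n
    poly     : Poly bound

private
  variable
    Γ Δ : Vec Ty k
    σ τ : Ty

mutual
  -- Both loops, `tab` and `iter`, run once per vertex, so every expression has polynomial cost as
  -- soon as its primitives have.
  data Ex {k} (Γ : Vec Ty k) : Ty → Set where
    var  : (x : Fin k) → Ex Γ (lookup Γ x)
    prim : Prim Δ τ → Exs Γ Δ → Ex Γ τ
    sub  : Ex Δ τ → Exs Γ Δ → Ex Γ τ
    tab  : Ex (fin ∷ Γ) τ → Ex Γ (vec τ)
    iter : Ex Γ τ → Ex (τ ∷ Γ) τ → Ex Γ τ

  data Exs {k} (Γ : Vec Ty k) : ∀ {l} → Vec Ty l → Set where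
    []  : Exs Γ []
    _∷_ : Ex Γ τ → Exs Γ Δ → Exs Γ (τ ∷ Δ)

iterate : {A : Set} → (A → A) → ℕ → A → A
iterate f zero    x = x
iterate f (suc m) x = iterate f m (f x)

mutual
  eval : Ex Γ τ → Env n Γ → ⟪ τ ⟫ n
  eval (var x)     ρ = value ρ x
  eval (prim p es) ρ = Prim.fun p (evals es ρ)
  eval (sub e es)  ρ = eval e (evals es ρ)
  eval (tab e)     ρ = tabulate λ i → eval e (i ∷ ρ)
  eval {n = n} (iter e e′) ρ = iterate (λ x → eval e′ (x ∷ ρ)) n (eval e ρ)

  evals : Exs Γ Δ → Env n Γ → Env n Δ
  evals []       ρ = []
  evals (e ∷ es) ρ = eval e ρ ∷ evals es ρ

vars : ∀ {r v k} → (Fin k → Fin v) → Args r v k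
vars {k = zero}  f = []
vars {k = suc k} f = var (f zero) ∷ vars (f ∘ suc)

varsCost : ∀ {v k} → (Fin k → Fin v) → ℕ
varsCost {k = zero}  f = 1
varsCost {k = suc k} f = 1 + (varsCost (f ∘ suc) + (1 + ((2 + toℕ (f zero)) + 1)))

cost-vars : ∀ {r v k} (f : Fin k → Fin v) {ρ s κ} → cost* {r} (vars f) ρ s κ ≡ varsCost f
cost-vars {k = zero}  f = refl
cost-vars {k = suc k} f = cong (λ z → 1 + (z + _)) (cost-vars (f ∘ suc))

vars-ok : ∀ {r v k} (f : Fin k → Fin v) {ρ s} {ρ′ : Vec Data k} →
          (∀ x → lookup ρ (f x) ≡ lookup ρ′ x) → ⟦_⟧* {r} (vars f) ρ s ≡ ρ′
vars-ok {k = zero}  f {ρ′ = []}     h = refl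
vars-ok {k = suc k} f {ρ′ = d ∷ ρ′} h = cong₂ _∷_ (h zero) (vars-ok (f ∘ suc) (h ∘ suc))

pattern #0 = zero
pattern #1 = suc #0
pattern #2 = suc #1
pattern #3 = suc #2
pattern #4 = suc #3
pattern #5 = suc #4
pattern #6 = suc #5
pattern #7 = suc #6
pattern #8 = suc #7
pattern #9 = suc #8

-- A loop body sees four variables before those of its context: two components of the cell, the
-- parameter and the vertex list.
past : Fin k → Fin (4 + k)
past x = suc (suc (suc (suc x)))

≤-by : ∀ {a b} x → a + x ≡ b → a ≤ b
≤-by {a} x eq = ≤-trans (m≤m+n a x) (≤-reflexive eq)

opaque
  mutual
    toTm : {Γ : Vec Ty k} → Ex Γ τ → Tm false (suc k)
    toTm (var x)     = var (suc x)
    toTm (prim p es) = call (Prim.tm p) (var #0 ∷ toTms es)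
    toTm (sub e es)  = call (toTm e) (var #0 ∷ toTms es)
    toTm (tab e)     = rec (var #0) nil nil (tabStep e)
    toTm (iter e e′) = rec (var #0) (toTm e) (var #0) (iterStep e′)

    toTms : {Γ : Vec Ty k} {Δ : Vec Ty l} → Exs Γ Δ → Args false (suc k) l
    toTms []       = []
    toTms (e ∷ es) = toTm e ∷ toTms es

    tabStep : {Γ : Vec Ty k} → Ex (fin ∷ Γ) τ → Tm true (3 + suc k)
    tabStep e = cons (call (toTm e) (var #3 ∷ var #0 ∷ vars past)) (selfʳ nil)

    iterStep : {Γ : Vec Ty k} → Ex (τ ∷ Γ) τ → Tm true (3 + suc k)
    iterStep e = selfʳ (call (toTm e) (var #3 ∷ var #2 ∷ vars past))

  mutual
    toTm-ok : (e : Ex Γ τ) (ρ : Env n Γ) → ⟦ toTm e ⟧ (indices n ∷ encs ρ) tt ≡ enc τ (eval e ρ)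
    toTm-ok (var x) ρ = lookup-encs ρ x
    toTm-ok {n = n} (prim p es) ρ =
      trans (cong (λ z → ⟦ Prim.tm p ⟧ (indices n ∷ z) tt) (toTms-ok es ρ)) (Prim.tm-ok p _)
    toTm-ok {n = n} (sub e es) ρ =
      trans (cong (λ z → ⟦ toTm e ⟧ (indices n ∷ z) tt) (toTms-ok es ρ)) (toTm-ok e _)
    toTm-ok {n = n} (tab {τ = τ} e) ρ = go id
      where
      go : ∀ {l} (f : Fin l → Fin n) {p} →
           recV nil (tabStep e) (indices n ∷ encs ρ) (encodeVec (enc {n} fin) (tabulate f)) p ≡
           encodeVec (enc τ) (tabulate λ i → eval e (f i ∷ ρ))
      go {zero}  f = refl
      go {suc l} f = cong₂ cons
        (trans (cong (λ z → ⟦ toTm e ⟧ (indices n ∷ enc {n} fin (f zero) ∷ z) tt) (vars-ok past λ x → refl))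
              (toTm-ok e (f zero ∷ ρ)))
        (go (f ∘ suc))
    toTm-ok {n = n} (iter {τ = τ} e e′) ρ = trans (cong (λ z → recV (var #0) (iterStep e′) _ (indices n) z)
          (toTm-ok e ρ)) (go id _)
      where
      go : ∀ {l} (f : Fin l → Fin n) (x : ⟪ τ ⟫ n) →
           recV (var #0) (iterStep e′) (indices n ∷ encs ρ) (encodeVec (enc {n} fin) (tabulate f)) (enc τ x) ≡
           enc τ (iterate (λ x → eval e′ (x ∷ ρ)) l x)
      go {zero}  f x = refl
      go {suc l} f x = trans
        (cong (recV (var #0) (iterStep e′) _ (encodeVec (enc {n} fin) (tabulate (f ∘ suc))))
          (trans (cong (λ z → ⟦ toTm e′ ⟧ (indices n ∷ enc τ x ∷ z) tt) (vars-ok past λ x → refl)) (toTm-ok e′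
                (x ∷ ρ))))
        (go (f ∘ suc) _)

    toTms-ok : (es : Exs Γ Δ) (ρ : Env n Γ) → ⟦ toTms es ⟧* (indices n ∷ encs ρ) tt ≡ encs (evals es ρ)
    toTms-ok []       ρ = refl
    toTms-ok (e ∷ es) ρ = cong₂ _∷_ (toTm-ok e ρ) (toTms-ok es ρ)

  -- 30 covers the fixed steps per round of both loops: 27 for `tab` and 25 for `iter`.
  stepBound : ∀ {k : ℕ} → ℕ → ℕ
  stepBound {k} b = 30 + (varsCost (past {k}) + b)

  mutual
    bnd : ∀ {k} {Γ : Vec Ty k} → Ex Γ τ → ℕ → ℕ
    bnd (var x)     n = 3 + toℕ x
    bnd (prim p es) n = 1 + ((1 + (bnds es n + 4)) + Prim.bound p n)
    bnd (sub e es)  n = 1 + ((1 + (bnds es n + 4)) + bnd e n)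
    bnd {k = k} (tab e) n = 10 + n * stepBound {k} (bnd e n)
    bnd {k = k} (iter e e′) n = 12 + (bnd e n + n * stepBound {k} (bnd e′ n))

    bnds : Exs Γ Δ → ℕ → ℕ
    bnds []       n = 1
    bnds (e ∷ es) n = 1 + (bnds es n + (1 + (bnd e n + 1)))

  mutual
    bnd-poly : (e : Ex Γ τ) → Poly (bnd e)
    bnd-poly (var x)     = polyConst _
    bnd-poly (prim p es) = poly+ (polyConst 1) (poly+ (poly+ (polyConst 1) (poly+ (bnds-poly es) (polyConst
          4))) (Prim.poly p))
    bnd-poly (sub e es)  = poly+ (polyConst 1) (poly+ (poly+ (polyConst 1) (poly+ (bnds-poly es) (polyConst
          4))) (bnd-poly e))
    bnd-poly (tab e)     = poly+ (polyConst 10) (poly* polyId (poly+ (polyConst 30) (poly+ (polyConst _)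
          (bnd-poly e))))
    bnd-poly (iter e e′) = poly+ (polyConst 12) (poly+ (bnd-poly e) (poly* polyId (poly+ (polyConst 30) (poly+
          (polyConst _) (bnd-poly e′)))))

    bnds-poly : (es : Exs Γ Δ) → Poly (bnds es)
    bnds-poly []       = polyConst 1
    bnds-poly (e ∷ es) = poly+ (polyConst 1) (poly+ (bnds-poly es) (poly+ (polyConst 1) (poly+ (bnd-poly e)
          (polyConst 1))))

  mutual
    bnd-ok : ∀ {k} {Γ : Vec Ty k} (e : Ex Γ τ) (ρ : Env n Γ) → cost (toTm e) (indices n ∷ encs ρ) tt tt ≤ bnd e n
    bnd-ok (var x) ρ = ≤-refl
    bnd-ok {n = n} (prim p es) ρ = s≤s (+-mono-≤ (s≤s (+-monoˡ-≤ 4 (bnds-ok es ρ)))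
      (subst (λ z → cost (Prim.tm p) (indices n ∷ z) tt tt ≤ Prim.bound p n) (sym (toTms-ok es ρ))
            (Prim.bound-ok p _)))
    bnd-ok {n = n} (sub e es) ρ = s≤s (+-mono-≤ (s≤s (+-monoˡ-≤ 4 (bnds-ok es ρ)))
      (subst (λ z → cost (toTm e) (indices n ∷ z) tt tt ≤ bnd e n) (sym (toTms-ok es ρ)) (bnd-ok e _)))
    bnd-ok {n = n} {k} (tab e) ρ = ≤-trans (s≤s (s≤s (s≤s (s≤s (s≤s (s≤s (go id)))))))
                                 (≤-reflexive (eq (n * B)))
      where
      B : ℕ
      B = stepBound {k} (bnd e n)
      eq : ∀ x → 6 + (4 + x) ≡ 10 + x
      eq = solve-∀
      arr : ∀ v c z → 7 + (1 + ((1 + ((1 + ((1 + (v + (1 + (2 + 1)))) + (1 + ((2 + 3) + 1)))) + c))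
                + (1 + ((1 + (1 + (1 + z))) + 1)))) ≡ (27 + (v + c)) + z
      arr = solve-∀
      arr′ : ∀ v c z → (30 + (v + c)) + (4 + z) ≡ 4 + ((30 + (v + c)) + z)
      arr′ = solve-∀
      go : ∀ {l} (f : Fin l → Fin n) {p} →
           recC nil (tabStep e) (indices n ∷ encs ρ) (encodeVec (enc {n} fin) (tabulate f)) p ≤ 4 + l * B
      go {zero}  f = ≤-refl
      go {suc l} f {p} = begin
        _ ≡⟨ cong₂ (λ v w → 7 + (1 + ((1 + ((1 + ((1 + (v + (1 + (2 + 1)))) + (1 + ((2 + 3) + 1)))) +
                 cost (toTm e) (indices n ∷ enc {n} fin (f zero) ∷ w) tt tt)) + (1 + ((1 + (1 + (1 + z))) + 1)))))
               (cost-vars (past {k})) (vars-ok past λ x → refl) ⟩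
        _ ≡⟨ arr (varsCost (past {k})) _ z ⟩
        _ ≤⟨ +-mono-≤ (+-mono-≤ {27} {30} (≤-by 3 refl) (+-monoʳ-≤ _ (bnd-ok e (f zero ∷ ρ)))) (go (f ∘ suc)) ⟩
        _ ≡⟨ arr′ (varsCost (past {k})) (bnd e n) (l * B) ⟩
        _ ∎
        where
        open ≤-Reasoning
        z : ℕ
        z = recC nil (tabStep e) (indices n ∷ encs ρ) (encodeVec (enc {n} fin) (tabulate (f ∘ suc))) nil
    bnd-ok {τ = τ} {n = n} {k} (iter e e′) ρ = begin
        _ ≡⟨ cong (λ z → 1 + (2 + (1 + (cost (toTm e) (indices n ∷ encs ρ) tt tt + (1 +
                recC (var #0) (iterStep e′) (indices n ∷ encs ρ) (indices n) z))))) (toTm-ok e ρ) ⟩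
        _ ≤⟨ +-monoʳ-≤ 4 (+-mono-≤ (bnd-ok e ρ) (s≤s (go id _))) ⟩
        _ ≡⟨ eq (bnd e n) (n * B) ⟩
        _ ∎
      where
      open ≤-Reasoning
      B : ℕ
      B = stepBound {k} (bnd e′ n)
      eq : ∀ b x → 4 + (b + (1 + (7 + x))) ≡ 12 + (b + x)
      eq = solve-∀
      arr : ∀ v c z → 7 + (1 + ((1 + ((1 + ((1 + (v + (1 + ((2 + 2) + 1)))) + (1 + ((2 + 3) + 1)))) + c))
                + (1 + z))) ≡ (25 + (v + c)) + z
      arr = solve-∀
      arr′ : ∀ v c z → (30 + (v + c)) + (7 + z) ≡ 7 + ((30 + (v + c)) + z)
      arr′ = solve-∀
      go : ∀ {l} (f : Fin l → Fin n) (x : ⟪ τ ⟫ n) →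
           recC (var #0) (iterStep e′) (indices n ∷ encs ρ) (encodeVec (enc {n} fin) (tabulate f)) (enc τ x) ≤
                 7 + l * B
      go {zero}  f x = ≤-by 2 refl
      go {suc l} f x = begin
        _ ≡⟨ cong₂ (λ v w → 7 + (1 + ((1 + ((1 + ((1 + (v + (1 + ((2 + 2) + 1)))) + (1 + ((2 + 3) + 1)))) +
                 cost (toTm e′) (indices n ∷ enc τ x ∷ w) tt tt)) + (1 +
                 recC (var #0) (iterStep e′) (indices n ∷ encs ρ) (encodeVec (enc {n} fin) (tabulate (f ∘
                       suc))) (⟦ toTm e′ ⟧ (indices n ∷ enc τ x ∷ w) tt)))))
               (cost-vars (past {k})) (vars-ok past λ x → refl) ⟩
        _ ≡⟨ arr (varsCost (past {k})) _ _ ⟩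
        _ ≤⟨ +-mono-≤ (+-mono-≤ {25} {30} (≤-by 5 refl) (+-monoʳ-≤ _ (bnd-ok e′ (x ∷ ρ))))
               (subst (λ z → recC (var #0) (iterStep e′) (indices n ∷ encs ρ) (encodeVec (enc {n} fin)
                     (tabulate (f ∘ suc))) z ≤ 7 + l * B)
                 (sym (toTm-ok e′ (x ∷ ρ))) (go (f ∘ suc) _)) ⟩
        _ ≡⟨ arr′ (varsCost (past {k})) (bnd e′ n) (l * B) ⟩
        _ ∎

    bnds-ok : (es : Exs Γ Δ) (ρ : Env n Γ) → cost* (toTms es) (indices n ∷ encs ρ) tt tt ≤ bnds es n
    bnds-ok []       ρ = ≤-refl
    bnds-ok (e ∷ es) ρ = s≤s (+-mono-≤ (bnds-ok es ρ) (s≤s (+-monoˡ-≤ 1 (bnd-ok e ρ))))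

-- Primitive operations

hd tl : ∀ {r v} → Tm r v → Tm r v
hd t = match t nil (var #0)
tl t = match t nil (var #1)

hdD tlD : Data → Data
hdD d = matchD d nil λ a b → a
tlD d = matchD d nil λ a b → b

quoteTm : ∀ {r v} → Data → Tm r v
quoteTm nil        = nil
quoteTm (cons a b) = cons (quoteTm a) (quoteTm b)

quoteTm-ok : ∀ {r v} d {ρ : Vec Data v} {s} → ⟦ quoteTm {r} d ⟧ ρ s ≡ d
quoteTm-ok nil        = refl
quoteTm-ok (cons a b) = cong₂ cons (quoteTm-ok a) (quoteTm-ok b)

quoteCost : Data → ℕ
quoteCost nil        = 1
quoteCost (cons a b) = 1 + (quoteCost a + (1 + (quoteCost b + 1)))

cost-quote : ∀ {r v} d {ρ : Vec Data v} {s κ} → cost (quoteTm {r} d) ρ s κ ≡ quoteCost d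
cost-quote nil        = refl
cost-quote (cons a b) = cong₂ (λ x y → 1 + (x + (1 + (y + 1)))) (cost-quote a) (cost-quote b)

trueTm : ∀ {r v} → Tm r v
trueTm = cons nil nil

constP : ∀ τ → (x : ∀ {n} → ⟪ τ ⟫ n) (d : Data) → (∀ {n} → enc {n} τ x ≡ d) → Prim [] τ
constP τ x d eq = record
  { fun = λ _ → x ; tm = quoteTm d
  ; tm-ok = λ _ → trans (quoteTm-ok d) (sym eq)
  ; bound = λ _ → quoteCost d ; bound-ok = λ _ → ≤-reflexive (cost-quote d) ; poly = polyConst _ }

iteP : Prim (bool ∷ τ ∷ τ ∷ []) τ
iteP = record
  { fun = λ { (b ∷ x ∷ y ∷ []) → if b then x else y }
  ; tm = match (var #1) (var #3) (var #4)
  ; tm-ok = λ { (true ∷ x ∷ y ∷ []) → refl ; (false ∷ x ∷ y ∷ []) → refl }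
  ; bound = λ _ → 20
  ; bound-ok = λ { (true ∷ x ∷ y ∷ []) → ≤ᵇ⇒≤ _ _ tt ; (false ∷ x ∷ y ∷ []) → ≤ᵇ⇒≤ _ _ tt }
  ; poly = polyConst _ }

notP : Prim (bool ∷ []) bool
notP = record
  { fun = λ { (b ∷ []) → not b }
  ; tm = match (var #1) trueTm nil
  ; tm-ok = λ { (true ∷ []) → refl ; (false ∷ []) → refl }
  ; bound = λ _ → 20
  ; bound-ok = λ { (true ∷ []) → ≤ᵇ⇒≤ _ _ tt ; (false ∷ []) → ≤ᵇ⇒≤ _ _ tt }
  ; poly = polyConst _ }

andP : Prim (bool ∷ bool ∷ []) bool
andP = record
  { fun = λ { (a ∷ b ∷ []) → a ∧ b }
  ; tm = match (var #1) nil (var #4)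
  ; tm-ok = λ { (true ∷ b ∷ []) → refl ; (false ∷ b ∷ []) → refl }
  ; bound = λ _ → 20
  ; bound-ok = λ { (true ∷ b ∷ []) → ≤ᵇ⇒≤ _ _ tt ; (false ∷ b ∷ []) → ≤ᵇ⇒≤ _ _ tt }
  ; poly = polyConst _ }

orP : Prim (bool ∷ bool ∷ []) bool
orP = record
  { fun = λ { (a ∷ b ∷ []) → a ∨ b }
  ; tm = match (var #1) (var #2) trueTm
  ; tm-ok = λ { (true ∷ b ∷ []) → refl ; (false ∷ b ∷ []) → refl }
  ; bound = λ _ → 20
  ; bound-ok = λ { (true ∷ b ∷ []) → ≤ᵇ⇒≤ _ _ tt ; (false ∷ b ∷ []) → ≤ᵇ⇒≤ _ _ tt }
  ; poly = polyConst _ }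

is0 is1 : ℕ → Bool
is0 zero = true
is0 (suc _) = false
is1 zero = false
is1 (suc k) = is0 k

is0P is1P : Prim (nat ∷ []) bool
is0P = record
  { fun = λ { (k ∷ []) → is0 k }
  ; tm = match (var #1) trueTm nil
  ; tm-ok = λ { (zero ∷ []) → refl ; (suc _ ∷ []) → refl }
  ; bound = λ _ → 20
  ; bound-ok = λ { (zero ∷ []) → ≤ᵇ⇒≤ _ _ tt ; (suc _ ∷ []) → ≤ᵇ⇒≤ _ _ tt }
  ; poly = polyConst _ }
is1P = record
  { fun = λ { (k ∷ []) → is1 k }
  ; tm = match (var #1) nil (match (var #1) trueTm nil)
  ; tm-ok = λ { (zero ∷ []) → refl ; (suc zero ∷ []) → refl ; (suc (suc _) ∷ []) → refl }
  ; bound = λ _ → 30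
  ; bound-ok = λ { (zero ∷ []) → ≤ᵇ⇒≤ _ _ tt ; (suc zero ∷ []) → ≤ᵇ⇒≤ _ _ tt ; (suc (suc _) ∷ []) → ≤ᵇ⇒≤ _ _ tt }
  ; poly = polyConst _ }

pairP : Prim (σ ∷ τ ∷ []) (σ ⊗ τ)
pairP = record
  { fun = λ { (x ∷ y ∷ []) → x , y } ; tm = cons (var #1) (var #2)
  ; tm-ok = λ { (x ∷ y ∷ []) → refl } ; bound = λ _ → 20
  ; bound-ok = λ { (x ∷ y ∷ []) → ≤ᵇ⇒≤ _ _ tt } ; poly = polyConst _ }

fstP : Prim (σ ⊗ τ ∷ []) σ
fstP = record
  { fun = λ { ((x , y) ∷ []) → x } ; tm = hd (var #1)
  ; tm-ok = λ { ((x , y) ∷ []) → refl } ; bound = λ _ → 20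
  ; bound-ok = λ { ((x , y) ∷ []) → ≤ᵇ⇒≤ _ _ tt } ; poly = polyConst _ }

sndP : Prim (σ ⊗ τ ∷ []) τ
sndP = record
  { fun = λ { ((x , y) ∷ []) → y } ; tm = tl (var #1)
  ; tm-ok = λ { ((x , y) ∷ []) → refl } ; bound = λ _ → 20
  ; bound-ok = λ { ((x , y) ∷ []) → ≤ᵇ⇒≤ _ _ tt } ; poly = polyConst _ }

nilP : Prim [] (bits 0)
nilP = constP (bits 0) [] nil refl

consP : Prim (bool ∷ bits k ∷ []) (bits (suc k))
consP = record
  { fun = λ { (b ∷ bs ∷ []) → b ∷ bs } ; tm = cons (var #1) (var #2)
  ; tm-ok = λ { (x ∷ y ∷ []) → refl } ; bound = λ _ → 20
  ; bound-ok = λ { (x ∷ y ∷ []) → ≤ᵇ⇒≤ _ _ tt } ; poly = polyConst _ }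

isCons : Data → Bool
isCons nil        = false
isCons (cons _ _) = true

isConsP : Prim (raw ∷ []) bool
isConsP = record
  { fun = λ { (d ∷ []) → isCons d } ; tm = match (var #1) nil trueTm
  ; tm-ok = λ { (nil ∷ []) → refl ; (cons _ _ ∷ []) → refl } ; bound = λ _ → 20
  ; bound-ok = λ { (nil ∷ []) → ≤ᵇ⇒≤ _ _ tt ; (cons _ _ ∷ []) → ≤ᵇ⇒≤ _ _ tt } ; poly = polyConst _ }

tlP : Prim (raw ∷ []) raw
tlP = record
  { fun = λ { (d ∷ []) → tlD d } ; tm = tl (var #1)
  ; tm-ok = λ { (nil ∷ []) → refl ; (cons _ _ ∷ []) → refl } ; bound = λ _ → 20
  ; bound-ok = λ { (nil ∷ []) → ≤ᵇ⇒≤ _ _ tt ; (cons _ _ ∷ []) → ≤ᵇ⇒≤ _ _ tt } ; poly = polyConst _ }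

someP : Prim (raw ∷ []) raw
someP = record
  { fun = λ { (d ∷ []) → cons nil d } ; tm = cons nil (var #1)
  ; tm-ok = λ { (d ∷ []) → refl } ; bound = λ _ → 20
  ; bound-ok = λ { (d ∷ []) → ≤ᵇ⇒≤ _ _ tt } ; poly = polyConst _ }

linear : ∀ a b → Poly (λ n → a + n * b)
linear a b = poly+ (polyConst a) (poly* polyId (polyConst b))

step≤ : ∀ {a b c z} x → a + x ≡ c → z ≤ b → a + z ≤ c + b
step≤ x eq h = +-mono-≤ (≤-by x eq) h

allV anyV : Vec Bool n → Bool
allV = foldr′ _∧_ true
anyV = foldr′ _∨_ false

allP anyP : Prim (vec bool ∷ []) bool
allP = record
  { fun = λ { (xs ∷ []) → allV xs } ; tm = rec (var #1) nil trueTm step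
  ; tm-ok = λ { (xs ∷ []) → go xs } ; bound = λ n → 20 + n * 30
  ; bound-ok = λ { (xs ∷ []) → +-monoʳ-≤ 7 (≤-trans (bd xs) (≤-by 5 (+-comm _ 5))) } ; poly = linear 20 30 }
  where
  step : ∀ {v} → Tm true (3 + v)
  step = match (var #0) nil (selfʳ nil)
  go : ∀ {v} {ρ : Vec Data v} (xs : Vec Bool l) {p} → recV trueTm step ρ (encodeVec encodeBool xs) p ≡
        encodeBool (allV xs)
  go []           = refl
  go (true ∷ xs)  = go xs
  go (false ∷ xs) = refl
  bd : ∀ {v} {ρ : Vec Data v} (xs : Vec Bool l) {p} → recC trueTm step ρ (encodeVec encodeBool xs) p ≤ 8 + l * 30
  bd []           = ≤ᵇ⇒≤ _ _ tt
  bd {l = suc l} (true ∷ xs)  = ≤-trans (step≤ {18} {c = 30} 12 refl (bd xs)) (≤-reflexive (eq (l * 30)))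
    where eq : ∀ x → 30 + (8 + x) ≡ 8 + (30 + x)
          eq = solve-∀
  bd (false ∷ xs) = ≤-by {12} _ refl
anyP = record
  { fun = λ { (xs ∷ []) → anyV xs } ; tm = rec (var #1) nil nil step
  ; tm-ok = λ { (xs ∷ []) → go xs } ; bound = λ n → 20 + n * 30
  ; bound-ok = λ { (xs ∷ []) → +-monoʳ-≤ 7 (≤-trans (bd xs) (≤-by 5 (+-comm _ 5))) } ; poly = linear 20 30 }
  where
  step : ∀ {v} → Tm true (3 + v)
  step = match (var #0) (selfʳ nil) trueTm
  go : ∀ {v} {ρ : Vec Data v} (xs : Vec Bool l) {p} → recV nil step ρ (encodeVec encodeBool xs) p ≡ encodeBool
        (anyV xs)
  go []           = refl
  go (true ∷ xs)  = refl
  go (false ∷ xs) = go xs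
  bd : ∀ {v} {ρ : Vec Data v} (xs : Vec Bool l) {p} → recC nil step ρ (encodeVec encodeBool xs) p ≤ 8 + l * 30
  bd []           = ≤ᵇ⇒≤ _ _ tt
  bd (true ∷ xs)  = ≤-by {20} _ refl
  bd {l = suc l} (false ∷ xs) = ≤-trans (step≤ {14} {c = 30} 16 refl (bd xs)) (≤-reflexive (eq (l * 30)))
    where eq : ∀ x → 30 + (8 + x) ≡ 8 + (30 + x)
          eq = solve-∀

countV : Vec Bool n → ℕ
countV []           = 0
countV (true ∷ xs)  = suc (countV xs)
countV (false ∷ xs) = countV xs

countP : Prim (vec bool ∷ []) raw
countP = record
  { fun = λ { (xs ∷ []) → encodeℕ (countV xs) } ; tm = rec (var #1) nil nil step
  ; tm-ok = λ { (xs ∷ []) → go xs } ; bound = λ n → 20 + n * 30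
  ; bound-ok = λ { (xs ∷ []) → +-monoʳ-≤ 7 (≤-trans (bd xs) (≤-by 5 (+-comm _ 5))) } ; poly = linear 20 30 }
  where
  step : ∀ {v} → Tm true (3 + v)
  step = match (var #0) (selfʳ nil) (cons nil (selfʳ nil))
  go : ∀ {v} {ρ : Vec Data v} (xs : Vec Bool l) {p} → recV nil step ρ (encodeVec encodeBool xs) p ≡ encodeℕ
        (countV xs)
  go []           = refl
  go (true ∷ xs)  = cong (cons nil) (go xs)
  go (false ∷ xs) = go xs
  bd : ∀ {v} {ρ : Vec Data v} (xs : Vec Bool l) {p} → recC nil step ρ (encodeVec encodeBool xs) p ≤ 8 + l * 30
  bd []           = ≤ᵇ⇒≤ _ _ tt
  bd {l = suc l} (true ∷ xs)  = ≤-trans (≤-reflexive (eq′ _)) (≤-trans (step≤ {22} {c = 30} 8 refl (bd xs))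
        (≤-reflexive (eq (l * 30))))
    where eq : ∀ x → 30 + (8 + x) ≡ 8 + (30 + x)
          eq = solve-∀
          eq′ : ∀ x → 21 + (x + 1) ≡ 22 + x
          eq′ = solve-∀
  bd {l = suc l} (false ∷ xs) = ≤-trans (step≤ {14} {c = 30} 16 refl (bd xs)) (≤-reflexive (eq (l * 30)))
    where eq : ∀ x → 30 + (8 + x) ≡ 8 + (30 + x)
          eq = solve-∀

lookupP : Prim (vec τ ∷ fin ∷ []) τ
lookupP {τ} = record
  { fun = λ { (xs ∷ i ∷ []) → lookup xs i } ; tm = rec (var #2) (var #1) (hd (var #0)) step
  ; tm-ok = λ { (xs ∷ i ∷ []) → go xs i } ; bound = λ n → 30 + n * 30
  ; bound-ok = λ { (xs ∷ i ∷ []) → +-monoʳ-≤ 10 (≤-trans (bd xs i) (≤-by 5 (+-comm _ 5))) } ; poly = linear 30 30 }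
  where
  step : ∀ {v} → Tm true (3 + v)
  step = selfʳ (tl (var #2))
  go : ∀ {v} {ρ : Vec Data v} (xs : Vec (⟪ τ ⟫ n) l) (i : Fin l) →
       recV (hd (var #0)) step ρ (encodeℕ (toℕ i)) (encodeVec (enc τ) xs) ≡ enc τ (lookup xs i)
  go (x ∷ xs) zero    = refl
  go (x ∷ xs) (suc i) = go xs i
  bd : ∀ {v} {ρ : Vec Data v} (xs : Vec (⟪ τ ⟫ n) l) (i : Fin l) →
       recC (hd (var #0)) step ρ (encodeℕ (toℕ i)) (encodeVec (enc τ) xs) ≤ 15 + l * 30
  bd (x ∷ xs) zero    = ≤-by {13} _ refl
  bd {l = suc l} (x ∷ xs) (suc i) = ≤-trans (step≤ {22} {c = 30} 8 refl (bd xs i)) (≤-reflexive (eq (l * 30)))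
    where eq : ∀ x → 30 + (15 + x) ≡ 15 + (30 + x)
          eq = solve-∀

bitTm : Fin k → ∀ {v} → Tm false v → Tm false v
bitTm zero    t = hd t
bitTm (suc j) t = bitTm j (tl t)

bitP : Fin k → Prim (bits k ∷ []) bool
bitP {k} j = record
  { fun = λ { (bs ∷ []) → lookup bs j } ; tm = bitTm j (var #1)
  ; tm-ok = λ { (bs ∷ []) → go j bs (var #1) refl } ; bound = λ n → 3 + k * 20
  ; bound-ok = λ { (bs ∷ []) → bd j bs (var #1) refl } ; poly = polyConst _ }
  where
  go : (j : Fin l) (bs : Vec Bool l) → ∀ {v} (t : Tm false v) {ρ} →
       ⟦ t ⟧ ρ tt ≡ encodeVec encodeBool bs → ⟦ bitTm j t ⟧ ρ tt ≡ encodeBool (lookup bs j)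
  go zero    (b ∷ bs) t eq = cong hdD eq
  go (suc j) (b ∷ bs) t eq = go j bs (tl t) (cong tlD eq)
  bd : (j : Fin l) (bs : Vec Bool l) → ∀ {v} (t : Tm false v) {ρ} →
       ⟦ t ⟧ ρ tt ≡ encodeVec encodeBool bs → cost (bitTm j t) ρ tt tt ≤ cost t ρ tt tt + l * 20
  bd {l = suc l} zero    (b ∷ bs) t {ρ} eq rewrite eq = ≤-trans (≤-reflexive (e (cost t ρ tt tt))) (+-monoʳ-≤
        (cost t ρ tt tt) (≤-by {8} _ refl))
    where e : ∀ x → 1 + (x + 7) ≡ x + 8
          e = solve-∀
  bd {l = suc l} (suc j) (b ∷ bs) t {ρ} eq = ≤-trans (bd j bs (tl t) (cong tlD eq)) (h eq)
    where e : ∀ x y → 1 + (x + 8) + y ≡ x + (9 + y)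
          e = solve-∀
          h : ⟦ t ⟧ ρ tt ≡ cons (encodeBool b) (encodeVec encodeBool bs) → cost (tl t) ρ tt tt + l * 20 ≤ cost
                t ρ tt tt + (20 + l * 20)
          h eq rewrite eq = ≤-trans (≤-reflexive (e (cost t ρ tt tt) (l * 20))) (+-monoʳ-≤ (cost t ρ tt tt)
                (≤-by {9 + l * 20} 11 (+-comm _ 11)))

eqF : ∀ {m n} → Fin m → Fin n → Bool
eqF zero    zero    = true
eqF zero    (suc j) = false
eqF (suc i) zero    = false
eqF (suc i) (suc j) = eqF i j

eqF-refl : (i : Fin n) → eqF i i ≡ true
eqF-refl zero    = refl
eqF-refl (suc i) = eqF-refl i

eqF⇒≡ : (i j : Fin n) → eqF i j ≡ true → i ≡ j
eqF⇒≡ zero    zero    h = refl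
eqF⇒≡ (suc i) (suc j) h = cong suc (eqF⇒≡ i j h)

eqP : Prim (fin ∷ fin ∷ []) bool
eqP = record
  { fun = λ { (i ∷ j ∷ []) → eqF i j } ; tm = rec (var #1) (var #2) base step
  ; tm-ok = λ { (i ∷ j ∷ []) → go i j } ; bound = λ n → 30 + n * 30
  ; bound-ok = λ { {n} (i ∷ j ∷ []) → +-monoʳ-≤ 10 (≤-trans (bd {l = n} i j) (≤-by 5 (+-comm _ 5))) } ; poly =
        linear 30 30 }
  where
  base : ∀ {v} → Tm false (1 + v)
  base = match (var #0) trueTm nil
  step : ∀ {v} → Tm true (3 + v)
  step = match (var #2) nil (selfʳ (var #1))
  go : ∀ {v} {ρ : Vec Data v} (i : Fin k) (j : Fin l) →
       recV base step ρ (encodeℕ (toℕ i)) (encodeℕ (toℕ j)) ≡ encodeBool (eqF i j)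
  go zero    zero    = refl
  go zero    (suc j) = refl
  go (suc i) zero    = refl
  go (suc i) (suc j) = go i j
  bd : ∀ {v} {ρ : Vec Data v} (i : Fin l) (j : Fin k) →
       recC base step ρ (encodeℕ (toℕ i)) (encodeℕ (toℕ j)) ≤ 15 + l * 30
  bd zero    zero    = ≤-by {12} _ refl
  bd zero    (suc j) = ≤-by {12} _ refl
  bd {l = suc l} (suc i) zero    = ≤-by {14} _ refl
  bd {l = suc l} (suc i) (suc j) = ≤-trans (step≤ {22} {c = 30} 8 refl (bd i j)) (≤-reflexive (eq (l * 30)))
    where eq : ∀ x → 30 + (15 + x) ≡ 15 + (30 + x)
          eq = solve-∀

-- Unary addition and minimum, truncated at n so that their running time is
-- bounded whatever the arguments are.

plusD minD : ℕ → Data → Data → Data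
plusD zero    a          b          = nil
plusD (suc m) nil        nil        = nil
plusD (suc m) nil        (cons _ b) = cons nil (plusD m nil b)
plusD (suc m) (cons _ a) b          = cons nil (plusD m a b)
minD zero    a          b          = nil
minD (suc m) nil        b          = nil
minD (suc m) (cons _ a) nil        = nil
minD (suc m) (cons _ a) (cons _ b) = cons nil (minD m a b)

plusD-encode : ∀ m a b → plusD m (encodeℕ a) (encodeℕ b) ≡ encodeℕ ((a + b) ⊓ m)
plusD-encode zero    a       b       = cong encodeℕ (sym (⊓-zeroʳ (a + b)))
plusD-encode (suc m) zero    zero    = refl
plusD-encode (suc m) zero    (suc b) = cong (cons nil) (plusD-encode m zero b)
plusD-encode (suc m) (suc a) b       = cong (cons nil) (plusD-encode m a b)

minD-encode : ∀ m a b → minD m (encodeℕ a) (encodeℕ b) ≡ encodeℕ ((a ⊓ b) ⊓ m)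
minD-encode zero    a       b       = cong encodeℕ (sym (⊓-zeroʳ (a ⊓ b)))
minD-encode (suc m) zero    b       = refl
minD-encode (suc m) (suc a) zero    = refl
minD-encode (suc m) (suc a) (suc b) = cong (cons nil) (minD-encode m a b)

plusP minP : Prim (raw ∷ raw ∷ []) raw
plusP = record
  { fun = λ { {n} (a ∷ b ∷ []) → plusD n a b } ; tm = rec (var #0) (cons (var #1) (var #2)) nil step
  ; tm-ok = λ { {n} (a ∷ b ∷ []) → go {n} {n} id a b } ; bound = λ n → 30 + n * 60
  ; bound-ok = λ { {n} (a ∷ b ∷ []) → +-monoʳ-≤ 15 (≤-trans (bd {n} {n} id a b) (≤-by 0 (+-identityʳ _))) } ;
        poly = linear 30 60 }
  where
  step : ∀ {v} → Tm true (3 + v)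
  step = match (var #2) nil (match (var #0)
           (match (var #1) nil (cons nil (selfʳ (cons nil (var #1)))))
           (cons nil (selfʳ (cons (var #1) (var #3)))))
  go : ∀ {v} {ρ : Vec Data v} (f : Fin l → Fin n) a b →
       recV nil step ρ (encodeVec (enc {n} fin) (tabulate f)) (cons a b) ≡ plusD l a b
  go {l = zero}  f a          b          = refl
  go {l = suc l} f nil        nil        = refl
  go {l = suc l} f nil        (cons _ b) = cong (cons nil) (go (f ∘ suc) nil b)
  go {l = suc l} f (cons _ a) b          = cong (cons nil) (go (f ∘ suc) a b)
  eq : ∀ x → 60 + (15 + x) ≡ 15 + (60 + x)
  eq = solve-∀
  bd : ∀ {v} {ρ : Vec Data v} (f : Fin l → Fin n) a b →
       recC nil step ρ (encodeVec (enc {n} fin) (tabulate f)) (cons a b) ≤ 15 + l * 60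
  bd {l = zero}  f a          b          = ≤-by {4} _ refl
  bd {l = suc l} f nil        nil        = ≤-by {27} _ refl
  bd {l = suc l} f nil        (cons _ b) = ≤-trans (≤-reflexive (eq′ _)) (≤-trans (step≤ {43} {c = 60} 17 refl
        (bd (f ∘ suc) nil b)) (≤-reflexive (eq (l * 60))))
    where eq′ : ∀ x → 42 + (x + 1) ≡ 43 + x
          eq′ = solve-∀
  bd {l = suc l} f (cons _ a) b          = ≤-trans (≤-reflexive (eq′ _)) (≤-trans (step≤ {42} {c = 60} 18 refl
        (bd (f ∘ suc) a b)) (≤-reflexive (eq (l * 60))))
    where eq′ : ∀ x → 41 + (x + 1) ≡ 42 + x
          eq′ = solve-∀
minP = record
  { fun = λ { {n} (a ∷ b ∷ []) → minD n a b } ; tm = rec (var #0) (cons (var #1) (var #2)) nil step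
  ; tm-ok = λ { {n} (a ∷ b ∷ []) → go {n} {n} id a b } ; bound = λ n → 30 + n * 60
  ; bound-ok = λ { {n} (a ∷ b ∷ []) → +-monoʳ-≤ 15 (≤-trans (bd {n} {n} id a b) (≤-by 0 (+-identityʳ _))) } ;
        poly = linear 30 60 }
  where
  step : ∀ {v} → Tm true (3 + v)
  step = match (var #2) nil (match (var #0) nil (match (var #3) nil (cons nil (selfʳ (cons (var #3) (var #1))))))
  go : ∀ {v} {ρ : Vec Data v} (f : Fin l → Fin n) a b →
       recV nil step ρ (encodeVec (enc {n} fin) (tabulate f)) (cons a b) ≡ minD l a b
  go {l = zero}  f a          b          = refl
  go {l = suc l} f nil        b          = refl
  go {l = suc l} f (cons _ a) nil        = refl
  go {l = suc l} f (cons _ a) (cons _ b) = cong (cons nil) (go (f ∘ suc) a b)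
  eq : ∀ x → 60 + (15 + x) ≡ 15 + (60 + x)
  eq = solve-∀
  bd : ∀ {v} {ρ : Vec Data v} (f : Fin l → Fin n) a b →
       recC nil step ρ (encodeVec (enc {n} fin) (tabulate f)) (cons a b) ≤ 15 + l * 60
  bd {l = zero}  f a          b          = ≤-by {4} _ refl
  bd {l = suc l} f nil        b          = ≤-by {22} _ refl
  bd {l = suc l} f (cons _ a) nil        = ≤-by {33} _ refl
  bd {l = suc l} {ρ = ρ} f (cons _ a) (cons _ b) = ≤-trans (≤-reflexive (eq′ (recC nil step ρ (encodeVec (enc
        fin) (tabulate (f ∘ suc))) (cons a b)))) (≤-trans (step≤ {53} {c = 60} 7 refl (bd (f ∘ suc) a b))
        (≤-reflexive (eq (l * 60))))
    where eq′ : ∀ x → 52 + (x + 1) ≡ 53 + x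
          eq′ = solve-∀

-- Tries with arbitrary binary trees as keys: a trie consists of the entry of
-- the key nil and, for keys cons a b, a trie indexed by a of tries indexed by b.

getD : Data → Data → Data
getD nil        p = hdD p
getD (cons a b) p = getD b (getD a (tlD p))

setD : Data → Data → Data → Data
setD nil        x p = cons x (tlD p)
setD (cons a b) x p = cons (hdD p) (setD a (setD b x (getD a (tlD p))) (tlD p))

get-set : ∀ k x p → getD k (setD k x p) ≡ x
get-set nil        x p = refl
get-set (cons a b) x p = trans (cong (getD b) (get-set a _ (tlD p))) (get-set b x _)

≟D : (d e : Data) → Dec (d ≡ e)
≟D nil        nil        = yes refl
≟D nil        (cons _ _) = no λ ()
≟D (cons _ _) nil        = no λ ()
≟D (cons a b) (cons c d) with ≟D a c | ≟D b d
... | yes refl | yes refl = yes refl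
... | no a≢c   | _        = no λ { refl → a≢c refl }
... | yes _    | no b≢d   = no λ { refl → b≢d refl }

get-set-≢ : ∀ k l x p → l ≢ k → getD l (setD k x p) ≡ getD l p
get-set-≢ nil        nil        x p l≢k = contradiction refl l≢k
get-set-≢ nil        (cons c d) x p l≢k = refl
get-set-≢ (cons a b) nil        x p l≢k = refl
get-set-≢ (cons a b) (cons c d) x p l≢k with ≟D c a
... | no c≢a   = cong (getD d) (get-set-≢ a c _ (tlD p) c≢a)
-- Keys with equal first components go through the same inner trie, so they differ in their second
-- components.
... | yes refl = trans (cong (getD d) (get-set a _ (tlD p))) (get-set-≢ b d x _ λ d≡b → l≢k (cong (cons a) d≡b))

private
  setBase : Tm false (1 + l)
  setBase = match (var #0) nil (cons (var #0) (tl (var #1)))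

  getBase : Tm false (1 + l)
  getBase = hd (var #0)

  getStep : Tm true (3 + l)
  getStep = selfʳ (selfˡ (tl (var #2)))

getTm : Tm false 2
getTm = rec (var #0) (var #1) getBase getStep

private
  setStep : Tm true (3 + l)
  setStep = match (var #2) nil
    (cons (hd (var #1)) (selfˡ (cons (selfʳ (cons (var #0) (call getTm (var #2 ∷ tl (var #1) ∷ [])))) (tl (var #1)))))

setTm : Tm false 3
setTm = rec (var #0) (cons (var #1) (var #2)) setBase setStep

get-ok : ∀ {v} {ρ : Vec Data v} k p → recV getBase getStep ρ k p ≡ getD k p
get-ok nil        p = refl
get-ok (cons a b) p = trans (get-ok b _) (cong (getD b) (get-ok a _))

set-ok : ∀ {v} {ρ : Vec Data v} k x p → recV setBase setStep ρ k (cons x p) ≡ setD k x p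
set-ok nil        x p = refl
set-ok (cons a b) x p = cong (cons (hdD p))
  (trans (cong (λ z → recV setBase setStep _ a (cons z (tlD p)))
    (trans (set-ok b x _) (cong (setD b x) (get-ok a (tlD p))))) (set-ok a _ _))

size : Data → ℕ
size nil        = 1
size (cons a b) = 1 + (size a + size b)

get-cost : ∀ {v} {ρ : Vec Data v} k p → recC getBase getStep ρ k p ≤ size k * 30
get-cost nil        nil        = ≤ᵇ⇒≤ _ _ tt
get-cost nil        (cons _ _) = ≤ᵇ⇒≤ _ _ tt
get-cost {ρ = ρ} (cons a b) p = go p
  where
  κ = recC getBase getStep ρ
  φ = recV getBase getStep ρ
  eq : ∀ t x y → 7 + (1 + ((1 + (t + (1 + x))) + (1 + y))) ≡ (11 + t) + (x + y)
  eq = solve-∀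
  eq′ : ∀ x y → 24 + (x * 30 + y * 30) + 6 ≡ (1 + (x + y)) * 30
  eq′ = solve-∀
  sum≤ : ∀ t q → t ≤ 13 → 7 + (1 + ((1 + (t + (1 + κ a q))) + (1 + κ b (φ a q)))) ≤ (1 + (size a + size b)) * 30
  sum≤ t q t≤ = ≤-trans (≤-reflexive (eq t (κ a q) (κ b (φ a q))))
    (≤-trans (+-mono-≤ (+-monoʳ-≤ 11 t≤) (+-mono-≤ (get-cost a q) (get-cost b (φ a q))))
      (≤-by 6 (eq′ (size a) (size b))))
  go : ∀ p → κ (cons a b) p ≤ (1 + (size a + size b)) * 30
  go nil        = sum≤ 7 nil (≤ᵇ⇒≤ _ _ tt)
  go (cons _ q) = sum≤ 13 q (≤ᵇ⇒≤ _ _ tt)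

-- Quadratic in the key, because at each `cons` of the key the inner trie is retrieved by `getD`
-- before it is updated.
set-cost : ∀ {v} {ρ : Vec Data v} k x p → recC setBase setStep ρ k (cons x p) ≤ size k * (size k * 200)
set-cost nil        x nil        = ≤ᵇ⇒≤ _ _ tt
set-cost nil        x (cons _ _) = ≤ᵇ⇒≤ _ _ tt
set-cost {ρ = ρ} (cons a b) x p = ≤-trans (unfold p)
  (≤-trans (+-monoʳ-≤ 200 (+-mono-≤ (get-cost a (tlD p)) (+-mono-≤ (set-cost a _ (tlD p)) (set-cost b x _))))
    (≤-by _ (eq (size a) (size b))))
  where
  κ = recC setBase setStep ρ
  g : Data → ℕ
  g q = recC getBase getStep (a ∷ q ∷ []) a q
  y : Data → Data
  y q = cons x (recV getBase getStep (a ∷ q ∷ []) a q)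
  ka kb : Data → ℕ
  ka q = κ a (cons (recV setBase setStep ρ b (y q)) q)
  kb q = κ b (y q)
  unfold : ∀ p → κ (cons a b) (cons x p) ≤ 200 + (g (tlD p) + (ka (tlD p) + kb (tlD p)))
  unfold nil = ≤-trans (≤-reflexive (arr (g nil) (ka nil) (kb nil))) (+-monoˡ-≤ (g nil + (ka nil + kb nil))
        (≤-by {70} {200} 130 refl))
    where
    arr : ∀ G A B → 7 + (1 + (4 + (1 + (4 + (1 + (6 + (1 + ((1 + ((1 + ((1 + ((1 + (2 + (1 + ((1 + ((1 + ((1 +
          (1 + (1 + (6 + 1)))) + (1 + (4 + 1)))) + (1 + (2 + (1 + (3 + (1 + G))))))) + 1)))) + (1 + B))) + (1 +
          (6 + 1)))) + (1 + A))) + 1)))))))) ≡ 70 + (G + (A + B))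
    arr = solve-∀
  unfold (cons _ q) = ≤-trans (≤-reflexive (arr (g q) (ka q) (kb q))) (+-monoˡ-≤ (g q + (ka q + kb q)) (≤-by
        {87} {200} 113 refl))
    where
    arr : ∀ G A B → 7 + (1 + (4 + (1 + (4 + (1 + (11 + (1 + ((1 + ((1 + ((1 + ((1 + (2 + (1 + ((1 + ((1 + ((1 +
          (1 + (1 + (12 + 1)))) + (1 + (4 + 1)))) + (1 + (2 + (1 + (3 + (1 + G))))))) + 1)))) + (1 + B))) + (1
          + (12 + 1)))) + (1 + A))) + 1)))))))) ≡ 87 + (G + (A + B))
    arr = solve-∀
  eq : ∀ x y → 200 + (x * 30 + (x * (x * 200) + y * (y * 200))) + (x * 370 + y * 400 + x * (y * 400)) ≡
       (1 + (x + y)) * ((1 + (x + y)) * 200)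
  eq = solve-∀

size-bool : ∀ b → size (encodeBool b) ≤ 3
size-bool true  = ≤-refl
size-bool false = s≤s z≤n

size-vec : ∀ {A : Set} {f : A → Data} {c} → (∀ x → size (f x) ≤ c) → (xs : Vec A l) →
           size (encodeVec f xs) ≤ 1 + l * (1 + c)
size-vec h []       = ≤-refl
size-vec {l = suc l} {f = f} {c} h (x ∷ xs) = s≤s (≤-trans (+-mono-≤ (h x) (size-vec h xs)) (≤-reflexive (+-suc c _)))

-- Keys have size linear in n, so accessing a table is polynomial in n however many entries it
-- holds.
size-key : (xs : Vec (Vec Bool k) n) → size (enc (vec (bits k)) xs) ≤ 1 + n * (1 + (1 + k * 4))
size-key = size-vec (size-vec size-bool)

getP : Prim (vec (bits k) ∷ raw ∷ []) raw
getP {k} = record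
  { fun = λ { (xs ∷ t ∷ []) → getD (enc (vec (bits k)) xs) t } ; tm = call getTm (var #1 ∷ var #2 ∷ [])
  ; tm-ok = λ { (xs ∷ t ∷ []) → get-ok (enc (vec (bits k)) xs) t } ; bound = λ n → 30 + (1 + n * (1 + (1 + k *
        4))) * 30
  ; bound-ok = λ { (xs ∷ t ∷ []) → +-mono-≤ {23} (≤-by 7 refl)
                     (≤-trans (get-cost (enc (vec (bits k)) xs) t) (*-monoˡ-≤ 30 (size-key xs))) }
  ; poly = poly+ (polyConst 30) (poly* (linear 1 _) (polyConst 30)) }

setP : Prim (vec (bits k) ∷ raw ∷ raw ∷ []) raw
setP {k} = record
  { fun = λ { (xs ∷ x ∷ t ∷ []) → setD (enc (vec (bits k)) xs) x t } ; tm = call setTm (var #1 ∷ var #2 ∷ var #3 ∷ [])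
  ; tm-ok = λ { (xs ∷ x ∷ t ∷ []) → set-ok (enc (vec (bits k)) xs) x t }
  ; bound = λ n → 50 + (1 + n * (1 + (1 + k * 4))) * ((1 + n * (1 + (1 + k * 4))) * 200)
  ; bound-ok = λ { (xs ∷ x ∷ t ∷ []) → +-mono-≤ {38} (≤-by 12 refl)
                     (≤-trans (set-cost (enc (vec (bits k)) xs) x t)
                       (*-mono-≤ (size-key xs) (*-monoˡ-≤ 200 (size-key xs)))) }
  ; poly = poly+ (polyConst 50) (poly* (linear 1 _) (poly* (linear 1 _) (polyConst 200))) }

-- Characterization of target sets

infix 3 !_
!_ : Bool → Set
! b = b ≡ true

!? : ∀ b → Dec (! b)
!? b = b ≟ᵇ true

Eventually : (ℕ → Set) → Set
Eventually P = ∃[ k ] (∀ s → k ≤ s → P s)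

eventually-∀ : ∀ {n} {P : ℕ → Fin n → Set} → (∀ w → Eventually λ s → P s w) → Eventually λ s → ∀ w → P s w
eventually-∀ {zero}  h = 0 , λ s _ ()
eventually-∀ {suc n} {P} h with h zero | eventually-∀ {n} {λ s w → P s (suc w)} (h ∘ suc)
... | k , f | l , g = k ⊔ l , λ s le → λ
  { zero    → f s (≤-trans (m≤m⊔n k l) le)
  ; (suc w) → g s (≤-trans (m≤n⊔m k l) le) w }

module Walks {n} (adj : Fin n → Fin n → Bool) (o : Fin n → Bool) where

  -- A walk between the given vertices whose length is even (false) or odd
  -- (true) and all of whose vertices except possibly the last one are in o.
  data Reach : Bool → Fin n → Fin n → Set where
    here : ∀ {u} → Reach false u u
    step : ∀ {j u y v} → ! o u → ! adj u y → Reach j y v → Reach (not j) u v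

  snoc : ∀ {j u y v} → Reach j u y → ! o y → ! adj y v → Reach (not j) u v
  snoc here          oy e = step oy e here
  snoc (step ou f r) oy e = step ou f (snoc r oy e)

  data Snoc (u v : Fin n) : Bool → Set where
    empty : u ≡ v → Snoc u v false
    last  : ∀ {j y} → Reach j u y → ! o y → ! adj y v → Snoc u v (not j)

  unsnoc : ∀ {j u v} → Reach j u v → Snoc u v j
  unsnoc here = empty refl
  unsnoc (step ou e r) with unsnoc r
  ... | empty refl   = last here ou e
  ... | last r′ oy f = last (step ou e r′) oy f

-- All that the dynamic program sees of the input graph. `reach` belongs here because it does not
-- depend on the set X that is sought.
record Signature (n : ℕ) : Set where
  field
    adj   : Fin n → Fin n → Bool
    z o a : Fin n → Bool
    reach : Bool → Fin n → Fin n → Bool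

-- A run of the activation process on a graph whose vertices have threshold
-- zero (z), one (o), or at least two and equal to the degree (a).
record Process (n : ℕ) : Set where
  field
    signature : Signature n
  open Signature signature public
  field
    adj-sym : ∀ {u v} → ! adj u v → ! adj v u
    cls     : ∀ u → (! z u) ⊎ (! o u) ⊎ (! a u)
    o¬z     : ∀ {u} → ! o u → ! z u → ⊥
    o¬a     : ∀ {u} → ! o u → ! a u → ⊥
    act     : ℕ → Fin n → Bool
    act-z   : ∀ {s u} → ! z u → ! act (suc s) u
    act-o   : ∀ {s u v} → ! o u → ! adj u v → ! act s v → ! act (suc s) u
    act-o⁻¹ : ∀ {s u} → ! o u → ! act (suc s) u → ∃[ v ] ((! adj u v) × (! act s v))
    act-a   : ∀ {s u} → ! a u → (∀ v → ! adj u v → ! act s v) → ! act (suc s) u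
    act-a⁻¹ : ∀ {s u} → ! a u → ! act (suc s) u → ∀ v → ! adj u v → ! act s v
    reach-e : ∀ {j u v} → ! reach j u v → Walks.Reach adj o j u v
    reach-i : ∀ {j u v} → Walks.Reach adj o j u v → ! reach j u v

  reach? : ∀ j u v → Dec (Walks.Reach adj o j u v)
  reach? j u v with !? (reach j u v)
  ... | yes h = yes (reach-e h)
  ... | no ¬h = no (¬h ∘ reach-i)

module Characterization {n} (P : Process n) where
  open Process P
  open Walks adj o

  -- The second alternative records a walk of the other parity to a zero vertex through its last OR
  -- vertex. So both parities count, and yet the notion depends only on the vertices reached with
  -- parity `j`, as `exempt-same` requires.
  Exempt : Bool → Fin n → Set
  Exempt j u = ∃[ y ] (Reach j u y × ((! z y) ⊎ ((! o y) × ∃[ w ] ((! adj y w) × (! z w)))))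

  exempt? : ∀ j u → Dec (Exempt j u)
  exempt? j u = any? λ y → reach? j u y ×-dec (!? (z y) ⊎-dec (!? (o y) ×-dec any? λ w → !? (adj y w) ×-dec !? (z w)))

  Iso : Fin n → Set
  Iso u = (! o u) × (∀ v → ! adj u v → ! a v)

  record Good : Set where
    field
      and-and : ∀ {u v} → ! a u → ! a v → ! adj u v → (! act 0 u) × (∀ w → ! adj u w → ! act 0 w)
      iso₀    : ∀ {u} → Iso u → ∃[ v ] ((! adj u v) × (∀ w → ! adj v w → ! act 0 w))
      iso₁    : ∀ {u} → Iso u → ∃[ v ] ((! adj u v) × (∀ w → ! adj v w → ! act 1 w))
      hit     : ∀ {u} j → ! o u → ¬ Exempt j u → ∃[ v ] (Reach j u v × (! act 0 v))

  parity : ℕ → Bool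
  parity zero    = false
  parity (suc s) = not (parity s)

  not-fixed : ∀ b → b ≢ not b
  not-fixed true  ()
  not-fixed false ()

  module Sufficient (g : Good) where
    open Good g

    -- The property reproduces itself: the neighbours of such an AND vertex are zero, or OR vertices
    -- that it activates itself, or AND vertices with the same property.
    stable : ∀ s {u v} → ! a u → ! a v → ! adj u v → (! act s u) × (∀ w → ! adj u w → ! act s w)
    stable zero    au av e = and-and au av e
    stable (suc s) {u} au av e = act-a au (proj₂ (stable s au av e)) , nbr
      where
      nbr : ∀ w → ! adj u w → ! act (suc s) w
      nbr w f with cls w
      ... | inj₁ zw        = act-z zw
      ... | inj₂ (inj₁ ow) = act-o ow (adj-sym f) (proj₁ (stable s au av e))
      ... | inj₂ (inj₂ aw) = act-a aw (proj₂ (stable s aw au (adj-sym f)))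

    -- The neighbour found for `s` also serves for `s + 2`: it is active at `s + 1` and then
    -- reactivates its OR neighbours. The two parts of (2) are thus the two base cases.
    iso-nbr : ∀ s {u} → Iso u → ∃[ v ] ((! adj u v) × (∀ w → ! adj v w → ! act s w))
    iso-nbr 0 i = iso₀ i
    iso-nbr 1 i = iso₁ i
    iso-nbr (suc (suc s)) i@(_ , all-a) with iso-nbr s i
    ... | v , e , h = v , e , nbr
      where
      nbr : ∀ w → ! adj v w → ! act (suc (suc s)) w
      nbr w f with cls w
      ... | inj₁ zw        = act-z zw
      ... | inj₂ (inj₁ ow) = act-o ow (adj-sym f) (act-a (all-a v e) h)
      ... | inj₂ (inj₂ aw) = proj₁ (stable (suc (suc s)) aw (all-a v e) (adj-sym f))

    iso-active : ∀ s {u} → Iso u → ! act s u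
    iso-active s i with iso-nbr s i
    ... | v , e , h = h _ (adj-sym e)

    hit-active : ∀ {j u v} → Reach j u v → ! act 0 v → ∃[ k ] (parity k ≡ j × (! act k u))
    hit-active here x = 0 , refl , x
    hit-active (step ou e r) x with hit-active r x
    ... | k , p , h = suc k , cong not p , act-o ou e h

    -- Adjacent OR vertices keep reactivating each other, so one activation recurs at all later
    -- times of the same parity.
    bounce : ∀ d {k u y} → ! o u → ! o y → ! adj u y → ! act k u → parity (d + k) ≡ parity k → ! act (d + k) u
    bounce zero          ou oy e h p = h
    bounce (suc zero)    ou oy e h p = contradiction (sym p) (not-fixed _)
    bounce (suc (suc d)) ou oy e h p =
      act-o ou e (act-o oy (adj-sym e) (bounce d ou oy e h (trans (sym (not-involutive _)) p)))

    exempt-active : ∀ {j u y} → Reach j u y → (! z y) ⊎ ((! o y) × ∃[ w ] ((! adj y w) × (! z w))) →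
                    Eventually λ s → ! act s u
    exempt-active here (inj₁ zu) = 1 , λ { (suc s) _ → act-z zu }
    exempt-active here (inj₂ (ou , w , e , zw)) = 2 , λ { (suc (suc s)) _ → act-o ou e (act-z zw) ; (suc zero)
          (s≤s ()) }
    exempt-active (step ou e r) t with exempt-active r t
    ... | k , h = suc k , λ { (suc s) (s≤s le) → act-o ou e (h s le) }

    -- Outside `Iso` some neighbour is zero or OR. A zero neighbour exempts `u`. With an OR
    -- neighbour, `bounce` makes one activation per parity class enough, and (3) provides both.
    o-active : ∀ {u} → ! o u → Eventually λ s → ! act s u
    o-active {u} ou with all? (λ v → !? (adj u v) →-dec !? (a v))
    ... | yes i = 0 , λ s _ → iso-active s (ou , i)
    ... | no ¬i with ¬∀⟶∃¬ n _ (λ v → !? (adj u v) →-dec !? (a v)) ¬i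
    ...   | v , ¬av with cls v | decidable-stable (!? (adj u v)) (λ ¬e → ¬av λ e → ⊥-elim (¬e e))
    ...     | inj₁ zv        | e = exempt-active here (inj₂ (ou , v , e , zv))
    ...     | inj₂ (inj₂ av) | e = ⊥-elim (¬av λ _ → av)
    ...     | inj₂ (inj₁ ov) | e with exempt? false u | exempt? true u
    ...       | yes (_ , r , t) | _ = exempt-active r t
    ...       | no _ | yes (_ , r , t) = exempt-active r t
    ...       | no ¬p | no ¬q with hit false ou ¬p | hit true ou ¬q
    ...         | _ , r , x | _ , r′ , x′ with hit-active r x | hit-active r′ x′
    ...           | k , p , h | k′ , p′ , h′ = k ⊔ k′ , λ s le → go s le (parity s) refl
      where
      from : ∀ {k s} → k ≤ s → ! act k u → parity s ≡ parity k → ! act s u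
      from {k} {s} le h p with m≤n⇒∃[o]m+o≡n le
      ... | d , refl = subst (λ i → ! act i u) (+-comm d k)
                         (bounce d ou ov e h (trans (cong parity (+-comm d k)) p))
      go : ∀ s → k ⊔ k′ ≤ s → ∀ j → parity s ≡ j → ! act s u
      go s le false q = from (≤-trans (m≤m⊔n k k′) le) h (trans q (sym p))
      go s le true  q = from (≤-trans (m≤n⊔m k k′) le) h′ (trans q (sym p′))

    active : ∀ u → Eventually λ s → ! act s u
    active u with cls u
    ... | inj₁ zu        = 1 , λ { (suc s) _ → act-z zu }
    ... | inj₂ (inj₁ ou) = o-active ou
    ... | inj₂ (inj₂ au) with eventually-∀ nbr
      where
      nbr : ∀ w → Eventually λ s → ! adj u w → ! act s w
      nbr w with cls w | !? (adj u w)
      ... | _ | no ¬e = 0 , λ s _ e → ⊥-elim (¬e e)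
      ... | inj₁ zw | yes _ = 1 , λ { (suc s) _ _ → act-z zw }
      ... | inj₂ (inj₁ ow) | yes _ = proj₁ (o-active ow) , λ s le _ → proj₂ (o-active ow) s le
      ... | inj₂ (inj₂ aw) | yes e = 0 , λ s _ f → proj₁ (stable s aw au (adj-sym e))
    ...   | k , h = suc k , λ { (suc s) (s≤s le) → act-a au (h s le) }

    eventually-active : Eventually λ s → ∀ u → ! act s u
    eventually-active = eventually-∀ active

  module Necessary (t : Eventually λ s → ∀ u → ! act s u) where

    -- The phase in which everything is active is run backwards, two steps at a time.
    persistent : ∀ {u} → (∀ s → ! act (2 + s) u → ! act s u) → ∀ s → ! act s u
    persistent {u} back s = down (proj₁ t) (proj₂ t _ (≤-trans (m≤m+n _ _) (m≤m+n _ s)) u)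
      where
      down : ∀ i → ! act (i + i + s) u → ! act s u
      down zero    h = h
      down (suc i) h = down i (back _ (subst (λ k → ! act (suc (k + s)) u) (+-suc i i) h))

    -- The parity of those walks from `u` whose ends are inactive at time `s`; it starts with `j`
    -- and alternates.
    jp : Bool → ℕ → Bool
    jp j zero    = j
    jp j (suc s) = not (jp j s)

    good : Good
    good = record { and-and = λ au av e → and-all au av e 0 , λ w f → act-a⁻¹ au (and-all au av e 1) w f
                  ; iso₀ = iso₀ ; iso₁ = iso₁ ; hit = hit }
      where
      and-all : ∀ {u v} → ! a u → ! a v → ! adj u v → ∀ s → ! act s u
      and-all au av e = persistent λ s h → act-a⁻¹ av (act-a⁻¹ au h _ e) _ (adj-sym e)

      iso-all : ∀ {u} → Iso u → ∀ s → ! act s u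
      iso-all {u} (ou , all-a) = persistent back
        where
        back : ∀ s → ! act (2 + s) u → ! act s u
        back s h with act-o⁻¹ ou h
        ... | v , e , h′ = act-a⁻¹ (all-a v e) h′ _ (adj-sym e)

      iso₀ : ∀ {u} → Iso u → ∃[ v ] ((! adj u v) × (∀ w → ! adj v w → ! act 0 w))
      iso₀ i@(ou , all-a) with act-o⁻¹ ou (iso-all i 2)
      ... | v , e , h = v , e , act-a⁻¹ (all-a v e) h

      iso₁ : ∀ {u} → Iso u → ∃[ v ] ((! adj u v) × (∀ w → ! adj v w → ! act 1 w))
      iso₁ i@(ou , all-a) with act-o⁻¹ ou (iso-all i 3)
      ... | v , e , h = v , e , act-a⁻¹ (all-a v e) h

      hit : ∀ {u} j → ! o u → ¬ Exempt j u → ∃[ v ] (Reach j u v × (! act 0 v))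
      hit {u} j ou ¬ex with any? (λ v → reach? j u v ×-dec !? (act 0 v))
      ... | yes h = h
      ... | no ¬h = ⊥-elim (final (jp j (proj₁ t)) refl)
        where
        base : ∀ y → Reach j u y → ¬ (! act 0 y)
        base y r x = ¬h (y , r , x)

        either : ∀ b j → (b ≡ j) ⊎ (not b ≡ j)
        either true  true  = inj₁ refl
        either true  false = inj₂ refl
        either false true  = inj₂ refl
        either false false = inj₁ refl

        mutual
          -- An OR vertex at the end of a walk could only be activated by the end of a walk one step
          -- longer. An AND vertex there needs the OR vertex just before it on the walk, which is
          -- dead already.
          dead : ∀ s y → Reach (jp j s) u y → ¬ (! z y) → ¬ (! act s y)
          dead zero    y r ¬zy h = base y r h
          dead (suc s) y r ¬zy h with cls y
          ... | inj₁ zy = ¬zy zy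
          ... | inj₂ (inj₁ oy) with act-o⁻¹ oy h
          ...   | v , e , h′ with !? (z v)
          ...     | no ¬zv = dead s v (subst (λ b → Reach b u v) (not-involutive _) (snoc r oy e)) ¬zv h′
          ...     | yes zv with either (jp j s) j
          ...       | inj₁ eq = ¬ex (v , subst (λ b → Reach b u v) (trans (not-involutive _) eq) (snoc r oy e)
                , inj₁ zv)
          ...       | inj₂ eq = ¬ex (y , subst (λ b → Reach b u y) eq r , inj₂ (oy , v , e , zv))
          dead (suc s) y r ¬zy h | inj₂ (inj₂ ay) = dead-a s y refl (unsnoc r) ay h

          dead-a : ∀ s y {b} → b ≡ not (jp j s) → Snoc u y b → ! a y → ¬ (! act (suc s) y)
          dead-a s y _ (empty refl) ay h = o¬a ou ay
          dead-a s y eq (last {i} {y′} r oy′ e) ay h =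
            dead s y′ (subst (λ b → Reach b u y′) (trans (sym (not-involutive i)) (trans (cong not eq)
                  (not-involutive _))) r)
              (o¬z oy′) (act-a⁻¹ ay h y′ (adj-sym e))

        -- The empty walk is even, so `u` would be inactive at one of two consecutive times after
        -- everything has become active.
        final : ∀ b → jp j (proj₁ t) ≡ b → ⊥
        final false eq = dead _ u (subst (λ b → Reach b u u) (sym eq) here) (o¬z ou) (proj₂ t _ ≤-refl u)
        final true  eq = dead (suc (proj₁ t)) u (subst (λ b → Reach (not b) u u) (sym eq) here) (o¬z ou) (proj₂
              t _ (n≤1+n _) u)

-- Labels, demands and local checks

infixr 4 _⇒_
infix  5 _==_

_⇒_ _==_ : Bool → Bool → Bool
a ⇒ b  = not a ∨ b
a == b = (a ⇒ b) ∧ (b ⇒ a)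

∧-i : ∀ {a b} → ! a → ! b → ! a ∧ b
∧-i refl refl = refl

∧-e₁ : ∀ {a b} → ! a ∧ b → ! a
∧-e₁ {true} h = refl

∧-e₂ : ∀ {a b} → ! a ∧ b → ! b
∧-e₂ {true} h = h

∨-i₁ : ∀ {a b} → ! a → ! a ∨ b
∨-i₁ refl = refl

∨-i₂ : ∀ {a b} → ! b → ! a ∨ b
∨-i₂ {true}  refl = refl
∨-i₂ {false} refl = refl

∨-e : ∀ {a b} → ! a ∨ b → (! a) ⊎ (! b)
∨-e {true}  h = inj₁ refl
∨-e {false} h = inj₂ h

⇒-i : ∀ {a b} → (! a → ! b) → ! (a ⇒ b)
⇒-i {true}  h = h refl
⇒-i {false} h = refl

⇒-e : ∀ {a b} → ! (a ⇒ b) → ! a → ! b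
⇒-e h refl = h

not-e : ∀ {a} → ! not a → ¬ (! a)
not-e {false} h ()

not-i : ∀ {a} → ¬ (! a) → ! not a
not-i {true}  h = ⊥-elim (h refl)
not-i {false} h = refl

¬!⇒false : ∀ {a} → ¬ (! a) → a ≡ false
¬!⇒false {true}  h = ⊥-elim (h refl)
¬!⇒false {false} h = refl

≡-i : ∀ {a b} → (! a → ! b) → (! b → ! a) → a ≡ b
≡-i {true}  {b}     f g = sym (f refl)
≡-i {false} {true}  f g = g refl
≡-i {false} {false} f g = refl

==-i : ∀ {a b} → a ≡ b → ! a == b
==-i {true}  refl = refl
==-i {false} refl = refl

==-e : ∀ {a b} → ! a == b → a ≡ b
==-e h = ≡-i (⇒-e (∧-e₁ h)) (⇒-e (∧-e₂ h))

allF anyF : (Fin n → Bool) → Bool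
allF p = allV (tabulate p)
anyF p = anyV (tabulate p)

allF-e : ∀ {p : Fin n → Bool} → ! allF p → ∀ i → ! p i
allF-e h zero    = ∧-e₁ h
allF-e h (suc i) = allF-e (∧-e₂ h) i

allF-i : ∀ {p : Fin n → Bool} → (∀ i → ! p i) → ! allF p
allF-i {zero}  h = refl
allF-i {suc n} h = ∧-i (h zero) (allF-i (h ∘ suc))

anyF-cong : ∀ {p q : Fin n → Bool} → (∀ i → p i ≡ q i) → anyF p ≡ anyF q
anyF-cong h = cong anyV (tabulate-cong h)

anyF-e : ∀ {p : Fin n → Bool} → ! anyF p → ∃[ i ] (! p i)
anyF-e {suc n} {p} h with ∨-e {p zero} h
... | inj₁ q = zero , q
... | inj₂ q with anyF-e q
...   | i , r = suc i , r

anyF-i : ∀ {p : Fin n → Bool} i → ! p i → ! anyF p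
anyF-i {p = p} zero    h = ∨-i₁ h
anyF-i {p = p} (suc i) h = ∨-i₂ {p zero} (anyF-i i h)

-- The demands of a vertex: near i asks for a neighbour with mark wanted i,
-- and walk j asks for a vertex with mark 0 at the end of a walk of parity j.
data Kind : Set where
  near : Fin 3 → Kind
  walk : Bool → Kind

pattern n0 = near #0
pattern n1 = near #1
pattern n2 = near #2
pattern d0 = walk false
pattern d1 = walk true

-- `n2` and `n0` are the two parts of (2): mark 1 or 2 of an AND neighbour certifies that its whole
-- neighbourhood is active at time 0 or 1. `n1` justifies mark 1 of an OR vertex by a neighbour in
-- X.
wanted : Fin 3 → Fin 3
wanted #0 = #2
wanted #1 = #0
wanted #2 = #1

anyK allK : (Kind → Bool) → Bool
anyK p = p n0 ∨ (p n1 ∨ (p n2 ∨ (p d0 ∨ p d1)))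
allK p = p n0 ∧ (p n1 ∧ (p n2 ∧ (p d0 ∧ p d1)))

allK-e : ∀ {p} → ! allK p → ∀ k → ! p k
allK-e {p} h k = go k
  where
  h₁ = ∧-e₂ {p n0} h
  h₂ = ∧-e₂ {p n1} h₁
  h₃ = ∧-e₂ {p n2} h₂
  go : ∀ k → ! p k
  go n0 = ∧-e₁ {p n0} h
  go n1 = ∧-e₁ {p n1} h₁
  go n2 = ∧-e₁ {p n2} h₂
  go d0 = ∧-e₁ {p d0} h₃
  go d1 = ∧-e₂ {p d0} h₃

allK-i : ∀ {p} → (∀ k → ! p k) → ! allK p
allK-i h = ∧-i (h n0) (∧-i (h n1) (∧-i (h n2) (∧-i (h d0) (h d1))))

anyK-e : ∀ {p} → ! anyK p → ∃[ k ] (! p k)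
anyK-e {p} h with ∨-e {p n0} h
... | inj₁ q = n0 , q
... | inj₂ h with ∨-e {p n1} h
...   | inj₁ q = n1 , q
...   | inj₂ h with ∨-e {p n2} h
...     | inj₁ q = n2 , q
...     | inj₂ h with ∨-e {p d0} h
...       | inj₁ q = d0 , q
...       | inj₂ q = d1 , q

anyK-i : ∀ {p} k → ! p k → ! anyK p
anyK-i {p} n0 h = ∨-i₁ h
anyK-i {p} n1 h = ∨-i₂ {p n0} (∨-i₁ h)
anyK-i {p} n2 h = ∨-i₂ {p n0} (∨-i₂ {p n1} (∨-i₁ h))
anyK-i {p} d0 h = ∨-i₂ {p n0} (∨-i₂ {p n1} (∨-i₂ {p n2} (∨-i₁ h)))
anyK-i {p} d1 h = ∨-i₂ {p n0} (∨-i₂ {p n1} (∨-i₂ {p n2} (∨-i₂ {p d0} h)))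

-- The component of a label that records the progress of a demand. Demands
-- sharing a component are never made by the same vertex.
parityMark : Bool → Fin 3
parityMark false = #0
parityMark true  = #1

idx : Kind → Fin 3
idx (near i) = i
idx (walk j) = parityMark j

-- Missing children are replaced by `leaf`, so that one kind of node covers all types of nodes of a
-- nice decomposition.
data BT (n : ℕ) : Set where
  leaf : BT n
  node : Subset n → BT n → BT n → BT n

topBag : BT n → Subset n
topBag leaf         = tabulate λ _ → false
topBag (node X _ _) = X

Label Key : ℕ → Set
Label n = Vec (Vec Bool 9) n
Key   n = Vec (Vec Bool 6) n

-- The components of a label: three marks, claiming that the vertex is active at
-- times 0, 1 and 2, and for every demand slot whether the demand is met in the
-- left subtree, or else in the right subtree or by the current bags.
mark inL inR : Label n → Fin 3 → Fin n → Bool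
mark c i u = lookup (lookup c u) (i ↑ˡ 6)
inL  c i u = lookup (lookup c u) (3 ↑ʳ (i ↑ˡ 3))
inR  c i u = lookup (lookup c u) (6 ↑ʳ i)

-- Masking with the bag makes a key depend on the vertices of the bag only, so that a parent can
-- compute the keys under which its children were stored.
row : Subset n → (Fin 3 → Fin n → Bool) → (Fin 3 → Fin n → Bool) → Fin n → Vec Bool 6
row M f g u =
  (lookup M u ∧ f #0 u) ∷ (lookup M u ∧ f #1 u) ∷ (lookup M u ∧ f #2 u) ∷
  (lookup M u ∧ g #0 u) ∷ (lookup M u ∧ g #1 u) ∷ (lookup M u ∧ g #2 u) ∷ []

key : Subset n → (Fin 3 → Fin n → Bool) → (Fin 3 → Fin n → Bool) → Key n
key M f g = tabulate (row M f g)

keyMark keyMet : Key n → Fin 3 → Fin n → Bool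
keyMark κ i u = lookup (lookup κ u) (i ↑ˡ 3)
keyMet  κ i u = lookup (lookup κ u) (3 ↑ʳ i)

keyMark-key : ∀ (M : Subset n) f g i u → keyMark (key M f g) i u ≡ lookup M u ∧ f i u
keyMark-key M f g i u = trans (cong (λ z → lookup z (i ↑ˡ 3)) (lookup∘tabulate (row M f g) u)) (go i)
  where
  go : ∀ i → lookup (row M f g u) (i ↑ˡ 3) ≡ lookup M u ∧ f i u
  go #0 = refl
  go #1 = refl
  go #2 = refl

keyMet-key : ∀ (M : Subset n) f g i u → keyMet (key M f g) i u ≡ lookup M u ∧ g i u
keyMet-key M f g i u = trans (cong (λ z → lookup z (3 ↑ʳ i)) (lookup∘tabulate (row M f g) u)) (go i)
  where
  go : ∀ i → lookup (row M f g u) (3 ↑ʳ i) ≡ lookup M u ∧ g i u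
  go #0 = refl
  go #1 = refl
  go #2 = refl

emptyKey : Key n
emptyKey = tabulate λ u → false ∷ false ∷ false ∷ false ∷ false ∷ false ∷ []

countF : (Fin n → Bool) → ℕ
countF p = countV (tabulate p)

module System {n} (S : Signature n) where
  open Signature S

  iso mixed : Fin n → Bool
  iso u   = o u ∧ allF λ v → adj u v ⇒ a v
  mixed u = a u ∧ anyF λ v → adj u v ∧ a v

  exempt : Bool → Fin n → Bool
  exempt j u = anyF λ y → reach j u y ∧ (z y ∨ (o y ∧ anyF λ w → adj y w ∧ z w))

  -- Walk demands with equal reach sets are met by the same vertices and are exempt together, so
  -- they can share one record.
  same : Bool → Bool → Fin n → Fin n → Bool
  same i j u v = o u ∧ (o v ∧ allF λ w → reach i u w == reach j v w)

  rel : Kind → Fin n → Kind → Fin n → Bool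
  rel (near i) u (near j) v = eqF i j ∧ eqF u v
  rel (walk i) u (walk j) v = same i j u v
  rel _        u _        v = false

  module Marks (f : Fin 3 → Fin n → Bool) where

    -- A host keeps bits for the demand; an obligation has to be met. An OR vertex with mark 0 or 1
    -- meets its own even or odd walk demand and hence needs no bits for it, which frees the slot
    -- for `n0` or `n1`.
    host oblig : Kind → Fin n → Bool
    host n0       u = iso u
    host n1       u = o u ∧ f #1 u
    host n2       u = iso u
    host (walk j) u = o u ∧ not (f (parityMark j) u)
    oblig (near i) u = host (near i) u
    oblig (walk j) u = o u ∧ not (exempt j u)

    sup : Kind → Fin n → Fin n → Bool
    sup (near i) u v = adj u v ∧ f (wanted i) v
    sup (walk j) u v = reach j u v ∧ f #0 v

    Sat : Kind → Fin n → Set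
    Sat k u = ∃[ v ] (! sup k u v)

  module Bags (X B₁ B₂ : Subset n) (c : Label n) where
    open Marks (mark c) public

    U : Fin n → Bool
    U u = lookup X u ∨ (lookup B₁ u ∨ lookup B₂ u)

    -- An open demand may be handed over to any vertex of the bag with a related demand, whether or
    -- not that vertex is a host.
    carrier : Subset n → Kind → Fin n → Bool
    carrier M k u = anyF λ v → lookup M v ∧ anyK λ k′ → rel k u k′ v

    -- Related hosts place their common demand alike, so its state can be read off at any of them,
    -- in particular at a host in the bag of a child.
    agree : Kind → Kind → Fin n → Fin n → Bool
    agree k k′ u v = (U v ∧ (host k′ v ∧ rel k u k′ v)) ⇒
      (inL c (idx k) u == inL c (idx k′) v) ∧ (inR c (idx k) u == inR c (idx k′) v)

    -- A claim about a subtree needs a carrier in its top bag, where the claim continues; for the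
    -- right slot, a witness in the current bags is the alternative. An obligation that is not
    -- claimed as met must be carried on by `X`.
    demand : Kind → Fin n → Bool
    demand k u = host k u ⇒
      ((inL c (idx k) u ⇒ carrier B₁ k u) ∧
      ((inR c (idx k) u ⇒ carrier B₂ k u ∨ anyF λ v → U v ∧ sup k u v) ∧
      ((oblig k u ⇒ carrier X k u ∨ (inL c (idx k) u ∨ inR c (idx k) u)) ∧
       allF λ v → allK λ k′ → agree k k′ u v)))

    edges : Fin n → Bool
    edges u = a u ⇒ allF λ v → (U v ∧ adj u v) ⇒
      ((mark c #1 u ⇒ mark c #0 v) ∧ (mark c #2 u ⇒ mark c #1 v))

    local : Fin n → Bool
    local u = (iso u ∨ mixed u ⇒ mark c #0 u ∧ mark c #1 u) ∧ (edges u ∧ allK λ k → demand k u)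

    check : Bool
    check = allF λ u → U u ⇒ local u

    forgotten : Fin n → Bool
    forgotten u = (lookup B₁ u ∨ lookup B₂ u) ∧ (not (lookup X u) ∧ mark c #0 u)

    keyL keyR keyT : Key n
    keyL = key B₁ (mark c) (inL c)
    keyR = key B₂ (mark c) (inR c)
    keyT = key X (mark c) λ i u → inL c i u ∨ inR c i u

  Allowed : (Fin n → List (Vec Bool 9)) → Label n → Set
  Allowed opts c = ∀ u → lookup c u ∈ opts u

  module Traces (options : Subset n → Subset n → Subset n → Fin n → List (Vec Bool 9)) where

    -- A run of the dynamic program that ends in the table entry with this key and cost. Vertices
    -- are paid for when they are forgotten, and the truncations at `n` mirror `plusD`.
    data Trace : BT n → Key n → ℕ → Set where
      leaf : Trace leaf emptyKey 0
      node : ∀ {X L R m₁ m₂} (c : Label n) → let open Bags X (topBag L) (topBag R) c in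
             Allowed (options X (topBag L) (topBag R)) c → ! check →
             Trace L keyL m₁ → Trace R keyR m₂ →
             Trace (node X L R) keyT ((((countF forgotten + m₁) ⊓ n) + m₂) ⊓ n)

-- Trees of bags

inT : BT n → Fin n → Bool
inT leaf         u = false
inT (node X L R) u = lookup X u ∨ (inT L u ∨ inT R u)

top : BT n → Fin n → Bool
top T u = lookup (topBag T) u

¬top-leaf : ∀ {u : Fin n} → ¬ (! top leaf u)
¬top-leaf {u = u} h with trans (sym h) (lookup∘tabulate (λ _ → false) u)
... | ()

top⇒inT : ∀ (T : BT n) {u} → ! top T u → ! inT T u
top⇒inT leaf {u} h = ⊥-elim (¬top-leaf {u = u} h)
top⇒inT (node X L R) h = ∨-i₁ h

-- Connectedness of the occurrences of each vertex around one node, expressed by membership instead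
-- of paths.
record Interface (X : Subset n) (L R : BT n) : Set where
  field
    topˡ : ∀ u → ! lookup X u → ! inT L u → ! top L u
    topʳ : ∀ u → ! lookup X u → ! inT R u → ! top R u
    both : ∀ u → ! inT L u → ! inT R u → ! lookup X u

Connected : BT n → Set
Connected leaf         = ⊤
Connected (node X L R) = Interface X L R × Connected L × Connected R

data Covered {n} (u v : Fin n) : BT n → Set where
  here  : ∀ {X L R} → ! lookup X u → ! lookup X v → Covered u v (node X L R)
  left  : ∀ {X L R} → Covered u v L → Covered u v (node X L R)
  right : ∀ {X L R} → Covered u v R → Covered u v (node X L R)

countF-≤ : (p : Fin n → Bool) → countF p ≤ n
countF-≤ {zero}  p = z≤n
countF-≤ {suc n} p with p zero
... | true  = s≤s (countF-≤ (p ∘ suc))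
... | false = m≤n⇒m≤1+n (countF-≤ (p ∘ suc))

countF-cong : {p q : Fin n → Bool} → (∀ u → p u ≡ q u) → countF p ≡ countF q
countF-cong {zero}  h = refl
countF-cong {suc n} {p} {q} h with p zero | q zero | h zero
... | true  | true  | refl = cong suc (countF-cong (h ∘ suc))
... | false | false | refl = countF-cong (h ∘ suc)

countF-mono : {p q : Fin n → Bool} → (∀ u → ! p u → ! q u) → countF p ≤ countF q
countF-mono {zero}  h = z≤n
countF-mono {suc n} {p} {q} h with p zero | q zero | h zero
... | true  | true  | _  = s≤s (countF-mono (h ∘ suc))
... | true  | false | h₀ = contradiction (h₀ refl) λ ()
... | false | true  | _  = m≤n⇒m≤1+n (countF-mono (h ∘ suc))
... | false | false | _  = countF-mono (h ∘ suc)

countF-≤-or-< : {p q : Fin n → Bool} → (∀ u → ! p u → ! q u) → (∀ u → ! q u → ! p u) ⊎ (countF p < countF q)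
countF-≤-or-< {zero}  h = inj₁ λ ()
countF-≤-or-< {suc n} {p} {q} h with p zero in ep | q zero in eq | h zero | countF-≤-or-< {n} (h ∘ suc)
... | true  | true  | _  | inj₁ g = inj₁ λ { zero _ → ep ; (suc u) → g u }
... | true  | true  | _  | inj₂ g = inj₂ (s≤s g)
... | true  | false | h₀ | _      = contradiction (h₀ refl) λ ()
... | false | true  | _  | _      = inj₂ (s≤s (countF-mono (h ∘ suc)))
... | false | false | _  | inj₁ g = inj₁ λ { zero k → contradiction (trans (sym eq) k) λ () ; (suc u) → g u }
... | false | false | _  | inj₂ g = inj₂ g

countF-false : countF {n} (λ _ → false) ≡ 0
countF-false {zero}  = refl
countF-false {suc n} = countF-false {n}

countF-disjoint : {p q : Fin n → Bool} → (∀ u → ! p u → ¬ (! q u)) →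
                  countF (λ u → p u ∨ q u) ≡ countF p + countF q
countF-disjoint {zero}  h = refl
countF-disjoint {suc n} {p} {q} h with p zero | q zero | h zero
... | true  | true  | h₀ = ⊥-elim (h₀ refl refl)
... | true  | false | _  = cong suc (countF-disjoint (h ∘ suc))
... | false | true  | _  = trans (cong suc (countF-disjoint (h ∘ suc))) (sym (+-suc _ _))
... | false | false | _  = countF-disjoint (h ∘ suc)

below : (Fin n → Bool) → BT n → Fin n → Bool
below x T u = x u ∧ (inT T u ∧ not (top T u))

-- A bag X over L and R forgets the chosen vertices in the bags below it but
-- not in X; connectedness makes this part and the two parts forgotten within
-- L and R disjoint.
count-node : ∀ (x : Fin n → Bool) {X L R} → Interface X L R →
  (g : Fin n → Bool) → (∀ u → g u ≡ (top L u ∨ top R u) ∧ (not (lookup X u) ∧ x u)) →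
  ((countF g + countF (below x L)) ⊓ n + countF (below x R)) ⊓ n ≡ countF (below x (node X L R))
count-node {n} x {X} {L} {R} I g g≡ = trans (cong (λ k → (k + _) ⊓ n) inner) outer
  where
  open Interface I
  gl = λ u → g u ∨ below x L u
  inner : (countF g + countF (below x L)) ⊓ n ≡ countF gl
  inner = trans (cong (_⊓ n) (sym (countF-disjoint dis))) (m≤n⇒m⊓n≡m (countF-≤ gl))
    where
    dis : ∀ u → ! g u → ¬ (! below x L u)
    dis u h k with trans (sym (g≡ u)) h
    ... | h′ with ∨-e {top L u} (∧-e₁ h′)
    ...   | inj₁ t = not-e (∧-e₂ {inT L u} (∧-e₂ {x u} k)) t
    ...   | inj₂ t = not-e (∧-e₁ (∧-e₂ {top L u ∨ top R u} h′))
                       (both u (∧-e₁ (∧-e₂ {x u} k)) (top⇒inT R t))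
  outer : (countF gl + countF (below x R)) ⊓ n ≡ countF (below x (node X L R))
  outer = trans (cong (_⊓ n) (trans (sym (countF-disjoint dis)) (countF-cong eq))) (m≤n⇒m⊓n≡m (countF-≤ _))
    where
    dis : ∀ u → ! gl u → ¬ (! below x R u)
    dis u h k with ∨-e {g u} h
    ... | inj₂ h′ = not-e (∧-e₂ {inT R u} (∧-e₂ {x u} k))
                      (topʳ u (both u (∧-e₁ (∧-e₂ {x u} h′)) (∧-e₁ (∧-e₂ {x u} k))) (∧-e₁ (∧-e₂ {x u} k)))
    ... | inj₁ h₁ with trans (sym (g≡ u)) h₁
    ...   | h′ with ∨-e {top L u} (∧-e₁ h′)
    ...     | inj₁ t = not-e (∧-e₁ (∧-e₂ {top L u ∨ top R u} h′)) (both u (top⇒inT L t) (∧-e₁ (∧-e₂ {x u} k)))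
    ...     | inj₂ t = not-e (∧-e₂ {inT R u} (∧-e₂ {x u} k)) t
    fromL : ∀ u → ! below x L u → ! below x (node X L R) u
    fromL u h = ∧-i {x u} (∧-e₁ {x u} h) (∧-i (∨-i₂ {lookup X u} (∨-i₁ iL))
      (not-i λ Xu → not-e (∧-e₂ {inT L u} (∧-e₂ {x u} h)) (topˡ u Xu iL)))
      where iL = ∧-e₁ (∧-e₂ {x u} h)
    fromR : ∀ u → ! below x R u → ! below x (node X L R) u
    fromR u h = ∧-i {x u} (∧-e₁ {x u} h) (∧-i (∨-i₂ {lookup X u} (∨-i₂ {inT L u} iR))
      (not-i λ Xu → not-e (∧-e₂ {inT R u} (∧-e₂ {x u} h)) (topʳ u Xu iR)))
      where iR = ∧-e₁ (∧-e₂ {x u} h)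
    fromG : ∀ u → ! g u → ! below x (node X L R) u
    fromG u h with trans (sym (g≡ u)) h
    ... | h′ = ∧-i (∧-e₂ {not (lookup X u)} h″) (∧-i (∨-i₂ {lookup X u} (inTT (∨-e {top L u} (∧-e₁ h′)))) (∧-e₁ h″))
      where
      h″ = ∧-e₂ {top L u ∨ top R u} h′
      inTT : (! top L u) ⊎ (! top R u) → ! inT L u ∨ inT R u
      inTT (inj₁ t) = ∨-i₁ (top⇒inT L t)
      inTT (inj₂ t) = ∨-i₂ {inT L u} (top⇒inT R t)
    split′ : ∀ u → ! below x (node X L R) u → (! gl u ∨ below x R u)
    split′ u h with !? (top L u) | !? (top R u) | ∨-e {inT L u} (inLR (∨-e {lookup X u} (∧-e₁ (∧-e₂ {x u} h))))
      where
      inLR : (! lookup X u) ⊎ (! inT L u ∨ inT R u) → ! inT L u ∨ inT R u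
      inLR (inj₁ Xu) = ⊥-elim (not-e (∧-e₂ {lookup X u ∨ (inT L u ∨ inT R u)} (∧-e₂ {x u} h)) Xu)
      inLR (inj₂ k)  = k
    ... | yes tl | _ | _ = ∨-i₁ (∨-i₁ (trans (g≡ u) (∧-i (∨-i₁ tl) (∧-i (∧-e₂ {lookup X u ∨ (inT L u ∨ inT R
          u)} (∧-e₂ {x u} h)) (∧-e₁ {x u} h)))))
    ... | no _ | yes tr | _ = ∨-i₁ (∨-i₁ (trans (g≡ u) (∧-i (∨-i₂ {top L u} tr) (∧-i (∧-e₂ {lookup X u ∨ (inT L
          u ∨ inT R u)} (∧-e₂ {x u} h)) (∧-e₁ {x u} h)))))
    ... | no tl | no tr | inj₁ k = ∨-i₁ {gl u} (∨-i₂ {g u} (∧-i {x u} (∧-e₁ {x u} h) (∧-i k (not-i tl))))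
    ... | no tl | no tr | inj₂ k = ∨-i₂ {gl u} (∧-i {x u} (∧-e₁ {x u} h) (∧-i k (not-i tr)))
    eq : ∀ u → gl u ∨ below x R u ≡ below x (node X L R) u
    eq u = ≡-i (λ h → go (∨-e {gl u} h)) (split′ u)
      where
      go : (! gl u) ⊎ (! below x R u) → ! below x (node X L R) u
      go (inj₂ k) = fromR u k
      go (inj₁ k) with ∨-e {g u} k
      ... | inj₁ k′ = fromG u k′
      ... | inj₂ k′ = fromL u k′

-- Soundness of the dynamic program

Marking : ℕ → Set
Marking n = Fin 3 → Fin n → Bool

-- Equivalence of demands

module Relation {n} (S : Signature n) where
  open Signature S
  open System S

  same-reach : ∀ {i j u v} → ! same i j u v → ∀ w → reach i u w ≡ reach j v w
  same-reach {u = u} {v} h w = ==-e (allF-e (∧-e₂ {o v} (∧-e₂ {o u} h)) w)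

  same-i : ∀ {i j u v} → ! o u → ! o v → (∀ w → reach i u w ≡ reach j v w) → ! same i j u v
  same-i ou ov h = ∧-i ou (∧-i ov (allF-i λ w → ==-i (h w)))

  same-o₁ : ∀ {i j u v} → ! same i j u v → ! o u
  same-o₁ h = ∧-e₁ h

  same-o₂ : ∀ {i j u v} → ! same i j u v → ! o v
  same-o₂ {u = u} h = ∧-e₁ (∧-e₂ {o u} h)

  data Rel : Kind → Fin n → Kind → Fin n → Set where
    near : ∀ {i u} → Rel (near i) u (near i) u
    walk : ∀ {i j u v} → ! same i j u v → Rel (walk i) u (walk j) v

  view : ∀ k u k′ v → ! rel k u k′ v → Rel k u k′ v
  view (near i) u (near j) v h with eqF⇒≡ i j (∧-e₁ h) | eqF⇒≡ u v (∧-e₂ {eqF i j} h)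
  ... | refl | refl = near
  view (walk i) u (walk j) v h = walk h

  unview : ∀ {k u k′ v} → Rel k u k′ v → ! rel k u k′ v
  unview (near {i} {u}) = ∧-i (eqF-refl i) (eqF-refl u)
  unview (walk h) = h

  rel-sym : ∀ {k u k′ v} → ! rel k u k′ v → ! rel k′ v k u
  rel-sym {k} {u} {k′} {v} h with view k u k′ v h
  ... | near = h
  ... | walk s = same-i (same-o₂ s) (same-o₁ s) λ w → sym (same-reach s w)

  rel-trans : ∀ {k u k′ v k″ w} → ! rel k u k′ v → ! rel k′ v k″ w → ! rel k u k″ w
  rel-trans {k} {u} {k′} {v} {k″} {w} h h′ with view k u k′ v h | view k′ v k″ w h′
  ... | near | near = h
  ... | walk s | walk s′ = same-i (same-o₁ s) (same-o₂ s′) λ x → trans (same-reach s x) (same-reach s′ x)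

  exempt-same : ∀ {i j u v} → ! same i j u v → exempt i u ≡ exempt j v
  exempt-same {i} {j} {u} {v} s = ≡-i (go (same-reach s)) (go (sym ∘ same-reach s))
    where
    go : ∀ {i j u v} → (∀ w → reach i u w ≡ reach j v w) → ! exempt i u → ! exempt j v
    go {i} {j} {u} h e with anyF-e e
    ... | y , p = anyF-i y (∧-i (trans (sym (h y)) (∧-e₁ p)) (∧-e₂ {reach i u y} p))

  module _ (f : Marking n) where
    open Marks f

    host-o : ∀ {j u} → ! host (walk j) u → ! o u
    host-o h = ∧-e₁ h

    rel-refl : ∀ {k u} → ! host k u → ! rel k u k u
    rel-refl {near i} {u} h = unview (near {i} {u})
    rel-refl {walk j} {u} h = same-i (host-o h) (host-o h) λ _ → refl

    sup-rel : ∀ {k u k′ v} → ! rel k u k′ v → ∀ w → sup k u w ≡ sup k′ v w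
    sup-rel {k} {u} {k′} {v} h w with view k u k′ v h
    ... | near = refl
    ... | walk s = cong (_∧ f #0 w) (same-reach s w)

    Sat-rel : ∀ {k u k′ v} → ! rel k u k′ v → Sat k′ v → Sat k u
    Sat-rel {k} {u} {k′} {v} h (w , p) = w , trans (sup-rel {k} {u} {k′} {v} h w) p

    oblig-rel : ∀ {k u k′ v} → ! rel k u k′ v → oblig k u ≡ oblig k′ v
    oblig-rel {k} {u} {k′} {v} h with view k u k′ v h
    ... | near = refl
    ... | walk s = cong₂ (λ x y → x ∧ not y) (trans (same-o₁ s) (sym (same-o₂ s))) (exempt-same s)

  module _ {f g : Marking n} where

    host-cong : ∀ {u} → (∀ i → f i u ≡ g i u) → ∀ k → Marks.host f k u ≡ Marks.host g k u
    host-cong h n0 = refl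
    host-cong h n1 = cong (o _ ∧_) (h #1)
    host-cong h n2 = refl
    host-cong h (walk j) = cong (λ b → o _ ∧ not b) (h (parityMark j))

    oblig-cong : ∀ {u} → (∀ i → f i u ≡ g i u) → ∀ k → Marks.oblig f k u ≡ Marks.oblig g k u
    oblig-cong h (near i) = host-cong h (near i)
    oblig-cong h (walk j) = refl

    sup-cong : ∀ {v} → (∀ i → f i v ≡ g i v) → ∀ k u → Marks.sup f k u v ≡ Marks.sup g k u v
    sup-cong h (near i) u = cong (adj u _ ∧_) (h (wanted i))
    sup-cong {v} h (walk j) u = cong (reach j u v ∧_) (h #0)

module Soundness {n} (S : Signature n)
                 (options : Subset n → Subset n → Subset n → Fin n → List (Vec Bool 9)) where
  open Signature S
  open System S
  open Relation S
  open Traces options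

  Agree : Marking n → ∀ {T κ m} → Trace T κ m → Set
  Agree f leaf = ⊤
  Agree f (node {X} {L} {R} c _ _ l r) =
    (∀ u → ! Bags.U X (topBag L) (topBag R) c u → ∀ i → mark c i u ≡ f i u) × Agree f l × Agree f r

  U⊆inT : ∀ {X : Subset n} {L R : BT n} {c u} → ! Bags.U X (topBag L) (topBag R) c u → ! inT (node X L R) u
  U⊆inT {X} {L} {R} {c} {u} h with ∨-e {lookup X u} h
  ... | inj₁ k = ∨-i₁ k
  ... | inj₂ k with ∨-e {lookup (topBag L) u} k
  ...   | inj₁ t = ∨-i₂ {lookup X u} (∨-i₁ (top⇒inT L t))
  ...   | inj₂ t = ∨-i₂ {lookup X u} (∨-i₂ {inT L u} (top⇒inT R t))

  Agree-cong : ∀ {f g T κ m} (t : Trace T κ m) → (∀ u → ! inT T u → ∀ i → f i u ≡ g i u) →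
               Agree f t → Agree g t
  Agree-cong leaf h _ = tt
  Agree-cong (node {X} {L} {R} c _ _ l r) h (p , q , q′) =
    (λ u Uu i → trans (p u Uu i) (h u (U⊆inT {X} {L} {R} {c} Uu) i)) ,
    Agree-cong l (λ u k → h u (∨-i₂ {lookup X u} (∨-i₁ k))) q ,
    Agree-cong r (λ u k → h u (∨-i₂ {lookup X u} (∨-i₂ {inT L u} k))) q′

  top-mark : ∀ {f T κ m} (t : Trace T κ m) → Agree f t → ∀ {u} → ! top T u → ∀ i → keyMark κ i u ≡ f i u
  top-mark leaf _ {u} h = ⊥-elim (¬top-leaf {u = u} h)
  top-mark (node {X} c _ _ l r) (p , _) {u} h i =
    trans (keyMark-key X (mark c) (λ i u → inL c i u ∨ inR c i u) i u) (trans (cong (_∧ mark c i u) h) (p u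
          (∨-i₁ h) i))

  -- Equal keys make the labels of a node and its child coincide on the bag of the child, and a
  -- vertex from both subtrees lies in `X`. So all labels glue to one marking of the graph.
  agreement : ∀ {T κ m} → Connected T → (t : Trace T κ m) → ∃[ f ] Agree f t
  agreement _ leaf = (λ _ _ → false) , tt
  agreement (I , CL , CR) (node {X} {L} {R} c al ch l r) with agreement CL l | agreement CR r
  ... | fL , aL | fR , aR = f , (λ u Uu i → onU u Uu i) ,
      Agree-cong l (λ u k i → sym (onL u k i)) aL , Agree-cong r (λ u k i → sym (onR u k i)) aR
    where
    open Interface I
    open Bags X (topBag L) (topBag R) c
    f : Marking n
    f i u with !? (U u) | !? (inT L u)
    ... | yes _ | _     = mark c i u
    ... | no _  | yes _ = fL i u
    ... | no _  | no _  = fR i u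
    onU : ∀ u → ! U u → ∀ i → mark c i u ≡ f i u
    onU u Uu i with !? (U u)
    ... | yes _ = refl
    ... | no ¬U = ⊥-elim (¬U Uu)
    L-top : ∀ u → ! top L u → ∀ i → mark c i u ≡ fL i u
    L-top u t i = trans (sym (trans (keyMark-key (topBag L) (mark c) (inL c) i u) (cong (_∧ mark c i u) t)))
          (top-mark l aL t i)
    R-top : ∀ u → ! top R u → ∀ i → mark c i u ≡ fR i u
    R-top u t i = trans (sym (trans (keyMark-key (topBag R) (mark c) (inR c) i u) (cong (_∧ mark c i u) t)))
          (top-mark r aR t i)
    onL : ∀ u → ! inT L u → ∀ i → f i u ≡ fL i u
    onL u k i with !? (U u) | !? (inT L u)
    ... | no _ | yes _ = refl
    ... | no _ | no ¬k = ⊥-elim (¬k k)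
    ... | yes Uu | _ with ∨-e {lookup X u} Uu
    ...   | inj₁ Xu = L-top u (topˡ u Xu k) i
    ...   | inj₂ h with ∨-e {lookup (topBag L) u} h
    ...     | inj₁ t = L-top u t i
    ...     | inj₂ t = L-top u (topˡ u (both u k (top⇒inT R t)) k) i
    onR : ∀ u → ! inT R u → ∀ i → f i u ≡ fR i u
    onR u k i with !? (U u) | !? (inT L u)
    ... | no ¬U | yes k′ = ⊥-elim (¬U (∨-i₁ (both u k′ k)))
    ... | no _ | no _ = refl
    ... | yes Uu | _ with ∨-e {lookup X u} Uu
    ...   | inj₁ Xu = R-top u (topʳ u Xu k) i
    ...   | inj₂ h with ∨-e {lookup (topBag L) u} h
    ...     | inj₁ t = R-top u (topʳ u (both u (top⇒inT L t) k) k) i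
    ...     | inj₂ t = R-top u t i

  module _ (f : Marking n) where
    open Marks f

    cost-below : ∀ {T κ m} → Connected T → (t : Trace T κ m) → Agree f t → m ≡ countF (below (f #0) T)
    cost-below _ leaf _ = sym (trans (countF-cong eq) (countF-false {n}))
      where
      eq : ∀ u → below (f #0) leaf u ≡ false
      eq u with f #0 u
      ... | true = refl
      ... | false = refl
    cost-below (I , CL , CR) (node {X} {L} {R} c _ _ l r) (p , aL , aR)
      rewrite cost-below CL l aL | cost-below CR r aR = count-node (f #0) I _ eq
      where
      open Bags X (topBag L) (topBag R) c using (U; forgotten)
      eq : ∀ u → forgotten u ≡ (top L u ∨ top R u) ∧ (not (lookup X u) ∧ f #0 u)
      eq u with !? (U u)
      ... | yes Uu = cong (λ b → (top L u ∨ top R u) ∧ (not (lookup X u) ∧ b)) (p u Uu #0)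
      ... | no ¬U = trans (cong (_∧ _) nt) (sym (cong (_∧ _) nt))
        where
        nt : top L u ∨ top R u ≡ false
        nt = ¬!⇒false λ e → ¬U (∨-i₂ {lookup X u} e)

    module AtNode {X L R} (c : Label n) (ch : ! Bags.check X (topBag L) (topBag R) c)
                  (p : ∀ u → ! Bags.U X (topBag L) (topBag R) c u → ∀ i → mark c i u ≡ f i u) where
      open Bags X (topBag L) (topBag R) c using (U; local; check; carrier)
      private
        module B = Bags X (topBag L) (topBag R) c

      loc : ∀ {u} → ! U u → ! local u
      loc {u} Uu = ⇒-e (allF-e ch u) Uu

      forced : ∀ {u} → ! U u → ! iso u ∨ mixed u → (! f #0 u) × (! f #1 u)
      forced {u} Uu h with ⇒-e (∧-e₁ (loc Uu)) h
      ... | q = trans (sym (p u Uu #0)) (∧-e₁ q) , trans (sym (p u Uu #1)) (∧-e₂ {mark c #0 u} q)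

      edge : ∀ {u v} → ! U u → ! U v → ! a u → ! adj u v → (! f #1 u → ! f #0 v) × (! f #2 u → ! f #1 v)
      edge {u} {v} Uu Uv au e with ⇒-e (allF-e (⇒-e (∧-e₁ (∧-e₂ {iso u ∨ mixed u ⇒ mark c #0 u ∧ mark c #1 u}
            (loc Uu))) au) v) (∧-i Uv e)
      ... | q = (λ h → trans (sym (p v Uv #0)) (⇒-e (∧-e₁ q) (trans (p u Uu #1) h))) ,
                (λ h → trans (sym (p v Uv #1)) (⇒-e (∧-e₂ {mark c #1 u ⇒ mark c #0 v} q) (trans (p u Uu #2) h)))

      module _ k {u} (Uu : ! U u) (h : ! host k u) where
        private
          h′ : ! B.host k u
          h′ = trans (host-cong {mark c} {f} (p u Uu) k) h
          lᵤ rᵤ : Bool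
          lᵤ = inL c (idx k) u
          rᵤ = inR c (idx k) u
          cl = lᵤ ⇒ carrier (topBag L) k u
          cr = rᵤ ⇒ carrier (topBag R) k u ∨ anyF λ v → U v ∧ B.sup k u v
          co = B.oblig k u ⇒ carrier X k u ∨ (lᵤ ∨ rᵤ)
          ca = allF λ v → allK λ k′ → B.agree k k′ u v
          D : ! cl ∧ (cr ∧ (co ∧ ca))
          D = ⇒-e {B.host k u} (allK-e {λ k → B.demand k u} (∧-e₂ {B.edges u} (∧-e₂ {iso u ∨ mixed u ⇒ mark c
                #0 u ∧ mark c #1 u} (loc Uu))) k) h′

        Carrier : BT n → Set
        Carrier T = ∃[ k′ ] ∃[ v ] ((! top T v) × (! rel k u k′ v))

        uncarrier : ∀ M → ! carrier M k u → ∃[ k′ ] ∃[ v ] ((! lookup M v) × (! rel k u k′ v))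
        uncarrier M q with anyF-e {p = λ v → lookup M v ∧ anyK λ k′ → rel k u k′ v} q
        ... | v , s with anyK-e {λ k′ → rel k u k′ v} (∧-e₂ {lookup M v} s)
        ...   | k′ , t = k′ , v , ∧-e₁ s , t

        left-carrier : ! lᵤ → Carrier L
        left-carrier q = uncarrier (topBag L) (⇒-e {lᵤ} (∧-e₁ {cl} D) q)

        right-carrier : ! rᵤ → Carrier R ⊎ Sat k u
        right-carrier q with ∨-e {carrier (topBag R) k u} (⇒-e {rᵤ} (∧-e₁ {cr} (∧-e₂ {cl} D)) q)
        ... | inj₁ s = inj₁ (uncarrier (topBag R) s)
        ... | inj₂ s with anyF-e {p = λ v → U v ∧ B.sup k u v} s
        ...   | v , t = inj₂ (v , trans (sym (sup-cong {mark c} {f} (p v (∧-e₁ {U v} t)) k u)) (∧-e₂ {U v} t))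

        met : ! oblig k u → (∃[ k′ ] ∃[ v ] ((! lookup X v) × (! rel k u k′ v))) ⊎ (! lᵤ ∨ rᵤ)
        met q with ∨-e {carrier X k u} (⇒-e {B.oblig k u} (∧-e₁ {co} (∧-e₂ {cr} (∧-e₂ {cl} D))) (trans
              (oblig-cong {mark c} {f} (p u Uu) k) q))
        ... | inj₁ s = inj₁ (uncarrier X s)
        ... | inj₂ s = inj₂ s

        agrees : ∀ k′ {v} → ! U v → ! host k′ v → ! rel k u k′ v →
                 (lᵤ ≡ inL c (idx k′) v) × (rᵤ ≡ inR c (idx k′) v)
        agrees k′ {v} Uv hv s with ⇒-e {U v ∧ (B.host k′ v ∧ rel k u k′ v)} (allK-e {λ k′ → B.agree k k′ u v}
              (allF-e (∧-e₂ {co} (∧-e₂ {cr} (∧-e₂ {cl} D))) v) k′) (∧-i Uv (∧-i (trans (host-cong {mark c} {f}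
              (p v Uv) k′) hv) s))
        ... | q = ==-e (∧-e₁ q) , ==-e (∧-e₂ {lᵤ == inL c (idx k′) v} q)

    edge-all : ∀ {T κ m} (t : Trace T κ m) → Agree f t → ∀ {u v} → Covered u v T → ! a u → ! adj u v →
               (! f #1 u → ! f #0 v) × (! f #2 u → ! f #1 v)
    edge-all (node {X} {L} {R} c _ ch l r) (p , aL , aR) (here Xu Xv) = AtNode.edge {X} {L} {R} c ch p (∨-i₁
          Xu) (∨-i₁ Xv)
    edge-all (node c _ ch l r) (p , aL , aR) (left q)  = edge-all l aL q
    edge-all (node c _ ch l r) (p , aL , aR) (right q) = edge-all r aR q

    forced-all : ∀ {T κ m} (t : Trace T κ m) → Agree f t → ∀ {u} → ! inT T u → ! iso u ∨ mixed u →
                 (! f #0 u) × (! f #1 u)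
    forced-all (node {X} {L} {R} c _ ch l r) (p , aL , aR) {u} h q with ∨-e {lookup X u} h
    ... | inj₁ Xu = AtNode.forced {X} {L} {R} c ch p (∨-i₁ Xu) q
    ... | inj₂ h′ with ∨-e {inT L u} h′
    ...   | inj₁ k = forced-all l aL k q
    ...   | inj₂ k = forced-all r aR k q

    -- A carrier that makes no demand itself must witness that the demand is
    -- met. For walks this needs the demands n1 to be met, so the statements
    -- below are applied first to the kinds near i and then to the kinds walk j.
    module Demands (C : Kind → Set)
                   (relief : ∀ k {u} k′ {v} → C k → ! host k u → ! rel k u k′ v → ¬ (! host k′ v) → Sat k u)
                   (C-rel : ∀ k {u} k′ {v} → ! rel k u k′ v → C k → C k′) where
      mutual
        -- A set bit either has a witness in the current bags or continues at a carrier one level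
        -- down, where `agrees` provides the same bit if the carrier is a host and `relief` provides
        -- a witness if it is not.
        met-below : ∀ {T κ m} (t : Trace T κ m) → Agree f t → ∀ {k u} → C k → ! top T u → ! host k u →
                    ! keyMet κ (idx k) u → Sat k u
        met-below leaf _ {u = u} Ck h = ⊥-elim (¬top-leaf {u = u} h)
        met-below t@(node {X} {L} {R} c _ ch l r) ag {k} {u} Ck Xu h q =
          met-here {X} {L} {R} c ch l r ag {k} Ck (∨-i₁ Xu) h
            (∧-e₂ {lookup X u} (trans (sym (keyMet-key X (mark c) (λ i u → inL c i u ∨ inR c i u) (idx k) u)) q))

        met-here : ∀ {X L R m₁ m₂} (c : Label n) → let open Bags X (topBag L) (topBag R) c using (U; check; keyL; keyR) in
                   (ch : ! check) (l : Trace L keyL m₁) (r : Trace R keyR m₂) →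
                   (∀ u → ! U u → ∀ i → mark c i u ≡ f i u) × Agree f l × Agree f r →
                   ∀ {k u} → C k → ! U u → ! Marks.host f k u → ! inL c (idx k) u ∨ inR c (idx k) u → Sat k u
        met-here {X} {L} {R} c ch l r (p , aL , aR) {k} {u} Ck Uu h q = go (∨-e {inL c (idx k) u} q)
          where
          module Here = AtNode {X} {L} {R} c ch p
          carried : ∀ {T : BT n} {κ m} (t : Trace T κ m) → Agree f t → ∀ k′ v → ! top T v → ! rel k u k′ v →
                    (! host k′ v → ! keyMet κ (idx k′) v) → Dec (! host k′ v) → Sat k u
          carried t ag k′ v tv s met (no ¬h) = relief k k′ Ck h s ¬h
          carried t ag k′ v tv s met (yes hv) = Sat-rel f {k} {u} {k′} {v} s (met-below t ag {k′} (C-rel k k′ s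
                Ck) tv hv (met hv))
          fromL : ! inL c (idx k) u → ∃[ k′ ] ∃[ v ] ((! top L v) × (! rel k u k′ v)) → Sat k u
          fromL lu (k′ , v , tv , s) = carried l aL k′ v tv s
            (λ hv → trans (keyMet-key (topBag L) (mark c) (inL c) (idx k′) v)
              (∧-i tv (trans (sym (proj₁ (Here.agrees k Uu h k′ (∨-i₂ {lookup X v} (∨-i₁ tv)) hv s))) lu))) (!?
                    (host k′ v))
          fromR : ! inR c (idx k) u → ∃[ k′ ] ∃[ v ] ((! top R v) × (! rel k u k′ v)) ⊎ Sat k u → Sat k u
          fromR ru (inj₂ s) = s
          fromR ru (inj₁ (k′ , v , tv , s)) = carried r aR k′ v tv s
            (λ hv → trans (keyMet-key (topBag R) (mark c) (inR c) (idx k′) v)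
              (∧-i tv (trans (sym (proj₂ (Here.agrees k Uu h k′ (∨-i₂ {lookup X v} (∨-i₂ {lookup (topBag L) v}
                    tv)) hv s))) ru))) (!? (host k′ v))
          go : (! inL c (idx k) u) ⊎ (! inR c (idx k) u) → Sat k u
          go (inj₁ lu) = fromL lu (Here.left-carrier k Uu h lu)
          go (inj₂ ru) = fromR ru (Here.right-carrier k Uu h ru)

      -- No node can drop an obligation: it is claimed as met, and then `met-here` applies, or it
      -- moves up to a related demand in the bag. An empty top bag leaves only the first
      -- possibility.
      met-or-carried : ∀ {T κ m} (t : Trace T κ m) → Agree f t → ∀ {k u} → C k → ! inT T u → ! host k u → !
            oblig k u →
                       Sat k u ⊎ ∃[ k′ ] ∃[ v ] ((! top T v) × (! rel k u k′ v))
      met-or-carried (node {X} {L} {R} c _ ch l r) ag@(p , aL , aR) {k} {u} Ck iu h ob with ∨-e {lookup X u} iu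
      ... | inj₁ Xu = inj₂ (k , u , Xu , rel-refl f {k} h)
      ... | inj₂ iu′ = go (∨-e {inT L u} iu′)
        where
        lift : ∀ {k′ v} → ! Bags.U X (topBag L) (topBag R) c v → ! rel k u k′ v →
               Sat k u ⊎ ∃[ k″ ] ∃[ w ] ((! lookup X w) × (! rel k u k″ w))
        lift {k′} {v} Uv s with !? (host k′ v)
        ... | no ¬h = inj₁ (relief k k′ Ck h s ¬h)
        ... | yes hv with AtNode.met {X} {L} {R} c ch p k′ Uv hv (trans (sym (oblig-rel f {k} {u} {k′} {v} s)) ob)
        ...   | inj₁ (k″ , w , Xw , s′) = inj₂ (k″ , w , Xw , rel-trans {k} {u} {k′} {v} {k″} {w} s s′)
        ...   | inj₂ q = inj₁ (Sat-rel f {k} {u} {k′} {v} s (met-here {X} {L} {R} c ch l r ag {k′} (C-rel k k′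
              s Ck) Uv hv q))
        go : (! inT L u) ⊎ (! inT R u) → Sat k u ⊎ ∃[ k″ ] ∃[ w ] ((! lookup X w) × (! rel k u k″ w))
        go (inj₁ q) with met-or-carried l aL Ck q h ob
        ... | inj₁ s = inj₁ s
        ... | inj₂ (k′ , v , tv , s) = lift (∨-i₂ {lookup X v} (∨-i₁ tv)) s
        go (inj₂ q) with met-or-carried r aR Ck q h ob
        ... | inj₁ s = inj₁ s
        ... | inj₂ (k′ , v , tv , s) = lift (∨-i₂ {lookup X v} (∨-i₂ {lookup (topBag L) v} tv)) s

-- Completeness of the dynamic program

noBits : Vec Bool 9
noBits = replicate 9 false

-- Each slot has three states: left, right, neither. There are 8 labels for vertices that are not
-- OR, where only the marks vary; 4 * 2 * 3 = 24 for OR vertices that are not isolated from other OR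
-- and zero vertices (mark 0 with slot 0, mark 1, slot 1); and 3 ^ 3 = 27 for the others, whose
-- marks are fixed.
valid : Bool → Bool → Vec Bool 9 → Bool
valid isO isIso (x ∷ r ∷ q ∷ l0 ∷ l1 ∷ l2 ∷ r0 ∷ r1 ∷ r2 ∷ []) =
  (not (l0 ∧ r0) ∧ (not (l1 ∧ r1) ∧ not (l2 ∧ r2))) ∧
  ((not isO ⇒ not (l0 ∨ r0) ∧ (not (l1 ∨ r1) ∧ not (l2 ∨ r2))) ∧
  ((isO ∧ not isIso ⇒ not q ∧ (not (l2 ∨ r2) ∧ (x ⇒ not (l0 ∨ r0)))) ∧
   (isIso ⇒ x ∧ (r ∧ not q))))

data NiceBT {n} : BT n → Set where
  leaf  : NiceBT leaf
  unary : ∀ {X L} → NiceBT L → NiceBT (node X L leaf)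
  join  : ∀ {X L R} → X ≡ topBag L → X ≡ topBag R → NiceBT L → NiceBT R → NiceBT (node X L R)

-- In graph terms, the top bag separates the vertices below it from the vertices outside the tree.
Closed : ∀ {n} → (Fin n → Fin n → Bool) → BT n → Set
Closed adj T = ∀ {u v} → ! adj u v → ! inT T u → ¬ (! top T u) → Covered u v T

Covered⇒inT : ∀ {n} {u v : Fin n} {T} → Covered u v T → (! inT T u) × (! inT T v)
Covered⇒inT (here p q) = ∨-i₁ p , ∨-i₁ q
Covered⇒inT {u = u} {v} (left {X} c)  = ∨-i₂ {lookup X u} (∨-i₁ (proj₁ (Covered⇒inT c))) , ∨-i₂ {lookup X v}
      (∨-i₁ (proj₂ (Covered⇒inT c)))
Covered⇒inT {u = u} {v} (right {X} {L} c) =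
  ∨-i₂ {lookup X u} (∨-i₂ {inT L u} (proj₁ (Covered⇒inT c))) , ∨-i₂ {lookup X v} (∨-i₂ {inT L v} (proj₂
        (Covered⇒inT c)))

module _ {n} {adj : Fin n → Fin n → Bool} {X : Subset n} {L R : BT n} (I : Interface X L R) (Cl : Closed adj (node X L R)) where
  open Interface I

  -- If the edge were covered elsewhere, connectedness would put `u` into the top bag of `L`.
  closedˡ : Closed adj L
  closedˡ {u} e iu ¬t with Cl e (∨-i₂ {lookup X u} (∨-i₁ iu)) (λ Xu → ¬t (topˡ u Xu iu))
  ... | here Xu _ = ⊥-elim (¬t (topˡ u Xu iu))
  ... | left c    = c
  ... | right c   = ⊥-elim (¬t (topˡ u (both u iu (proj₁ (Covered⇒inT c))) iu))

  closedʳ : Closed adj R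
  closedʳ {u} e iu ¬t with Cl e (∨-i₂ {lookup X u} (∨-i₂ {inT L u} iu)) (λ Xu → ¬t (topʳ u Xu iu))
  ... | here Xu _ = ⊥-elim (¬t (topʳ u Xu iu))
  ... | left c    = ⊥-elim (¬t (topʳ u (both u (proj₁ (Covered⇒inT c)) iu) iu))
  ... | right c   = c

module Correctness {n} (P : Process n)
                   (options : Subset n → Subset n → Subset n → Fin n → List (Vec Bool 9)) where
  open Process P
  open Walks adj o
  open Characterization P
  open System signature
  open Relation signature
  open Traces options

  exempt-e : ∀ {j u} → ! exempt j u → Exempt j u
  exempt-e {j} {u} h with anyF-e h
  ... | y , p = y , reach-e (∧-e₁ p) , go (∨-e {z y} (∧-e₂ {reach j u y} p))
    where
    go : _ → (! z y) ⊎ ((! o y) × ∃[ w ] ((! adj y w) × (! z w)))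
    go (inj₁ q) = inj₁ q
    go (inj₂ q) with anyF-e (∧-e₂ {o y} q)
    ... | w , r = inj₂ (∧-e₁ q , w , ∧-e₁ r , ∧-e₂ {adj y w} r)

  exempt-i : ∀ {j u} → Exempt j u → ! exempt j u
  exempt-i (y , r , inj₁ q) = anyF-i y (∧-i (reach-i r) (∨-i₁ q))
  exempt-i (y , r , inj₂ (oy , w , e , zw)) =
    anyF-i y (∧-i (reach-i r) (∨-i₂ {z y} (∧-i oy (anyF-i w (∧-i e zw)))))

  iso-e : ∀ {u} → ! iso u → Iso u
  iso-e {u} h = ∧-e₁ h , λ v e → ⇒-e (allF-e (∧-e₂ {o u} h) v) e

  iso-i : ∀ {u} → Iso u → ! iso u
  iso-i (ou , h) = ∧-i ou (allF-i λ v → ⇒-i (h v))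

  mixed-e : ∀ {u} → ! mixed u → (! a u) × ∃[ v ] ((! adj u v) × (! a v))
  mixed-e {u} h with anyF-e (∧-e₂ {a u} h)
  ... | v , p = ∧-e₁ h , v , ∧-e₁ p , ∧-e₂ {adj u v} p

  module _ (f : Marking n) (f₀ : ∀ u → f #0 u ≡ act 0 u) where
    open Soundness signature options
    open Marks f

    Near Walk : Kind → Set
    Near (near _) = ⊤
    Near (walk _) = ⊥
    Walk (near _) = ⊥
    Walk (walk _) = ⊤

    trace⇒good : ∀ {T κ m} (t : Trace T κ m) → (∀ u → ¬ (! top T u)) → (∀ u → ! inT T u) →
                 (∀ {u v} → ! adj u v → Covered u v T) → Agree f t → Good
    trace⇒good {T} t bare full cov ag = record
      { and-and = λ {u} {v} au av e →
          let q = forced-all f t ag (full u) (∨-i₂ {iso u} (∧-i au (anyF-i v (∧-i e av)))) in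
          trans (sym (f₀ u)) (proj₁ q) , λ w e′ → trans (sym (f₀ w)) (mark1-a au (proj₂ q) w e′)
      ; iso₀ = iso₀ ; iso₁ = iso₁ ; hit = hit }
      where
      near-relief : ∀ k {u} k′ {v} → Near k → ! host k u → ! rel k u k′ v → ¬ (! host k′ v) → Sat k u
      near-relief (near i) {u} (near j) {v} _ h s ¬h with view (near i) u (near j) v s
      ... | near = ⊥-elim (¬h h)

      near-rel : ∀ k {u} k′ {v} → ! rel k u k′ v → Near k → Near k′
      near-rel (near i) (near j) _ _ = tt

      module DN = Demands f Near near-relief near-rel

      sat-near : ∀ i {u} → ! host (near i) u → Sat (near i) u
      sat-near i {u} h with DN.met-or-carried t ag {near i} tt (full u) h h
      ... | inj₁ s = s
      ... | inj₂ (_ , v , tv , _) = ⊥-elim (bare v tv)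

      mark1-a : ∀ {u} → ! a u → ! f #1 u → ∀ v → ! adj u v → ! f #0 v
      mark1-a au h v e = proj₁ (edge-all f t ag (cov e) au e) h

      mark1-o : ∀ {u} → ! o u → ! f #1 u → ∃[ v ] ((! adj u v) × (! f #0 v))
      mark1-o {u} ou h with sat-near #1 (∧-i ou h)
      ... | v , p = v , ∧-e₁ p , ∧-e₂ {adj u v} p

      -- Claims are one-sided: a mark must be true where it is set, but an active vertex may lack
      -- it. Only mark 0 is exact, since it defines X.
      mark1 : ∀ u → ! f #1 u → ! act 1 u
      mark1 u h with cls u
      ... | inj₁ zu = act-z zu
      ... | inj₂ (inj₂ au) = act-a au λ v e → trans (sym (f₀ v)) (mark1-a au h v e)
      ... | inj₂ (inj₁ ou) with mark1-o ou h
      ...   | v , e , k = act-o ou e (trans (sym (f₀ v)) k)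

      -- Mark 0 supplies the empty walk. Mark 1 supplies a walk of length 1, because the demand `n1`
      -- behind it is known to be met.
      sat-relieved : ∀ j {u} → ! o u → ! f (parityMark j) u → Sat (walk j) u
      sat-relieved false {u} ou h = u , ∧-i (reach-i here) h
      sat-relieved true  {u} ou h with mark1-o ou h
      ... | v , e , k = v , ∧-i (reach-i (step ou e here)) k

      walk-relief : ∀ k {u} k′ {v} → Walk k → ! host k u → ! rel k u k′ v → ¬ (! host k′ v) → Sat k u
      walk-relief (walk i) {u} (walk j) {v} _ h s ¬h with !? (f (parityMark j) v)
      ... | yes p = Sat-rel f {walk i} {u} {walk j} {v} s (sat-relieved j (same-o₂ {i} {j} {u} {v} s) p)
      ... | no ¬p = ⊥-elim (¬h (∧-i (same-o₂ {i} {j} {u} {v} s) (not-i ¬p)))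

      walk-rel : ∀ k {u} k′ {v} → ! rel k u k′ v → Walk k → Walk k′
      walk-rel (walk i) (walk j) _ _ = tt

      module DW = Demands f Walk walk-relief walk-rel

      sat-walk : ∀ j {u} → ! o u → ¬ Exempt j u → Sat (walk j) u
      sat-walk j {u} ou ¬ex with !? (f (parityMark j) u)
      ... | yes p = sat-relieved j ou p
      ... | no ¬p with DW.met-or-carried t ag {walk j} tt (full u) (∧-i ou (not-i ¬p)) (∧-i ou (not-i (¬ex ∘
            exempt-e)))
      ...   | inj₁ s = s
      ...   | inj₂ (_ , v , tv , _) = ⊥-elim (bare v tv)

      iso₀ : ∀ {u} → Iso u → ∃[ v ] ((! adj u v) × (∀ w → ! adj v w → ! act 0 w))
      iso₀ {u} i with sat-near #2 (iso-i i)
      ... | v , p = v , ∧-e₁ p , λ w e → trans (sym (f₀ w)) (mark1-a (proj₂ i v (∧-e₁ p)) (∧-e₂ {adj u v} p) w e)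

      iso₁ : ∀ {u} → Iso u → ∃[ v ] ((! adj u v) × (∀ w → ! adj v w → ! act 1 w))
      iso₁ {u} i with sat-near #0 (iso-i i)
      ... | v , p = v , ∧-e₁ p , λ w e → mark1 w (proj₂ (edge-all f t ag (cov e) (proj₂ i v (∧-e₁ p)) e) (∧-e₂
            {adj u v} p))

      hit : ∀ {u} j → ! o u → ¬ Exempt j u → ∃[ v ] (Reach j u v × (! act 0 v))
      hit {u} j ou ¬ex with sat-walk j ou ¬ex
      ... | v , p = v , reach-e (∧-e₁ p) , trans (sym (f₀ v)) (∧-e₂ {reach j u v} p)

  -- A path to a witness along which related demands are handed on, so that near and walk demands
  -- share the separation arguments. The final vertex of `end` need not have a related demand.
  data Chain : Kind → Fin n → Fin n → Set where
    stop : ∀ {k u} → Chain k u u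
    end  : ∀ {k u v} → ! adj u v → Chain k u v
    link : ∀ {k u k′ y v} → ! adj u y → ! rel k u k′ y → Chain k′ y v → Chain k u v

  -- The edge can be prepended in either direction, each time flipping the parity.
  reach-adj : ∀ {j u y} → ! o u → ! o y → ! adj u y → ∀ w → reach (not j) u w ≡ reach j y w
  reach-adj {j} {u} {y} ou oy e w = ≡-i
    (λ h → reach-i (subst (λ b → Reach b y w) (not-involutive j) (step oy (adj-sym e) (reach-e h))))
    (λ h → reach-i (step ou e (reach-e h)))

  reach-chain : ∀ {j u v} → Reach j u v → Chain (walk j) u v
  reach-chain here = stop
  reach-chain (step ou e here) = end e
  reach-chain (step {j} {u} {y} ou e r@(step oy _ _)) =
    link {k′ = walk j} e (same-i ou oy (reach-adj ou oy e)) (reach-chain r)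

  carried : Subset n → Kind → Fin n → Bool
  carried M k u = anyF λ v → lookup M v ∧ anyK λ k′ → rel k u k′ v

  carried-e : ∀ M {k u} → ! carried M k u → ∃[ k′ ] ∃[ v ] ((! lookup M v) × (! rel k u k′ v))
  carried-e M {k} {u} h with anyF-e {p = λ v → lookup M v ∧ anyK λ k′ → rel k u k′ v} h
  ... | v , p with anyK-e {λ k′ → rel k u k′ v} (∧-e₂ {lookup M v} p)
  ...   | k′ , q = k′ , v , ∧-e₁ p , q

  carried-i : ∀ M k {u} k′ v → ! lookup M v → ! rel k u k′ v → ! carried M k u
  carried-i M k {u} k′ v h p = anyF-i v (∧-i h (anyK-i {λ k′ → rel k u k′ v} k′ p))

  carried-rel : ∀ M {k u k′ v} → ! rel k u k′ v → carried M k u ≡ carried M k′ v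
  carried-rel M {k} {u} {k′} {v} h = ≡-i (go k u k′ v (rel-sym {k} {u} {k′} {v} h)) (go k′ v k u h)
    where
    go : ∀ k u k′ v → ! rel k′ v k u → ! carried M k u → ! carried M k′ v
    go k u k′ v h p with carried-e M {k} {u} p
    ... | k″ , w , q , r = carried-i M k′ k″ w q (rel-trans {k′} {v} {k} {u} {k″} {w} h r)

  -- A chain that enters the part below a bag does so through the bag.
  enter : ∀ {T} → Closed adj T → ∀ {k u v} → Chain k u v → ¬ (! inT T u) → ! inT T v →
          (! top T v) ⊎ (! carried (topBag T) k u)
  enter Cl stop ¬iu iv = ⊥-elim (¬iu iv)
  enter {T} Cl {v = v} (end e) ¬iu iv with !? (top T v)
  ... | yes tv = inj₁ tv
  ... | no ¬tv = ⊥-elim (¬iu (proj₂ (Covered⇒inT (Cl (adj-sym e) iv ¬tv))))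
  enter {T} Cl (link {k} {u} {k′} {y} e s ch) ¬iu iv with !? (inT T y)
  ... | no ¬iy with enter Cl ch ¬iy iv
  ...   | inj₁ tv = inj₁ tv
  ...   | inj₂ q = inj₂ (trans (carried-rel (topBag T) {k} {u} {k′} {y} s) q)
  enter {T} Cl (link {k} {u} {k′} {y} e s ch) ¬iu iv | yes iy with !? (top T y)
  ... | yes ty = inj₂ (carried-i (topBag T) k k′ y ty s)
  ... | no ¬ty = ⊥-elim (¬iu (proj₂ (Covered⇒inT (Cl (adj-sym e) iy ¬ty))))

  -- To leave the tree, a chain would have to pass a vertex of the top bag, and that vertex would
  -- carry the demand.
  stay : ∀ {T} → Closed adj T → ∀ {k u v} → Chain k u v → ! rel k u k u → ! inT T u →
         ¬ (! carried (topBag T) k u) → ! inT T v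
  stay Cl stop rr iu ¬c = iu
  stay {T} Cl {k} {u} (end e) rr iu ¬c =
    proj₂ (Covered⇒inT (Cl e iu λ tu → ¬c (carried-i (topBag T) k k u tu rr)))
  stay {T} Cl (link {k} {u} {k′} {y} e s ch) rr iu ¬c =
    stay Cl ch (rel-trans {k′} {y} {k} {u} {k′} {y} (rel-sym {k} {u} {k′} {y} s) s)
      (proj₂ (Covered⇒inT (Cl e iu λ tu → ¬c (carried-i (topBag T) k k u tu rr))))
      (λ c → ¬c (trans (carried-rel (topBag T) {k} {u} {k′} {y} s) c))

  module Completeness (g : Good)
    (opt-out : ∀ {X B₁ B₂ u} → (lookup X u ∨ (lookup B₁ u ∨ lookup B₂ u)) ≡ false → noBits ∈ options X B₁ B₂ u)
    (opt-in : ∀ {X B₁ B₂ u bs} → ! lookup X u ∨ (lookup B₁ u ∨ lookup B₂ u) → ! valid (o u) (iso u) bs → bs ∈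
          options X B₁ B₂ u)
    where
    open Good g

    -- The true activities. Mark 2 is confined to AND vertices, where the neighbours of `Iso`
    -- vertices are found; `valid` leaves no room for it at OR vertices.
    f : Marking n
    f #0 u = act 0 u
    f #1 u = act 1 u
    f #2 u = a u ∧ act 2 u

    open Marks f

    iso-01 : ∀ {u} → ! iso u → (! f #0 u) × (! f #1 u)
    iso-01 i with iso₀ (iso-e i) | iso₁ (iso-e i)
    ... | v , e , h | w , e′ , h′ = h _ (adj-sym e) , h′ _ (adj-sym e′)

    mixed-01 : ∀ {u} → ! mixed u → (! f #0 u) × (! f #1 u)
    mixed-01 h with mixed-e h
    ... | au , v , e , av = proj₁ (and-and au av e) , act-a au (proj₂ (and-and au av e))

    sat : ∀ k {u} → ! oblig k u → Sat k u
    sat n0 {u} h with iso₁ (iso-e h)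
    ... | v , e , q = v , ∧-i e (∧-i av (act-a av q))
      where av = proj₂ (iso-e h) v e
    sat n1 {u} h with act-o⁻¹ (∧-e₁ h) (∧-e₂ {o u} h)
    ... | v , e , q = v , ∧-i e q
    sat n2 {u} h with iso₀ (iso-e h)
    ... | v , e , q = v , ∧-i e (act-a (proj₂ (iso-e h) v e) q)
    sat (walk j) {u} h with hit j (∧-e₁ h) (λ ex → not-e (∧-e₂ {o u} h) (exempt-i ex))
    ... | v , r , q = v , ∧-i (reach-i r) q

    sup-chain : ∀ k {u v} → ! sup k u v → Chain k u v
    sup-chain (near i) h = end (∧-e₁ h)
    sup-chain (walk j) h = reach-chain (reach-e (∧-e₁ h))

    oblig-refl : ∀ k {u} → ! oblig k u → ! rel k u k u
    oblig-refl (near i) {u} h = unview (near {i} {u})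
    oblig-refl (walk j) h = same-i (∧-e₁ h) (∧-e₁ h) λ _ → refl

    host⇒o : ∀ k {u} → ! host k u → ! o u
    host⇒o n0 h = ∧-e₁ h
    host⇒o n1 h = ∧-e₁ h
    host⇒o n2 h = ∧-e₁ h
    host⇒o (walk j) h = ∧-e₁ h

    -- `n0` excludes `d0` because `Iso` vertices belong to X, and `n1` and `d1` disagree about mark
    -- 1.
    host-unique : ∀ k k′ {u} → ! host k u → ! host k′ u → idx k ≡ idx k′ → k ≡ k′
    host-unique (near i) (near _) h h′ refl = refl
    host-unique d0 d0 h h′ e = refl
    host-unique d1 d1 h h′ e = refl
    host-unique n0 d0 {u} h h′ e = ⊥-elim (not-e (∧-e₂ {o u} h′) (proj₁ (iso-01 h)))
    host-unique d0 n0 {u} h h′ e = ⊥-elim (not-e (∧-e₂ {o u} h) (proj₁ (iso-01 h′)))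
    host-unique n1 d1 {u} h h′ e = ⊥-elim (not-e (∧-e₂ {o u} h′) (∧-e₂ {o u} h))
    host-unique d1 n1 {u} h h′ e = ⊥-elim (not-e (∧-e₂ {o u} h) (∧-e₂ {o u} h′))

    slot : (Kind → Fin n → Bool) → Fin 3 → Fin n → Bool
    slot d i u = anyK λ k → eqF (idx k) i ∧ (host k u ∧ d k u)

    slot-e : ∀ d i {u} → ! slot d i u → ∃[ k ] (idx k ≡ i × (! host k u) × (! d k u))
    slot-e d i {u} h with anyK-e {λ k → eqF (idx k) i ∧ (host k u ∧ d k u)} h
    ... | k , p = k , eqF⇒≡ (idx k) i (∧-e₁ p) , ∧-e₁ q , ∧-e₂ {host k u} q
      where q = ∧-e₂ {eqF (idx k) i} p

    slot-i : ∀ d k {u} → ! host k u → ! d k u → ! slot d (idx k) u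
    slot-i d k {u} h p = anyK-i {λ k′ → eqF (idx k′) (idx k) ∧ (host k′ u ∧ d k′ u)} k (∧-i (eqF-refl (idx k))
          (∧-i h p))

    slot-host : ∀ d k {u} → ! host k u → slot d (idx k) u ≡ d k u
    slot-host d k {u} h = ≡-i onto (slot-i d k h)
      where
      onto : ! slot d (idx k) u → ! d k u
      onto p with slot-e d (idx k) p
      ... | k′ , e , h′ , q = subst (λ k → ! d k u) (host-unique k′ k h′ h e) q

    stateKey : (Kind → Fin n → Bool) → BT n → Key n
    stateKey want T = key (topBag T) f (slot want)

    Invariant : (Kind → Fin n → Bool) → Set
    Invariant d = ∀ k u k′ v → ! rel k u k′ v → d k u ≡ d k′ v

    exact : BT n → Kind → Fin n → Bool
    exact T k u = anyF λ v → inT T v ∧ sup k u v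

    Wanted : BT n → (Kind → Fin n → Bool) → Set
    Wanted T d = ∀ k u → ! top T u → ! d k u → ! exact T k u

    exact-inv : ∀ T → Invariant (exact T)
    exact-inv T k u k′ v h = anyF-cong λ w → cong (inT T w ∧_) (sup-rel f {k} {u} {k′} {v} h w)

    -- R is empty unless the node is a join; want tells which demands the trace
    -- to be constructed has to meet.
    record Situation : Set where
      field
        X       : Subset n
        L R     : BT n
        I       : Interface X L R
        Cl      : Closed adj (node X L R)
        joined  : Bool
        unary-R : ¬ (! joined) → ∀ {u} → ¬ (! inT R u)
        join-X  : ! joined → (X ≡ topBag L) × (X ≡ topBag R)
        want    : Kind → Fin n → Bool
        winv    : Invariant want
        wok     : Wanted (node X L R) want

    module AtBag (situation : Situation) where
      open Situation situation
      open Interface I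

      U : Fin n → Bool
      U u = lookup X u ∨ (lookup (topBag L) u ∨ lookup (topBag R) u)

      U⇒inT : ∀ {u} → ! U u → ! inT (node X L R) u
      U⇒inT {u} h with ∨-e {lookup X u} h
      ... | inj₁ k = ∨-i₁ k
      ... | inj₂ k with ∨-e {lookup (topBag L) u} k
      ...   | inj₁ t = ∨-i₂ {lookup X u} (∨-i₁ (top⇒inT L t))
      ...   | inj₂ t = ∨-i₂ {lookup X u} (∨-i₂ {inT L u} (top⇒inT R t))

      -- If `X` carries the demand, the node above decides through `want`; otherwise this is the
      -- last chance to meet an obligation. `e₁` picks one place: at a join it is left exactly if
      -- `L` has a witness, elsewhere exactly if the visible bags have none.
      bagsup need e₁ dl dr : Kind → Fin n → Bool
      bagsup k u = anyF λ v → U v ∧ sup k u v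
      need k u = if carried X k u then want k u else oblig k u
      e₁ k u = if joined then exact L k u else not (bagsup k u)
      dl k u = need k u ∧ e₁ k u
      dr k u = need k u ∧ not (e₁ k u)

      e₁-join : ! joined → ∀ k u → e₁ k u ≡ exact L k u
      e₁-join j k u = cong (λ b → if b then exact L k u else not (bagsup k u)) j

      e₁-unary : ¬ (! joined) → ∀ k u → e₁ k u ≡ not (bagsup k u)
      e₁-unary ¬j k u = cong (λ b → if b then exact L k u else not (bagsup k u)) (¬!⇒false ¬j)

      X⇒topˡ : ! joined → ∀ {u} → ! lookup X u → ! top L u
      X⇒topˡ j {u} = subst (λ Y → ! lookup Y u) (proj₁ (join-X j))

      X⇒topʳ : ! joined → ∀ {u} → ! lookup X u → ! top R u
      X⇒topʳ j {u} = subst (λ Y → ! lookup Y u) (proj₂ (join-X j))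

      join-U : ! joined → ∀ {u} → ! U u → ! lookup X u
      join-U j {u} h with ∨-e {lookup X u} h
      ... | inj₁ k = k
      ... | inj₂ k with ∨-e {lookup (topBag L) u} k
      ...   | inj₁ t = subst (λ Y → ! lookup Y u) (sym (proj₁ (join-X j))) t
      ...   | inj₂ t = subst (λ Y → ! lookup Y u) (sym (proj₂ (join-X j))) t

      need-inv : Invariant need
      need-inv k u k′ v h rewrite carried-rel X {k} {u} {k′} {v} h | winv k u k′ v h | oblig-rel f {k} {u} {k′}
            {v} h = refl

      e₁-inv : Invariant e₁
      e₁-inv k u k′ v h = cong₂ (λ x y → if joined then x else not y) (exact-inv L k u k′ v h)
        (anyF-cong λ w → cong (U w ∧_) (sup-rel f {k} {u} {k′} {v} h w))

      dl-inv : Invariant dl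
      dl-inv k u k′ v h = cong₂ _∧_ (need-inv k u k′ v h) (e₁-inv k u k′ v h)

      dr-inv : Invariant dr
      dr-inv k u k′ v h = cong₂ (λ x y → x ∧ not y) (need-inv k u k′ v h) (e₁-inv k u k′ v h)

      -- If `X` does not carry the demand, a witness exists by `sat` and the chain to it cannot
      -- leave by `stay`. If `X` does, the demand was requested, and only what the subtree can
      -- supply is requested.
      need-exact : ∀ k {u} → ! U u → ! need k u → ∃[ v ] ((! inT (node X L R) v) × (! sup k u v))
      need-exact k {u} Uu h with !? (carried X k u)
      ... | no ¬c rewrite ¬!⇒false ¬c with sat k h
      ...   | v , p = v , stay Cl (sup-chain k p) (oblig-refl k h) (U⇒inT Uu) ¬c , p
      need-exact k {u} Uu h | yes c rewrite c with carried-e X {k} {u} c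
      ...   | k′ , w , Xw , s with anyF-e (wok k′ w Xw (trans (sym (winv k u k′ w s)) h))
      ...     | v , p = v , ∧-e₁ p , trans (sup-rel f {k} {u} {k′} {w} s v) (∧-e₂ {inT (node X L R) v} p)

      dl-exact : ∀ k {u} → ! U u → ! dl k u → ∃[ v ] ((! inT L v) × (! sup k u v))
      dl-exact k {u} Uu h with !? joined
      ... | yes j with anyF-e (trans (sym (e₁-join j k u)) (∧-e₂ {need k u} h))
      ...   | v , p = v , ∧-e₁ p , ∧-e₂ {inT L v} p
      dl-exact k {u} Uu h | no ¬j with need-exact k Uu (∧-e₁ h)
      ... | v , iv , p with ∨-e {lookup X v} iv
      ...   | inj₁ Xv = ⊥-elim (not-e (trans (sym (e₁-unary ¬j k u)) (∧-e₂ {need k u} h)) (anyF-i v (∧-i (∨-i₁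
            Xv) p)))
      ...   | inj₂ iv′ with ∨-e {inT L v} iv′
      ...     | inj₁ q = v , q , p
      ...     | inj₂ q = ⊥-elim (unary-R ¬j q)

      -- At a join the bag is also the top bag of `L`, so a demand without a witness in `L` has its
      -- witness in `R`.
      dr-exact : ∀ k {u} → ! U u → ! top R u → ! dr k u → ∃[ v ] ((! inT R v) × (! sup k u v))
      dr-exact k {u} Uu tu h with !? joined
      ... | no ¬j = ⊥-elim (unary-R ¬j (top⇒inT R tu))
      ... | yes j with need-exact k Uu (∧-e₁ h)
      ...   | v , iv , p = v , inR? (∨-e {lookup X v} iv) , p
        where
        ¬L : ¬ (! inT L v)
        ¬L q = not-e (∧-e₂ {need k u} h) (trans (e₁-join j k u) (anyF-i v (∧-i q p)))
        inR? : (! lookup X v) ⊎ (! inT L v ∨ inT R v) → ! inT R v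
        inR? (inj₁ Xv) = ⊥-elim (¬L (top⇒inT L (X⇒topˡ j Xv)))
        inR? (inj₂ q) with ∨-e {inT L v} q
        ... | inj₁ q′ = ⊥-elim (¬L q′)
        ... | inj₂ q′ = q′

      wanted-l : Wanted L dl
      wanted-l k u tu h with dl-exact k (∨-i₂ {lookup X u} (∨-i₁ tu)) h
      ... | v , i , p = anyF-i v (∧-i i p)

      wanted-r : Wanted R dr
      wanted-r k u tu h with dr-exact k (∨-i₂ {lookup X u} (∨-i₂ {lookup (topBag L) u} tu)) tu h
      ... | v , i , p = anyF-i v (∧-i i p)

      -- Outside joins, a demand sent left has no witness in the visible bags. If `u` is not in the
      -- left bag itself, the chain to a witness below must enter through that bag, which then
      -- carries the demand.
      left-carried : ∀ k {u} → ! U u → ! rel k u k u → ! dl k u → ! carried (topBag L) k u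
      left-carried k {u} Uu rr h with !? (top L u)
      ... | yes tu = carried-i (topBag L) k k u tu rr
      ... | no ¬tu with !? joined
      ...   | yes j = ⊥-elim (¬tu (X⇒topˡ j (join-U j Uu)))
      ...   | no ¬j with dl-exact k Uu h
      ...     | v , iv , p with enter (closedˡ I Cl) (sup-chain k p) (λ iu → ¬tu (topˡ u Xu iu)) iv
        where
        Xu : ! lookup X u
        Xu with ∨-e {lookup X u} Uu
        ... | inj₁ q = q
        ... | inj₂ q with ∨-e {lookup (topBag L) u} q
        ...   | inj₁ t = ⊥-elim (¬tu t)
        ...   | inj₂ t = ⊥-elim (unary-R ¬j (top⇒inT R t))
      ...       | inj₂ c = c
      ...       | inj₁ tv = ⊥-elim (not-e (trans (sym (e₁-unary ¬j k u)) (∧-e₂ {need k u} h))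
                              (anyF-i v (∧-i (∨-i₂ {lookup X v} (∨-i₁ tv)) p)))

      right-met : ∀ k {u} → ! U u → ! rel k u k u → ! dr k u → ! carried (topBag R) k u ∨ bagsup k u
      right-met k {u} Uu rr h with !? joined
      ... | yes j = ∨-i₁ (carried-i (topBag R) k k u (X⇒topʳ j (join-U j Uu)) rr)
      ... | no ¬j = ∨-i₂ {carried (topBag R) k u} (case !? (bagsup k u) of λ
              { (yes p) → p ; (no ¬p) → ⊥-elim (not-e (∧-e₂ {need k u} h) (trans (e₁-unary ¬j k u) (not-i ¬p))) })

      need⇒ : ∀ k u → ! need k u → ! dl k u ∨ dr k u
      need⇒ k u h with !? (e₁ k u)
      ... | yes p = ∨-i₁ (∧-i h p)
      ... | no ¬p = ∨-i₂ {dl k u} (∧-i h (not-i ¬p))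

      disjoint : ∀ k {u} → ! dl k u → ¬ (! dr k u)
      disjoint k {u} h h′ = not-e (∧-e₂ {need k u} h′) (∧-e₂ {need k u} h)

      bitsOf : Fin n → Vec Bool 9
      bitsOf u =
        f #0 u ∷ f #1 u ∷ f #2 u ∷ slot dl #0 u ∷ slot dl #1 u ∷ slot dl #2 u ∷
        slot dr #0 u ∷ slot dr #1 u ∷ slot dr #2 u ∷ []

      labelRow : Fin n → Vec Bool 9
      labelRow u = if U u then bitsOf u else noBits

      label : Label n
      label = tabulate labelRow

      slot-disjoint : ∀ i u → ! not (slot dl i u ∧ slot dr i u)
      slot-disjoint i u = not-i λ h → go (slot-e dl i (∧-e₁ h)) (slot-e dr i (∧-e₂ {slot dl i u} h))
        where
        go : _ → _ → ⊥
        go (k , e , h , p) (k′ , e′ , h′ , p′) with host-unique k k′ h h′ (trans e (sym e′))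
        ... | refl = disjoint k p p′

      no-slot : ∀ i {u} → (∀ k → idx k ≡ i → ¬ (! host k u)) → ! not (slot dl i u ∨ slot dr i u)
      no-slot i {u} ¬h = not-i λ p → go (∨-e {slot dl i u} p)
        where
        go : _ → ⊥
        go (inj₁ q) with slot-e dl i q
        ... | k , e , h , _ = ¬h k e h
        go (inj₂ q) with slot-e dr i q
        ... | k , e , h , _ = ¬h k e h

      bits-valid : ∀ u → ! valid (o u) (iso u) (bitsOf u)
      bits-valid u = ∧-i (∧-i (slot-disjoint #0 u) (∧-i (slot-disjoint #1 u) (slot-disjoint #2 u)))
        (∧-i (⇒-i λ ¬o → let none = λ i → no-slot i (λ k _ h → not-e ¬o (host⇒o k h)) in
                ∧-i (none #0) (∧-i (none #1) (none #2)))
        (∧-i (⇒-i λ h → let ¬i = not-e (∧-e₂ {o u} h) in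
                ∧-i (q-o (∧-e₁ h)) (∧-i (no-slot #2 (λ { n2 e i → ¬i i ; d0 () i ; d1 () i }))
                (⇒-i λ x → no-slot #0 λ { n0 e i → ¬i i ; d0 e h′ → not-e (∧-e₂ {o u} h′) x ; d1 () h′ })))
        (⇒-i λ i → ∧-i (proj₁ (iso-01 i)) (∧-i (proj₂ (iso-01 i)) (q-o (∧-e₁ i))))))
        where
        q-o : ! o u → ! not (a u ∧ act 2 u)
        q-o ou = not-i λ h → o¬a ou (∧-e₁ h)

      allowed : Allowed (options X (topBag L) (topBag R)) label
      allowed u rewrite lookup∘tabulate labelRow u with !? (U u)
      ... | yes Uu rewrite Uu = opt-in Uu (bits-valid u)
      ... | no ¬U rewrite ¬!⇒false ¬U = opt-out (¬!⇒false ¬U)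

      module B = Bags X (topBag L) (topBag R) label

      row≡ : ∀ {u} → ! U u → lookup label u ≡ bitsOf u
      row≡ {u} Uu = trans (lookup∘tabulate labelRow u) (cong (λ b → if b then bitsOf u else noBits) Uu)

      mark≡ : ∀ {u} → ! U u → ∀ i → mark label i u ≡ f i u
      mark≡ Uu i rewrite row≡ Uu = go i
        where
        go : ∀ i → lookup (bitsOf _) (i ↑ˡ 6) ≡ f i _
        go #0 = refl
        go #1 = refl
        go #2 = refl

      inL≡ : ∀ {u} → ! U u → ∀ i → inL label i u ≡ slot dl i u
      inL≡ Uu i rewrite row≡ Uu = go i
        where
        go : ∀ i → lookup (bitsOf _) (3 ↑ʳ (i ↑ˡ 3)) ≡ slot dl i _
        go #0 = refl
        go #1 = refl
        go #2 = refl

      inR≡ : ∀ {u} → ! U u → ∀ i → inR label i u ≡ slot dr i u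
      inR≡ Uu i rewrite row≡ Uu = go i
        where
        go : ∀ i → lookup (bitsOf _) (6 ↑ʳ i) ≡ slot dr i _
        go #0 = refl
        go #1 = refl
        go #2 = refl

      agree-ok : ∀ {u} → ! U u → ∀ k → ! host k u → ∀ v k′ → ! B.agree k k′ u v
      agree-ok {u} Uu k h v k′ = ⇒-i λ q →
        let Uv = ∧-e₁ {U v} q
            q′ = ∧-e₂ {U v} q
            hv = trans (sym (host-cong {mark label} {f} (mark≡ Uv) k′)) (∧-e₁ q′)
            s  = ∧-e₂ {B.host k′ v} q′
        in ∧-i (==-i (both-sides {inL label} {dl} (inL≡ Uu) (inL≡ Uv) hv (dl-inv k u k′ v s)))
               (==-i (both-sides {inR label} {dr} (inR≡ Uu) (inR≡ Uv) hv (dr-inv k u k′ v s)))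
        where
        both-sides : ∀ {p : Fin 3 → Fin n → Bool} {d′ : Kind → Fin n → Bool} → (∀ i → p i u ≡ slot d′ i u) →
                     (∀ i → p i v ≡ slot d′ i v) → ! host k′ v → d′ k u ≡ d′ k′ v →
                     p (idx k) u ≡ p (idx k′) v
        both-sides {p} {d′} pu pv hv e =
          trans (pu (idx k)) (trans (slot-host d′ k h) (trans e (trans (sym (slot-host d′ k′ hv)) (sym (pv (idx
                k′))))))

      demand-ok : ∀ {u} → ! U u → ∀ k → ! B.demand k u
      demand-ok {u} Uu k = ⇒-i λ h′ → go (trans (sym (host-cong {mark label} {f} (mark≡ Uu) k)) h′)
        where
        lᵤ rᵤ : Bool
        lᵤ = inL label (idx k) u
        rᵤ = inR label (idx k) u
        go : ! host k u → ! (lᵤ ⇒ B.carrier (topBag L) k u) ∧ ((rᵤ ⇒ B.carrier (topBag R) k u ∨ anyF λ v → U v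
              ∧ B.sup k u v) ∧
                   ((B.oblig k u ⇒ B.carrier X k u ∨ (lᵤ ∨ rᵤ)) ∧ allF λ v → allK λ k′ → B.agree k k′ u v))
        go h = ∧-i (⇒-i λ p → left-carried k Uu rr (trans (sym l≡) p))
              (∧-i (⇒-i λ p → supply (right-met k Uu rr (trans (sym r≡) p)))
              (∧-i (⇒-i λ p → obl (trans (sym (oblig-cong {mark label} {f} (mark≡ Uu) k)) p))
                   (allF-i λ v → allK-i λ k′ → agree-ok Uu k h v k′)))
          where
          rr = rel-refl f {k} h
          l≡ : lᵤ ≡ dl k u
          l≡ = trans (inL≡ Uu (idx k)) (slot-host dl k h)
          r≡ : rᵤ ≡ dr k u
          r≡ = trans (inR≡ Uu (idx k)) (slot-host dr k h)
          supply : ! carried (topBag R) k u ∨ bagsup k u → ! B.carrier (topBag R) k u ∨ anyF λ v → U v ∧ B.sup k u v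
          supply q with ∨-e {carried (topBag R) k u} q
          ... | inj₁ c = ∨-i₁ c
          ... | inj₂ s with anyF-e s
          ...   | v , p = ∨-i₂ {carried (topBag R) k u} (anyF-i v (∧-i (∧-e₁ {U v} p)
                    (trans (sup-cong {mark label} {f} (mark≡ (∧-e₁ {U v} p)) k u) (∧-e₂ {U v} p))))
          obl : ! oblig k u → ! B.carrier X k u ∨ (lᵤ ∨ rᵤ)
          obl q with !? (carried X k u)
          ... | yes c = ∨-i₁ c
          ... | no ¬c = ∨-i₂ {carried X k u} (trans (cong₂ _∨_ l≡ r≡) (need⇒ k u (trans (cong (λ b → if b then
                want k u else oblig k u) (¬!⇒false ¬c)) q)))

      local-ok : ∀ {u} → ! U u → ! B.local u
      local-ok {u} Uu = ∧-i (⇒-i λ h → m01 (01? (∨-e {iso u} h)))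
        (∧-i (⇒-i λ au → allF-i λ v → ⇒-i λ q → edge au (∧-e₁ {U v} q) (∧-e₂ {U v} q))
             (allK-i (demand-ok Uu)))
        where
        01? : (! iso u) ⊎ (! mixed u) → (! f #0 u) × (! f #1 u)
        01? (inj₁ i) = iso-01 i
        01? (inj₂ m) = mixed-01 m
        m01 : (! f #0 u) × (! f #1 u) → ! mark label #0 u ∧ mark label #1 u
        m01 (p , q) = ∧-i (trans (mark≡ Uu #0) p) (trans (mark≡ Uu #1) q)
        edge : ! a u → ∀ {v} → ! U v → ! adj u v →
               ! (mark label #1 u ⇒ mark label #0 v) ∧ (mark label #2 u ⇒ mark label #1 v)
        edge au {v} Uv e = ∧-i
          (⇒-i λ p → trans (mark≡ Uv #0) (act-a⁻¹ au (trans (sym (mark≡ Uu #1)) p) v e))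
          (⇒-i λ p → trans (mark≡ Uv #1) (act-a⁻¹ au (∧-e₂ {a u} (trans (sym (mark≡ Uu #2)) p)) v e))

      check-ok : ! B.check
      check-ok = allF-i {p = λ u → B.U u ⇒ B.local u} λ u → ⇒-i (local-ok {u})

      ∧-cong : ∀ {x y y′} → (! x → y ≡ y′) → x ∧ y ≡ x ∧ y′
      ∧-cong {true}  h = h refl
      ∧-cong {false} h = refl

      key-cong : ∀ (M : Subset n) {p q p′ q′} → (∀ {u} → ! lookup M u → ∀ i → p i u ≡ p′ i u) →
                 (∀ {u} → ! lookup M u → ∀ i → q i u ≡ q′ i u) → key M p q ≡ key M p′ q′
      key-cong M {p} {q} {p′} {q′} hp hq = tabulate-cong λ u → go u
        where
        go : ∀ u → row M p q u ≡ row M p′ q′ u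
        go u with lookup M u in eq
        ... | false = refl
        ... | true rewrite hp eq #0 | hp eq #1 | hp eq #2 | hq eq #0 | hq eq #1 | hq eq #2 = refl

      keyL-ok : B.keyL ≡ stateKey dl L
      keyL-ok = key-cong (topBag L) (λ {u} t → mark≡ (∨-i₂ {lookup X u} (∨-i₁ t))) (λ {u} t → inL≡ (∨-i₂
            {lookup X u} (∨-i₁ t)))

      keyR-ok : B.keyR ≡ stateKey dr R
      keyR-ok = key-cong (topBag R) (λ {u} t → mark≡ (∨-i₂ {lookup X u} (∨-i₂ {lookup (topBag L) u} t)))
                                    (λ {u} t → inR≡ (∨-i₂ {lookup X u} (∨-i₂ {lookup (topBag L) u} t)))

      keyT-ok : B.keyT ≡ stateKey want (node X L R)
      keyT-ok = key-cong X (λ t → mark≡ (∨-i₁ t)) λ {u} t i →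
        trans (cong₂ _∨_ (inL≡ (∨-i₁ t) i) (inR≡ (∨-i₁ t) i)) (≡-i (λ p → onto t i (∨-e {slot dl i u} p)) (back t i))
        where
        -- A host in `X` carries its own demand, so the choice lies with the node above.
        want≡ : ∀ {u} → ! lookup X u → ∀ k → ! host k u → need k u ≡ want k u
        want≡ {u} t k h = cong (λ b → if b then want k u else oblig k u) (carried-i X k k u t (rel-refl f {k} h))
        onto : ∀ {u} → ! lookup X u → ∀ i → (! slot dl i u) ⊎ (! slot dr i u) → ! slot want i u
        onto t i (inj₁ p) with slot-e dl i p
        ... | k , refl , h , q = slot-i want k h (trans (sym (want≡ t k h)) (∧-e₁ q))
        onto t i (inj₂ p) with slot-e dr i p
        ... | k , refl , h , q = slot-i want k h (trans (sym (want≡ t k h)) (∧-e₁ q))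
        back : ∀ {u} → ! lookup X u → ∀ i → ! slot want i u → ! slot dl i u ∨ slot dr i u
        back {u} t i p with slot-e want i p
        ... | k , refl , h , q with ∨-e {dl k u} (need⇒ k u (trans (want≡ t k h) q))
        ...   | inj₁ s = ∨-i₁ (slot-i dl k h s)
        ...   | inj₂ s = ∨-i₂ {slot dl (idx k) u} (slot-i dr k h s)

      forgotten-ok : ∀ u → B.forgotten u ≡ (top L u ∨ top R u) ∧ (not (lookup X u) ∧ f #0 u)
      forgotten-ok u = ∧-cong λ t → cong (not (lookup X u) ∧_) (mark≡ (∨-i₂ {lookup X u} t) #0)

      trace-node : Trace L (stateKey dl L) (countF (below (f #0) L)) → Trace R (stateKey dr R) (countF (below
            (f #0) R)) →
                   Trace (node X L R) (stateKey want (node X L R)) (countF (below (f #0) (node X L R)))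
      trace-node l r = subst₂ (Trace (node X L R)) keyT-ok (count-node (f #0) I B.forgotten forgotten-ok)
        (node label allowed check-ok (subst (λ κ → Trace L κ (countF (below (f #0) L))) (sym keyL-ok) l) (subst
              (λ κ → Trace R κ (countF (below (f #0) R))) (sym keyR-ok) r))

    trace : ∀ T → NiceBT T → Connected T → Closed adj T → ∀ want → Invariant want → Wanted T want →
            Trace T (stateKey want T) (countF (below (f #0) T))
    trace leaf _ _ _ want _ _ = subst₂ (Trace leaf) key≡ count≡ leaf
      where
      key≡ : emptyKey ≡ stateKey want leaf
      key≡ = tabulate-cong λ u → go u
        where
        go : ∀ u → _ ≡ row (tabulate λ _ → false) f (slot want) u
        go u rewrite lookup∘tabulate (λ (_ : Fin n) → false) u = refl
      count≡ : 0 ≡ countF (below (f #0) leaf)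
      count≡ = sym (trans (countF-cong λ u → ¬!⇒false λ h → false≢ (∧-e₂ {f #0 u} h)) (countF-false {n}))
        where
        false≢ : ¬ (! false)
        false≢ ()
    trace (node X L leaf) (unary nl) (I , CL , CR) Cl want winv wok =
      trace-node (trace L nl CL (closedˡ I Cl) dl dl-inv wanted-l) (trace leaf leaf tt (λ { _ () }) dr dr-inv
            wanted-r)
      where
      this : Situation
      this = record { X = X ; L = L ; R = leaf ; I = I ; Cl = Cl ; joined = false ; unary-R = λ _ () ; join-X = λ ()
                    ; want = want ; winv = winv ; wok = wok }
      open AtBag this
    trace (node X L R) (join XL XR nl nr) (I , CL , CR) Cl want winv wok =
      trace-node (trace L nl CL (closedˡ I Cl) dl dl-inv wanted-l) (trace R nr CR (closedʳ I Cl) dr dr-inv wanted-r)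
      where
      this : Situation
      this = record { X = X ; L = L ; R = R ; I = I ; Cl = Cl ; joined = true ; unary-R = λ ¬j → ⊥-elim (¬j refl)
                    ; join-X = λ _ → XL , XR ; want = want ; winv = winv ; wok = wok }
      open AtBag this

-- The local checks as expressions

infixr 4 _⇒ᵉ_
infix  5 _==ᵉ_
infixr 6 _∧ᵉ_
infixr 5 _∨ᵉ_
infixl 8 _⟨_⟩ᵉ

notᵉ : Ex Γ bool → Ex Γ bool
allᵉ anyᵉ : Ex (fin ∷ Γ) bool → Ex Γ bool
_∧ᵉ_ _∨ᵉ_ _⇒ᵉ_ _==ᵉ_ : Ex Γ bool → Ex Γ bool → Ex Γ bool
_⟨_⟩ᵉ : Ex Γ (vec τ) → Ex Γ fin → Ex Γ τ
notᵉ a = prim notP (a ∷ [])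
a ∧ᵉ b = prim andP (a ∷ b ∷ [])
a ∨ᵉ b = prim orP (a ∷ b ∷ [])
a ⇒ᵉ b = notᵉ a ∨ᵉ b
a ==ᵉ b = (a ⇒ᵉ b) ∧ᵉ (b ⇒ᵉ a)
a ⟨ u ⟩ᵉ = prim lookupP (a ∷ u ∷ [])
allᵉ e = prim allP (tab e ∷ [])
anyᵉ e = prim anyP (tab e ∷ [])

anyKᵉ allKᵉ : (Kind → Ex Γ bool) → Ex Γ bool
anyKᵉ p = p n0 ∨ᵉ (p n1 ∨ᵉ (p n2 ∨ᵉ (p d0 ∨ᵉ p d1)))
allKᵉ p = p n0 ∧ᵉ (p n1 ∧ᵉ (p n2 ∧ᵉ (p d0 ∧ᵉ p d1)))

falseᵉ : Ex Γ bool
falseᵉ = prim (constP bool false nil refl) []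

pattern v0 = var #0
pattern v1 = var #1
pattern v2 = var #2
pattern v3 = var #3
pattern v4 = var #4
pattern v5 = var #5
pattern v6 = var #6
pattern v7 = var #7
pattern v8 = var #8
pattern v9 = var #9

matrix set labels matrices : Ty
matrix   = vec (vec bool)
set      = vec bool
labels   = vec (bits 9)
matrices = matrix ⊗ matrix

zᵉ oᵉ aᵉ : Ex (vec nat ∷ fin ∷ []) bool
zᵉ = prim is0P (v0 ⟨ v1 ⟩ᵉ ∷ [])
oᵉ = prim is1P (v0 ⟨ v1 ⟩ᵉ ∷ [])
aᵉ = notᵉ zᵉ ∧ᵉ notᵉ oᵉ

adjᵉ : Ex (matrix ∷ fin ∷ fin ∷ []) bool
adjᵉ = v0 ⟨ v1 ⟩ᵉ ⟨ v2 ⟩ᵉ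

reachᵉ : Bool → Ex (matrices ∷ fin ∷ fin ∷ []) bool
reachᵉ false = prim fstP (v0 ∷ []) ⟨ v1 ⟩ᵉ ⟨ v2 ⟩ᵉ
reachᵉ true  = prim sndP (v0 ∷ []) ⟨ v1 ⟩ᵉ ⟨ v2 ⟩ᵉ

isoᵉ mixedᵉ : Ex (matrix ∷ vec nat ∷ fin ∷ []) bool
isoᵉ   = sub oᵉ (v1 ∷ v2 ∷ []) ∧ᵉ allᵉ (sub adjᵉ (v1 ∷ v3 ∷ v0 ∷ []) ⇒ᵉ sub aᵉ (v2 ∷ v0 ∷ []))
mixedᵉ = sub aᵉ (v1 ∷ v2 ∷ []) ∧ᵉ anyᵉ (sub adjᵉ (v1 ∷ v3 ∷ v0 ∷ []) ∧ᵉ sub aᵉ (v2 ∷ v0 ∷ []))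

exemptᵉ : Bool → Ex (matrix ∷ vec nat ∷ matrices ∷ fin ∷ []) bool
exemptᵉ j = anyᵉ (sub (reachᵉ j) (v3 ∷ v4 ∷ v0 ∷ []) ∧ᵉ (sub zᵉ (v2 ∷ v0 ∷ []) ∨ᵉ
  (sub oᵉ (v2 ∷ v0 ∷ []) ∧ᵉ anyᵉ (sub adjᵉ (v2 ∷ v1 ∷ v0 ∷ []) ∧ᵉ sub zᵉ (v3 ∷ v0 ∷ [])))))

sameᵉ : Bool → Bool → Ex (vec nat ∷ matrices ∷ fin ∷ fin ∷ []) bool
sameᵉ i j = sub oᵉ (v0 ∷ v2 ∷ []) ∧ᵉ (sub oᵉ (v0 ∷ v3 ∷ []) ∧ᵉ
  allᵉ (sub (reachᵉ i) (v2 ∷ v3 ∷ v0 ∷ []) ==ᵉ sub (reachᵉ j) (v2 ∷ v4 ∷ v0 ∷ [])))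

relᵉ : Kind → Kind → Ex (vec nat ∷ matrices ∷ fin ∷ fin ∷ []) bool
relᵉ (near i) (near j) = prim (constP bool (eqF i j) (encodeBool (eqF i j)) refl) [] ∧ᵉ prim eqP (v2 ∷ v3 ∷ [])
relᵉ (walk i) (walk j) = sameᵉ i j
relᵉ (near _) (walk _) = falseᵉ
relᵉ (walk _) (near _) = falseᵉ

markᵉ inLᵉ inRᵉ : Fin 3 → Ex (labels ∷ fin ∷ []) bool
markᵉ i = prim (bitP (i ↑ˡ 6)) (v0 ⟨ v1 ⟩ᵉ ∷ [])
inLᵉ  i = prim (bitP (3 ↑ʳ (i ↑ˡ 3))) (v0 ⟨ v1 ⟩ᵉ ∷ [])
inRᵉ  i = prim (bitP (6 ↑ʳ i)) (v0 ⟨ v1 ⟩ᵉ ∷ [])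

hostᵉ : Kind → Ex (matrix ∷ vec nat ∷ labels ∷ fin ∷ []) bool
hostᵉ n0       = sub isoᵉ (v0 ∷ v1 ∷ v3 ∷ [])
hostᵉ n1       = sub oᵉ (v1 ∷ v3 ∷ []) ∧ᵉ sub (markᵉ #1) (v2 ∷ v3 ∷ [])
hostᵉ n2       = sub isoᵉ (v0 ∷ v1 ∷ v3 ∷ [])
hostᵉ (walk j) = sub oᵉ (v1 ∷ v3 ∷ []) ∧ᵉ notᵉ (sub (markᵉ (parityMark j)) (v2 ∷ v3 ∷ []))

obligᵉ : Kind → Ex (matrix ∷ vec nat ∷ matrices ∷ labels ∷ fin ∷ []) bool
obligᵉ (near i) = sub (hostᵉ (near i)) (v0 ∷ v1 ∷ v3 ∷ v4 ∷ [])
obligᵉ (walk j) = sub oᵉ (v1 ∷ v4 ∷ []) ∧ᵉ notᵉ (sub (exemptᵉ j) (v0 ∷ v1 ∷ v2 ∷ v4 ∷ []))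

supᵉ : Kind → Ex (matrix ∷ matrices ∷ labels ∷ fin ∷ fin ∷ []) bool
supᵉ (near i) = sub adjᵉ (v0 ∷ v3 ∷ v4 ∷ []) ∧ᵉ sub (markᵉ (wanted i)) (v2 ∷ v4 ∷ [])
supᵉ (walk j) = sub (reachᵉ j) (v1 ∷ v3 ∷ v4 ∷ []) ∧ᵉ sub (markᵉ #0) (v2 ∷ v4 ∷ [])

Uᵉ : Ex (set ∷ set ∷ set ∷ fin ∷ []) bool
Uᵉ = v0 ⟨ v3 ⟩ᵉ ∨ᵉ (v1 ⟨ v3 ⟩ᵉ ∨ᵉ v2 ⟨ v3 ⟩ᵉ)

carrierᵉ : Kind → Ex (vec nat ∷ matrices ∷ set ∷ fin ∷ []) bool
carrierᵉ k = anyᵉ (v3 ⟨ v0 ⟩ᵉ ∧ᵉ anyKᵉ λ k′ → sub (relᵉ k k′) (v1 ∷ v2 ∷ v4 ∷ v0 ∷ []))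

Bagsᵉ : Vec Ty 7
Bagsᵉ = matrix ∷ vec nat ∷ matrices ∷ set ∷ set ∷ set ∷ labels ∷ []

agreeᵉ : Kind → Kind → Ex (fin ∷ fin ∷ Bagsᵉ) bool
agreeᵉ k k′ =
  (sub Uᵉ (v5 ∷ v6 ∷ v7 ∷ v1 ∷ []) ∧ᵉ
    (sub (hostᵉ k′) (v2 ∷ v3 ∷ v8 ∷ v1 ∷ []) ∧ᵉ sub (relᵉ k k′) (v3 ∷ v4 ∷ v0 ∷ v1 ∷ []))) ⇒ᵉ
  ((sub (inLᵉ (idx k)) (v8 ∷ v0 ∷ []) ==ᵉ sub (inLᵉ (idx k′)) (v8 ∷ v1 ∷ [])) ∧ᵉ
   (sub (inRᵉ (idx k)) (v8 ∷ v0 ∷ []) ==ᵉ sub (inRᵉ (idx k′)) (v8 ∷ v1 ∷ [])))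

demandᵉ : Kind → Ex (fin ∷ Bagsᵉ) bool
demandᵉ k = sub (hostᵉ k) (v1 ∷ v2 ∷ v7 ∷ v0 ∷ []) ⇒ᵉ
  ((lᵤ ⇒ᵉ sub (carrierᵉ k) (v2 ∷ v3 ∷ v5 ∷ v0 ∷ [])) ∧ᵉ
  ((rᵤ ⇒ᵉ sub (carrierᵉ k) (v2 ∷ v3 ∷ v6 ∷ v0 ∷ []) ∨ᵉ
     anyᵉ (sub Uᵉ (v5 ∷ v6 ∷ v7 ∷ v0 ∷ []) ∧ᵉ sub (supᵉ k) (v2 ∷ v4 ∷ v8 ∷ v1 ∷ v0 ∷ []))) ∧ᵉ
  ((sub (obligᵉ k) (v1 ∷ v2 ∷ v3 ∷ v7 ∷ v0 ∷ []) ⇒ᵉ sub (carrierᵉ k) (v2 ∷ v3 ∷ v4 ∷ v0 ∷ []) ∨ᵉ (lᵤ ∨ᵉ rᵤ)) ∧ᵉ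
   allᵉ (allKᵉ λ k′ → sub (agreeᵉ k k′) (v1 ∷ v0 ∷ v2 ∷ v3 ∷ v4 ∷ v5 ∷ v6 ∷ v7 ∷ v8 ∷ [])))))
  where
  lᵤ rᵤ : Ex (fin ∷ Bagsᵉ) bool
  lᵤ = sub (inLᵉ (idx k)) (v7 ∷ v0 ∷ [])
  rᵤ = sub (inRᵉ (idx k)) (v7 ∷ v0 ∷ [])

edgesᵉ localᵉ : Ex (fin ∷ Bagsᵉ) bool
edgesᵉ = sub aᵉ (v2 ∷ v0 ∷ []) ⇒ᵉ
  allᵉ ((sub Uᵉ (v5 ∷ v6 ∷ v7 ∷ v0 ∷ []) ∧ᵉ sub adjᵉ (v2 ∷ v1 ∷ v0 ∷ [])) ⇒ᵉ
    ((sub (markᵉ #1) (v8 ∷ v1 ∷ []) ⇒ᵉ sub (markᵉ #0) (v8 ∷ v0 ∷ [])) ∧ᵉ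
     (sub (markᵉ #2) (v8 ∷ v1 ∷ []) ⇒ᵉ sub (markᵉ #1) (v8 ∷ v0 ∷ []))))
localᵉ =
  (sub isoᵉ (v1 ∷ v2 ∷ v0 ∷ []) ∨ᵉ sub mixedᵉ (v1 ∷ v2 ∷ v0 ∷ []) ⇒ᵉ
    sub (markᵉ #0) (v7 ∷ v0 ∷ []) ∧ᵉ sub (markᵉ #1) (v7 ∷ v0 ∷ [])) ∧ᵉ
  (edgesᵉ ∧ᵉ allKᵉ demandᵉ)

checkᵉ : Ex Bagsᵉ bool
checkᵉ = allᵉ (sub Uᵉ (v4 ∷ v5 ∷ v6 ∷ v0 ∷ []) ⇒ᵉ localᵉ)

-- Shaped so that evaluating the expressions above yields the functions of `System` by computation
-- alone; this is why `update-write` holds by `refl`.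
module Sem {n} (G : Vec (Vec Bool n) n) (t : Vec ℕ n) (R : Vec (Vec Bool n) n × Vec (Vec Bool n) n) where
  adj : Fin n → Fin n → Bool
  adj u v = lookup (lookup G u) v
  z o a : Fin n → Bool
  z u = is0 (lookup t u)
  o u = is1 (lookup t u)
  a u = not (z u) ∧ not (o u)
  reach : Bool → Fin n → Fin n → Bool
  reach false u v = lookup (lookup (proj₁ R) u) v
  reach true  u v = lookup (lookup (proj₂ R) u) v
  signature : Signature n
  signature = record { adj = adj ; z = z ; o = o ; a = a ; reach = reach }

infixr 5 _∷ᵇ_

_∷ᵇ_ : Ex Γ bool → Ex Γ (bits k) → Ex Γ (bits (suc k))
b ∷ᵇ bs = prim consP (b ∷ bs ∷ [])

[]ᵇ : Ex Γ (bits 0)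
[]ᵇ = prim nilP []

keyLᵉ keyRᵉ keyTᵉ : Ex (set ∷ labels ∷ []) (vec (bits 6))
keyLᵉ = tab ((v1 ⟨ v0 ⟩ᵉ ∧ᵉ sub (markᵉ #0) (v2 ∷ v0 ∷ [])) ∷ᵇ (v1 ⟨ v0 ⟩ᵉ ∧ᵉ sub (markᵉ #1) (v2 ∷ v0 ∷ [])) ∷ᵇ
             (v1 ⟨ v0 ⟩ᵉ ∧ᵉ sub (markᵉ #2) (v2 ∷ v0 ∷ [])) ∷ᵇ (v1 ⟨ v0 ⟩ᵉ ∧ᵉ sub (inLᵉ #0) (v2 ∷ v0 ∷ [])) ∷ᵇ
             (v1 ⟨ v0 ⟩ᵉ ∧ᵉ sub (inLᵉ #1) (v2 ∷ v0 ∷ [])) ∷ᵇ (v1 ⟨ v0 ⟩ᵉ ∧ᵉ sub (inLᵉ #2) (v2 ∷ v0 ∷ [])) ∷ᵇ []ᵇ)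
keyRᵉ = tab ((v1 ⟨ v0 ⟩ᵉ ∧ᵉ sub (markᵉ #0) (v2 ∷ v0 ∷ [])) ∷ᵇ (v1 ⟨ v0 ⟩ᵉ ∧ᵉ sub (markᵉ #1) (v2 ∷ v0 ∷ [])) ∷ᵇ
             (v1 ⟨ v0 ⟩ᵉ ∧ᵉ sub (markᵉ #2) (v2 ∷ v0 ∷ [])) ∷ᵇ (v1 ⟨ v0 ⟩ᵉ ∧ᵉ sub (inRᵉ #0) (v2 ∷ v0 ∷ [])) ∷ᵇ
             (v1 ⟨ v0 ⟩ᵉ ∧ᵉ sub (inRᵉ #1) (v2 ∷ v0 ∷ [])) ∷ᵇ (v1 ⟨ v0 ⟩ᵉ ∧ᵉ sub (inRᵉ #2) (v2 ∷ v0 ∷ [])) ∷ᵇ []ᵇ)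
keyTᵉ = tab ((v1 ⟨ v0 ⟩ᵉ ∧ᵉ sub (markᵉ #0) (v2 ∷ v0 ∷ [])) ∷ᵇ (v1 ⟨ v0 ⟩ᵉ ∧ᵉ sub (markᵉ #1) (v2 ∷ v0 ∷ [])) ∷ᵇ
             (v1 ⟨ v0 ⟩ᵉ ∧ᵉ sub (markᵉ #2) (v2 ∷ v0 ∷ [])) ∷ᵇ met #0 ∷ᵇ met #1 ∷ᵇ met #2 ∷ᵇ []ᵇ)
  where
  met : Fin 3 → Ex (fin ∷ set ∷ labels ∷ []) bool
  met i = v1 ⟨ v0 ⟩ᵉ ∧ᵉ (sub (inLᵉ i) (v2 ∷ v0 ∷ []) ∨ᵉ sub (inRᵉ i) (v2 ∷ v0 ∷ []))

emptyKeyᵉ : Ex [] (vec (bits 6))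
emptyKeyᵉ = tab (falseᵉ ∷ᵇ falseᵉ ∷ᵇ falseᵉ ∷ᵇ falseᵉ ∷ᵇ falseᵉ ∷ᵇ falseᵉ ∷ᵇ []ᵇ)

iteᵉ : Ex Γ bool → Ex Γ τ → Ex Γ τ → Ex Γ τ
iteᵉ b x y = prim iteP (b ∷ x ∷ y ∷ [])

countᵉ : Ex (set ∷ set ∷ set ∷ labels ∷ []) raw
countᵉ = prim countP (tab ((v2 ⟨ v0 ⟩ᵉ ∨ᵉ v3 ⟨ v0 ⟩ᵉ) ∧ᵉ (notᵉ (v1 ⟨ v0 ⟩ᵉ) ∧ᵉ sub (markᵉ #0) (v4 ∷ v0 ∷ []))) ∷ [])

-- Variables: the number of vertices a label forgets, the entries of its two
-- child keys, and the current entry of its own key.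
newᵉ : Ex (raw ∷ raw ∷ raw ∷ raw ∷ []) raw
newᵉ = prim someP (iteᵉ (prim isConsP (v3 ∷ [])) (prim minP (total ∷ prim tlP (v3 ∷ []) ∷ [])) total ∷ [])
  where
  total : Ex (raw ∷ raw ∷ raw ∷ raw ∷ []) raw
  total = prim plusP (prim plusP (v0 ∷ prim tlP (v1 ∷ []) ∷ []) ∷ prim tlP (v2 ∷ []) ∷ [])

-- Variables: the table under construction, the tables of the two children, and
-- the variables of checkᵉ.
updateᵉ : Ex (raw ∷ raw ∷ raw ∷ Bagsᵉ) raw
updateᵉ = iteᵉ (sub checkᵉ (v3 ∷ v4 ∷ v5 ∷ v6 ∷ v7 ∷ v8 ∷ v9 ∷ []) ∧ᵉ (prim isConsP (lᵤ ∷ []) ∧ᵉ prim isConsP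
      (rᵤ ∷ [])))
  (prim setP (t ∷ sub newᵉ (sub countᵉ (v6 ∷ v7 ∷ v8 ∷ v9 ∷ []) ∷ lᵤ ∷ rᵤ ∷ prim getP (t ∷ v0 ∷ []) ∷ []) ∷ v0 ∷ []))
  v0
  where
  lᵤ rᵤ : Ex (raw ∷ raw ∷ raw ∷ Bagsᵉ) raw
  lᵤ = prim getP (sub keyLᵉ (v7 ∷ v9 ∷ []) ∷ v1 ∷ [])
  rᵤ = prim getP (sub keyRᵉ (v8 ∷ v9 ∷ []) ∷ v2 ∷ [])
  t : Ex (raw ∷ raw ∷ raw ∷ Bagsᵉ) (vec (bits 6))
  t = sub keyTᵉ (v6 ∷ v9 ∷ [])

stepᵉ : Ex (matrices ∷ matrix ∷ vec nat ∷ []) matrices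
stepᵉ = prim pairP
  (tab (tab (prim eqP (v1 ∷ v0 ∷ []) ∨ᵉ (sub oᵉ (v4 ∷ v1 ∷ []) ∧ᵉ
     anyᵉ (sub adjᵉ (v4 ∷ v2 ∷ v0 ∷ []) ∧ᵉ sub (reachᵉ true) (v3 ∷ v0 ∷ v1 ∷ []))))) ∷
   tab (tab (sub oᵉ (v4 ∷ v1 ∷ []) ∧ᵉ
     anyᵉ (sub adjᵉ (v4 ∷ v2 ∷ v0 ∷ []) ∧ᵉ sub (reachᵉ false) (v3 ∷ v0 ∷ v1 ∷ [])))) ∷ [])

-- `iter` makes n rounds, and two steps per round give the 2n steps after which `within` is
-- stationary.
matricesᵉ : Ex (matrix ∷ vec nat ∷ []) matrices
matricesᵉ = iter (prim pairP (tab (tab falseᵉ) ∷ tab (tab falseᵉ) ∷ []))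
  (sub stepᵉ (sub stepᵉ (v0 ∷ v1 ∷ v2 ∷ []) ∷ v1 ∷ v2 ∷ []))

allBits : ∀ k → List (Vec Bool k)
allBits zero    = [] ∷ []
allBits (suc k) = map (false ∷_) (allBits k) ++ map (true ∷_) (allBits k)

∈-allBits : (bs : Vec Bool k) → bs ∈ allBits k
∈-allBits []           = here refl
∈-allBits (false ∷ bs) = ∈-++⁺ˡ (∈-map⁺ (false ∷_) (∈-allBits bs))
∈-allBits {suc k} (true ∷ bs)  = ∈-++⁺ʳ (map (false ∷_) (allBits k)) (∈-map⁺ (true ∷_) (∈-allBits bs))

opaque
  -- The resulting lists enter the program as constants, so selecting from all 2 ^ 9 vectors takes
  -- no running time.
  validLabels : Bool → Bool → List (Vec Bool 9)
  validLabels i j = filterᵇ (valid i j) (allBits 9)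

  ∈-validLabels : ∀ i j {bs} → ! valid i j bs → bs ∈ validLabels i j
  ∈-validLabels i j h = ∈-filter⁺ (T? ∘ valid i j) (∈-allBits _) (Equivalence.from T-≡ h)

encodeList : {A : Set} → (A → Data) → List A → Data
encodeList f []       = nil
encodeList f (x ∷ xs) = cons (f x) (encodeList f xs)

encodeLabels : List (Vec Bool 9) → Data
encodeLabels = encodeList (encodeVec encodeBool)

-- A vertex outside the visible bags has a single option. Labels can thus be vectors over all
-- vertices, while their number is exponential in the visible ones only.
labelsFor : Bool → Bool → Bool → List (Vec Bool 9)
labelsFor inU isIso isO =
  if inU then (if isIso then validLabels true true else if isO then validLabels true false else validLabels
        false false)
  else noBits ∷ []

optionsᵉ : Ex (matrix ∷ vec nat ∷ set ∷ set ∷ set ∷ []) (vec raw)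
optionsᵉ = tab (iteᵉ (sub Uᵉ (v3 ∷ v4 ∷ v5 ∷ v0 ∷ []))
  (iteᵉ (sub isoᵉ (v1 ∷ v2 ∷ v0 ∷ [])) (const (validLabels true true))
    (iteᵉ (sub oᵉ (v2 ∷ v0 ∷ [])) (const (validLabels true false)) (const (validLabels false false))))
  (const (noBits ∷ [])))
  where
  const : List (Vec Bool 9) → Ex (fin ∷ matrix ∷ vec nat ∷ set ∷ set ∷ set ∷ []) raw
  const bs = prim (constP raw (encodeLabels bs) (encodeLabels bs) refl) []

opaque
  unfolding validLabels

  labelsFor-length : ∀ i j k → length (labelsFor i j k) ≤ (if i then 32 else 1)
  labelsFor-length false _     _     = ≤-refl
  labelsFor-length true  true  _     = ≤ᵇ⇒≤ _ _ tt
  labelsFor-length true  false true  = ≤ᵇ⇒≤ _ _ tt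
  labelsFor-length true  false false = ≤ᵇ⇒≤ _ _ tt

  labelsFor-nonempty : ∀ i j k → 1 ≤ length (labelsFor i j k)
  labelsFor-nonempty false _     _     = ≤-refl
  labelsFor-nonempty true  true  _     = ≤ᵇ⇒≤ _ _ tt
  labelsFor-nonempty true  false true  = ≤ᵇ⇒≤ _ _ tt
  labelsFor-nonempty true  false false = ≤ᵇ⇒≤ _ _ tt

-- Reachability by OR walks

module ReachIter {n} (adj : Fin n → Fin n → Bool) (o : Fin n → Bool) where
  open Walks adj o

  -- Walks with fewer than k edges.
  within : ℕ → Bool → Fin n → Fin n → Bool
  within zero    j     u v = false
  within (suc k) false u v = eqF u v ∨ (o u ∧ anyF λ y → adj u y ∧ within k true y v)
  within (suc k) true  u v = o u ∧ anyF λ y → adj u y ∧ within k false y v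

  within-sound : ∀ k j {u v} → ! within k j u v → Reach j u v
  via : ∀ k j {u v} → ! o u ∧ anyF (λ y → adj u y ∧ within k j y v) → Reach (not j) u v
  within-sound (suc k) false {u} {v} h with ∨-e {eqF u v} h
  ... | inj₁ e = subst (Reach false u) (eqF⇒≡ u v e) here
  ... | inj₂ q = via k true q
  within-sound (suc k) true h = via k false h
  via k j {u} {v} h with anyF-e {p = λ y → adj u y ∧ within k j y v} (∧-e₂ {o u} h)
  ... | y , p = step (∧-e₁ h) (∧-e₁ p) (within-sound k j (∧-e₂ {adj u y} p))

  _⊑_ : (Bool → Fin n → Bool) → (Bool → Fin n → Bool) → Set
  p ⊑ q = ∀ j u → ! p j u → ! q j u

  slice : ℕ → Fin n → Bool → Fin n → Bool
  slice k v j u = within k j u v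

  grow : ∀ v k l → slice k v ⊑ slice l v → slice (suc k) v ⊑ slice (suc l) v
  grow v k l h false u p with ∨-e {eqF u v} p
  ... | inj₁ e = ∨-i₁ e
  ... | inj₂ q with anyF-e {p = λ y → adj u y ∧ within k true y v} (∧-e₂ {o u} q)
  ...   | y , r = ∨-i₂ {eqF u v} (∧-i (∧-e₁ {o u} q) (anyF-i y (∧-i (∧-e₁ r) (h true y (∧-e₂ {adj u y} r)))))
  grow v k l h true u q with anyF-e {p = λ y → adj u y ∧ within k false y v} (∧-e₂ {o u} q)
  ... | y , r = ∧-i (∧-e₁ {o u} q) (anyF-i y (∧-i (∧-e₁ r) (h false y (∧-e₂ {adj u y} r))))

  grow-suc : ∀ v k → slice k v ⊑ slice (suc k) v
  grow-suc v zero    j u ()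
  grow-suc v (suc k) = grow v k (suc k) (grow-suc v k)

  closed-reach : ∀ k → (∀ v → slice (suc k) v ⊑ slice k v) → ∀ {j u v} → Reach j u v → ! within k j u v
  closed-reach k cl {u = u} here = cl u false u (∨-i₁ (eqF-refl u))
  closed-reach k cl {v = v} (step {true} {u} {y} ou e r) =
    cl v false u (∨-i₂ {eqF u v} (∧-i ou (anyF-i y (∧-i e (closed-reach k cl r)))))
  closed-reach k cl {v = v} (step {false} {u} {y} ou e r) =
    cl v true u (∧-i ou (anyF-i y (∧-i e (closed-reach k cl r))))

  weight : (Bool → Fin n → Bool) → ℕ
  weight p = countF (p false) + countF (p true)

  -- The slices increase and have weight at most 2n, so they are stationary
  -- after 2n steps.
  stationary : ∀ v → slice (suc (n + n)) v ⊑ slice (n + n) v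
  stationary v with progress (n + n)
    where
    ⊑? : ∀ k → (slice (suc k) v ⊑ slice k v) ⊎ (weight (slice k v) < weight (slice (suc k) v))
    ⊑? k with countF-≤-or-< {p = slice k v false} {slice (suc k) v false} (grow-suc v k false)
            | countF-≤-or-< {p = slice k v true} {slice (suc k) v true} (grow-suc v k true)
    ... | inj₁ f | inj₁ g = inj₁ λ { false → f ; true → g }
    ... | inj₂ f | inj₂ g = inj₂ (+-mono-<-≤ f (<⇒≤ g))
    ... | inj₂ f | inj₁ g = inj₂ (+-mono-<-≤ f (countF-mono (grow-suc v k true)))
    ... | inj₁ f | inj₂ g = inj₂ (+-mono-≤-< (countF-mono (grow-suc v k false)) g)
    progress : ∀ k → (slice (suc k) v ⊑ slice k v) ⊎ (suc k ≤ weight (slice (suc k) v))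
    progress zero with ⊑? zero
    ... | inj₁ h = inj₁ h
    ... | inj₂ h = inj₂ (≤-trans (s≤s z≤n) h)
    progress (suc k) with progress k
    ... | inj₁ h = inj₁ (grow v (suc k) k h)
    ... | inj₂ h with ⊑? (suc k)
    ...   | inj₁ h′ = inj₁ h′
    ...   | inj₂ h′ = inj₂ (≤-trans (s≤s h) h′)
  ... | inj₁ h = h
  ... | inj₂ h = contradiction h (<⇒≱ (s≤s (+-mono-≤ (countF-≤ (slice (suc (n + n)) v false)) (countF-≤ (slice
        (suc (n + n)) v true)))))

  within-complete : ∀ {j u v} → Reach j u v → ! within (n + n) j u v
  within-complete = closed-reach (n + n) stationary

module Reachability {n} (G : Vec (Vec Bool n) n) (t : Vec ℕ n) where
  private
    adj = λ u v → lookup (lookup G u) v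
    o   = λ u → is1 (lookup t u)
  open ReachIter adj o public

  Matrices : Set
  Matrices = Vec (Vec Bool n) n × Vec (Vec Bool n) n

  reachIn : Matrices → Bool → Fin n → Fin n → Bool
  reachIn R j u v = eval (reachᵉ j) (R ∷ u ∷ v ∷ [])

  Represents : Matrices → ℕ → Set
  Represents R k = ∀ j u v → reachIn R j u v ≡ within k j u v

  lookup₂ : ∀ {A : Set} (f : Fin n → Fin n → A) u v → lookup (lookup (tabulate λ u → tabulate (f u)) u) v ≡ f u v
  lookup₂ f u v = trans (cong (λ r → lookup r v) (lookup∘tabulate (λ u → tabulate (f u)) u)) (lookup∘tabulate (f u) v)

  represents-step : ∀ R k → Represents R k → Represents (eval stepᵉ (R ∷ G ∷ t ∷ [])) (suc k)
  represents-step R k h false u v = trans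
    (lookup₂ (λ u v → eqF u v ∨ (o u ∧ anyF λ y → adj u y ∧ reachIn R true y v)) u v)
    (cong (λ b → eqF u v ∨ (o u ∧ b)) (anyF-cong λ y → cong (adj u y ∧_) (h true y v)))
  represents-step R k h true u v = trans
    (lookup₂ (λ u v → o u ∧ anyF λ y → adj u y ∧ reachIn R false y v) u v)
    (cong (o u ∧_) (anyF-cong λ y → cong (adj u y ∧_) (h false y v)))

  represents-iterate : ∀ m R k → Represents R k →
    Represents (iterate (λ R → eval (sub stepᵉ (sub stepᵉ (v0 ∷ v1 ∷ v2 ∷ []) ∷ v1 ∷ v2 ∷ [])) (R ∷ G ∷ t ∷
          [])) m R) (m + m + k)
  represents-iterate zero    R k h = h
  represents-iterate (suc m) R k h = subst (Represents _) (arith m k)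
    (represents-iterate m _ (suc (suc k)) (represents-step _ (suc k) (represents-step R k h)))
    where
    arith : ∀ m k → m + m + suc (suc k) ≡ suc (m + suc m + k)
    arith = solve-∀

  opaque
    reachMatrices : Matrices
    reachMatrices = eval matricesᵉ (G ∷ t ∷ [])

    reachMatrices-eval : eval matricesᵉ (G ∷ t ∷ []) ≡ reachMatrices
    reachMatrices-eval = refl

    reachMatrices-within : Represents reachMatrices (n + n)
    reachMatrices-within = subst (Represents reachMatrices) (+-identityʳ (n + n)) (represents-iterate n _ 0 start)
      where
      start : Represents (tabulate (λ _ → tabulate λ _ → false) , tabulate (λ _ → tabulate λ _ → false)) 0
      start false u v = lookup₂ (λ _ _ → false) u v
      start true  u v = lookup₂ (λ _ _ → false) u v

-- Enumeration of labels

-- The remaining output `ys` is passed along instead of appended, so that the cost is linear in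
-- `cs`.
consEach : A → List (Vec A l) → List (Vec A (suc l)) → List (Vec A (suc l))
consEach x []       ys = ys
consEach x (c ∷ cs) ys = (x ∷ c) ∷ consEach x cs ys

consAll : List A → List (Vec A l) → List (Vec A (suc l))
consAll []       cs = []
consAll (x ∷ xs) cs = consEach x cs (consAll xs cs)

choices : Vec (List A) l → List (Vec A l)
choices []         = [] ∷ []
choices (xs ∷ xss) = consAll xs (choices xss)

∈-consEach⁺ˡ : ∀ {x : A} {c : Vec A l} {cs ys} → c ∈ cs → (x ∷ c) ∈ consEach x cs ys
∈-consEach⁺ˡ (here refl) = here refl
∈-consEach⁺ˡ (there p)   = there (∈-consEach⁺ˡ p)

∈-consEach⁺ʳ : ∀ (x : A) {c : Vec A (suc l)} cs {ys} → c ∈ ys → c ∈ consEach x cs ys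
∈-consEach⁺ʳ x []       p = p
∈-consEach⁺ʳ x (_ ∷ cs) p = there (∈-consEach⁺ʳ x cs p)

∈-consEach⁻ : ∀ (x : A) {c : Vec A (suc l)} cs {ys} → c ∈ consEach x cs ys →
              (∃[ d ] (c ≡ x ∷ d × d ∈ cs)) ⊎ (c ∈ ys)
∈-consEach⁻ x []       p           = inj₂ p
∈-consEach⁻ x (d ∷ cs) (here refl) = inj₁ (d , refl , here refl)
∈-consEach⁻ x (d ∷ cs) (there p) with ∈-consEach⁻ x cs p
... | inj₁ (e , q , r) = inj₁ (e , q , there r)
... | inj₂ q           = inj₂ q

∈-consAll⁺ : ∀ {x : A} {xs} {c : Vec A l} {cs} → x ∈ xs → c ∈ cs → (x ∷ c) ∈ consAll xs cs
∈-consAll⁺ (here refl) q = ∈-consEach⁺ˡ q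
∈-consAll⁺ {xs = y ∷ _} {cs = cs} (there p) q = ∈-consEach⁺ʳ y cs (∈-consAll⁺ p q)

∈-consAll⁻ : ∀ (xs : List A) {x} {c : Vec A l} {cs} → (x ∷ c) ∈ consAll xs cs → (x ∈ xs) × (c ∈ cs)
∈-consAll⁻ (y ∷ xs) {cs = cs} p with ∈-consEach⁻ y cs p
... | inj₁ (_ , refl , q) = here refl , q
... | inj₂ q with ∈-consAll⁻ xs q
...   | r , s = there r , s

∈-choices⁺ : ∀ {c : Vec A l} (xss : Vec (List A) l) → (∀ u → lookup c u ∈ lookup xss u) → c ∈ choices xss
∈-choices⁺ {c = []}    []         h = here refl
∈-choices⁺ {c = x ∷ c} (xs ∷ xss) h = ∈-consAll⁺ (h zero) (∈-choices⁺ xss (h ∘ suc))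

∈-choices⁻ : ∀ {c : Vec A l} (xss : Vec (List A) l) → c ∈ choices xss → ∀ u → lookup c u ∈ lookup xss u
∈-choices⁻ {c = x ∷ c} (xs ∷ xss) p zero    = proj₁ (∈-consAll⁻ xs p)
∈-choices⁻ {c = x ∷ c} (xs ∷ xss) p (suc u) = ∈-choices⁻ xss (proj₂ (∈-consAll⁻ xs p)) u

length-consEach : ∀ (x : A) (cs : List (Vec A l)) ys → length (consEach x cs ys) ≡ length cs + length ys
length-consEach x []       ys = refl
length-consEach x (_ ∷ cs) ys = cong suc (length-consEach x cs ys)

length-consAll : ∀ (xs : List A) (cs : List (Vec A l)) → length (consAll xs cs) ≡ length xs * length cs
length-consAll []       cs = refl
length-consAll (x ∷ xs) cs = trans (length-consEach x cs _) (cong (length cs +_) (length-consAll xs cs))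

length-choices : ∀ (b : ℕ) (U : Fin l → Bool) (xss : Vec (List A) l) →
                 (∀ u → length (lookup xss u) ≤ (if U u then b else 1)) → length (choices xss) ≤ b ^ countF U
length-choices b U []         h = ≤-refl
length-choices b U (xs ∷ xss) h rewrite length-consAll xs (choices xss) with U zero | h zero
... | true  | h₀ = *-mono-≤ h₀ (length-choices b (U ∘ suc) xss (h ∘ suc))
... | false | h₀ = ≤-trans (*-mono-≤ h₀ (length-choices b (U ∘ suc) xss (h ∘ suc))) (≤-reflexive (*-identityˡ _))

eachStep : Tm true 6
eachStep = cons (cons (var #3) (var #0)) (selfʳ (var #2))

eachTm : Tm false 3
eachTm = rec (var #1) (var #2) (var #0) eachStep

allStep : Tm true 5
allStep = call eachTm (var #0 ∷ var #4 ∷ selfʳ nil ∷ [])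

allTm : Tm false 2
allTm = rec (var #0) nil nil allStep

choicesStep : Tm true (3 + l)
choicesStep = call allTm (var #0 ∷ selfʳ nil ∷ [])

choicesTm : Tm false 1
choicesTm = rec (var #0) nil (cons nil nil) choicesStep

module _ {A : Set} (f : A → Data) where

  private
    ⌜_⌝ : List (Vec A l) → Data
    ⌜_⌝ = encodeList (encodeVec f)

  each-ok : ∀ {ρ : Vec Data 2} x (cs : List (Vec A l)) ys →
            recV (var #0) eachStep (f x ∷ ρ) ⌜ cs ⌝ ⌜ ys ⌝ ≡ ⌜ consEach x cs ys ⌝
  each-ok x []       ys = refl
  each-ok {ρ = ρ} x (c ∷ cs) ys = cong (cons _) (each-ok {ρ = ρ} x cs ys)

  all-ok : ∀ {d} xs (cs : List (Vec A l)) {p} →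
           recV nil allStep (d ∷ ⌜ cs ⌝ ∷ []) (encodeList f xs) p ≡ ⌜ consAll xs cs ⌝
  all-ok []       cs = refl
  all-ok (x ∷ xs) cs = trans (cong (λ z → recV (var #0) eachStep (f x ∷ ⌜ cs ⌝ ∷ z ∷ []) ⌜ cs ⌝ z) (all-ok xs
        cs)) (each-ok x cs _)

  choices-ok : ∀ {ρ : Vec Data l} {m} (xss : Vec (List A) m) {p} →
               recV (cons nil nil) choicesStep ρ (encodeVec (encodeList f) xss) p ≡ ⌜ choices xss ⌝
  choices-ok []         = refl
  choices-ok (xs ∷ xss) = trans (cong (λ z → recV nil allStep (encodeList f xs ∷ z ∷ []) (encodeList f xs) nil)
        (choices-ok xss)) (all-ok xs (choices xss))

  each-cost : ∀ {ρ : Vec Data 2} x (cs : List (Vec A l)) p →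
              recC (var #0) eachStep (f x ∷ ρ) ⌜ cs ⌝ p ≤ 5 + length cs * 30
  each-cost x []       p = ≤-refl
  each-cost {ρ = ρ} x (c ∷ cs) p = begin
    _                          ≡⟨ eq z ⟩
    26 + z                     ≤⟨ +-mono-≤ {26} {30} (≤-by 4 refl) (each-cost {ρ = ρ} x cs p) ⟩
    30 + (5 + length cs * 30)  ≡⟨ eq′ (length cs * 30) ⟩
    5 + (30 + length cs * 30)  ∎
    where
    open ≤-Reasoning
    z = recC (var #0) eachStep (f x ∷ ρ) ⌜ cs ⌝ p
    eq : ∀ z → 7 + (1 + (10 + (1 + ((1 + (4 + (1 + z))) + 1)))) ≡ 26 + z
    eq = solve-∀
    eq′ : ∀ x → 30 + (5 + x) ≡ 5 + (30 + x)
    eq′ = solve-∀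

  all-cost : ∀ {d} xs (cs : List (Vec A l)) {p} →
             recC nil allStep (d ∷ ⌜ cs ⌝ ∷ []) (encodeList f xs) p ≤ 4 + length xs * (60 + length cs * 30)
  all-cost []       cs = ≤-refl
  all-cost {d = d} (x ∷ xs) cs = begin
    _                  ≡⟨ eq z e ⟩
    (39 + e) + z       ≤⟨ +-mono-≤ (+-monoʳ-≤ 39 (each-cost {ρ = ⌜ cs ⌝ ∷ y ∷ []} x cs y)) (all-cost {d = d} xs cs) ⟩
    _                  ≤⟨ ≤-by 16 (eq′ (length cs * 30) (length xs * (60 + length cs * 30))) ⟩
    _                  ∎
    where
    open ≤-Reasoning
    y = recV nil allStep (d ∷ ⌜ cs ⌝ ∷ []) (encodeList f xs) nil
    z = recC nil allStep (d ∷ ⌜ cs ⌝ ∷ []) (encodeList f xs) nil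
    e = recC (var #0) eachStep (f x ∷ ⌜ cs ⌝ ∷ y ∷ []) ⌜ cs ⌝ y
    eq : ∀ z e → 7 + (1 + ((1 + ((1 + ((1 + (1 + (1 + ((1 + (1 + (1 + z))) + 1)))) + (1 + (6 + 1)))) + (1 + (2
          + 1)))) +
           (1 + (3 + (1 + (4 + (1 + e))))))) ≡ (39 + e) + z
    eq = solve-∀
    eq′ : ∀ x y → (39 + (5 + x)) + (4 + y) + 16 ≡ 4 + ((60 + x) + y)
    eq′ = solve-∀

  -- Since no option list is empty, the number of partial labels never decreases as coordinates are
  -- added, so `W` bounds every intermediate list and each coordinate costs O(W).
  choices-cost : ∀ {ρ : Vec Data l} {m} W (xss : Vec (List A) m) {p} →
                 (∀ u → 1 ≤ length (lookup xss u)) → (∀ u → length (lookup xss u) ≤ 32) →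
                 length (choices xss) ≤ W →
                 recC (cons nil nil) choicesStep ρ (encodeVec (encodeList f) xss) p ≤ 8 + m * (3000 * W)
  choices-cost W []         ne le len = ≤-refl
  choices-cost {ρ = ρ} {suc m} W (xs ∷ xss) ne le len = begin
    _ ≡⟨ cong (λ y → 7 + (1 + ((1 + ((1 + (1 + (1 + ((1 + (1 + (1 + z))) + 1)))) + (1 + (2 + 1)))) +
                 (1 + (2 + (1 + (1 + (1 + recC nil allStep (encodeList f xs ∷ y ∷ []) (encodeList f xs)
                       nil)))))))) (choices-ok xss) ⟩
    _ ≡⟨ eq z e ⟩
    (26 + e) + z ≤⟨ +-mono-≤ (+-monoʳ-≤ 26 (≤-trans (all-cost xs (choices xss)) (+-monoʳ-≤ 4 (*-mono-≤ (le
          zero) (+-monoʳ-≤ 60 (*-monoˡ-≤ 30 len′))))))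
                       (choices-cost W xss (ne ∘ suc) (le ∘ suc) len′) ⟩
    (26 + (4 + 32 * (60 + W * 30))) + (8 + m * (3000 * W)) ≤⟨ +-monoˡ-≤ _ (≤-trans (≤-reflexive (eq₁ W))
          (≤-trans (+-monoˡ-≤ (960 * W) (*-monoʳ-≤ 1950 W≥1)) (≤-by (90 * W) (eq₂ W)))) ⟩
    3000 * W + (8 + m * (3000 * W)) ≡⟨ eq₃ (3000 * W) (m * (3000 * W)) ⟩
    8 + (3000 * W + m * (3000 * W)) ∎
    where
    open ≤-Reasoning
    z = recC (cons nil nil) choicesStep ρ (encodeVec (encodeList f) xss) nil
    e = recC nil allStep (encodeList f xs ∷ ⌜ choices xss ⌝ ∷ []) (encodeList f xs) nil
    eq : ∀ z e → 7 + (1 + ((1 + ((1 + (1 + (1 + ((1 + (1 + (1 + z))) + 1)))) + (1 + (2 + 1)))) +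
           (1 + (2 + (1 + (1 + (1 + e))))))) ≡ (26 + e) + z
    eq = solve-∀
    eq₁ : ∀ W → 26 + (4 + 32 * (60 + W * 30)) ≡ 1950 * 1 + 960 * W
    eq₁ = solve-∀
    eq₂ : ∀ W → 1950 * W + 960 * W + 90 * W ≡ 3000 * W
    eq₂ = solve-∀
    eq₃ : ∀ x y → x + (8 + y) ≡ 8 + (x + y)
    eq₃ = solve-∀
    len′ : length (choices xss) ≤ W
    len′ = ≤-trans (≤-trans (≤-reflexive (sym (*-identityˡ _))) (*-monoˡ-≤ (length (choices xss)) (ne zero)))
                   (≤-trans (≤-reflexive (sym (length-consAll xs (choices xss)))) len)
    some : ∀ {k} (yss : Vec (List A) k) → (∀ u → 1 ≤ length (lookup yss u)) → 1 ≤ length (choices yss)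
    some []         h = ≤-refl
    some (ys ∷ yss) h = ≤-trans (*-mono-≤ (h zero) (some yss (h ∘ suc))) (≤-reflexive (sym (length-consAll ys
          (choices yss))))
    W≥1 : 1 ≤ W
    W≥1 = ≤-trans (some xss (ne ∘ suc)) len′

-- Tables

cons-injective : ∀ {a b c d} → Data.cons a b ≡ cons c d → a ≡ c × b ≡ d
cons-injective refl = refl , refl

encodeVec-injective : ∀ {A : Set} {f : A → Data} → (∀ {x y} → f x ≡ f y → x ≡ y) →
                      (xs ys : Vec A l) → encodeVec f xs ≡ encodeVec f ys → xs ≡ ys
encodeVec-injective inj []       []       h = refl
encodeVec-injective inj (x ∷ xs) (y ∷ ys) h =
  cong₂ _∷_ (inj (proj₁ (cons-injective h))) (encodeVec-injective inj xs ys (proj₂ (cons-injective h)))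

encodeBool-injective : ∀ {x y} → encodeBool x ≡ encodeBool y → x ≡ y
encodeBool-injective {true}  {true}  h = refl
encodeBool-injective {false} {false} h = refl

encodeKey : Key n → Data
encodeKey = enc (vec (bits 6))

encodeKey-injective : (κ λ′ : Key n) → encodeKey κ ≡ encodeKey λ′ → κ ≡ λ′
encodeKey-injective = encodeVec-injective (encodeVec-injective encodeBool-injective _ _)

some : ℕ → Data
some m = cons nil (encodeℕ m)

at : Data → Key n → Data
at d κ = getD (encodeKey κ) d

some≢nil : ∀ {m} → some m ≡ nil → ⊥
some≢nil ()

some-injective : ∀ {m m′} → some m ≡ some m′ → m ≡ m′
some-injective h = encodeℕ-injective _ _ (proj₂ (cons-injective h))
  where
  encodeℕ-injective : ∀ i j → encodeℕ i ≡ encodeℕ j → i ≡ j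
  encodeℕ-injective zero    zero    h = refl
  encodeℕ-injective (suc i) (suc j) h = cong suc (encodeℕ-injective i j (proj₂ (cons-injective h)))

Refines : ℕ → Data → Data → Set
Refines n d e = ∀ {κ : Key n} {m} → at d κ ≡ some m → ∃[ m′ ] (m′ ≤ m × at e κ ≡ some m′)

newEntry : ℕ → ℕ → Data → Data → Data → Data
newEntry n count l r old = cons nil (if isCons old then minD n total (tlD old) else total)
  where total = plusD n (plusD n (encodeℕ count) (tlD l)) (tlD r)

writeEntry : Bool → ℕ → Key n → Data → Data → Data → Data
writeEntry {n} ok count κ l r tbl =
  if ok ∧ (isCons l ∧ isCons r) then setD (encodeKey κ) (newEntry n count l r (at tbl κ)) tbl else tbl

-- The effect of a single label on the table, with the traces of the children and of the node
-- abstracted to the predicates `QL`, `QR` and `Q`.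
module Entries {n} (ok : Bool) (count : ℕ) (κT : Key n) (l r : Data) (QL QR : ℕ → Set) (Q : Key n → ℕ → Set)
  (l-ok : (l ≡ nil) ⊎ ∃[ m ] (l ≡ some m × QL m)) (r-ok : (r ≡ nil) ⊎ ∃[ m ] (r ≡ some m × QR m))
  (q : ∀ {m₁ m₂} → ! ok → QL m₁ → QR m₂ → Q κT (((count + m₁) ⊓ n + m₂) ⊓ n)) where

  total : ℕ → ℕ → ℕ
  total m₁ m₂ = ((count + m₁) ⊓ n + m₂) ⊓ n

  upd : Data → Data
  upd = writeEntry ok count κT l r

  Sound : Data → Set
  Sound d = ∀ κ → (at d κ ≡ nil) ⊎ (∃[ m ] (at d κ ≡ some m × Q κ m))

  sum-ok : ∀ m₁ m₂ → plusD n (plusD n (encodeℕ count) (encodeℕ m₁)) (encodeℕ m₂) ≡ encodeℕ (total m₁ m₂)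
  sum-ok m₁ m₂ = trans (cong (λ x → plusD n x (encodeℕ m₂)) (plusD-encode n count m₁)) (plusD-encode n _ m₂)

  new-nil : ∀ m₁ m₂ {old} → old ≡ nil → newEntry n count (some m₁) (some m₂) old ≡ some (total m₁ m₂)
  new-nil m₁ m₂ refl = cong (cons nil) (sum-ok m₁ m₂)

  new-some : ∀ m₁ m₂ {old m} → old ≡ some m → newEntry n count (some m₁) (some m₂) old ≡ some (total m₁ m₂ ⊓ m)
  new-some m₁ m₂ {m = m} refl = cong (cons nil)
    (trans (cong (λ x → minD n x (encodeℕ m)) (sum-ok m₁ m₂))
    (trans (minD-encode n (total m₁ m₂) m)
      -- `minD` truncates at `n` too, which is harmless because the total is truncated already.
      (cong encodeℕ (m≤n⇒m⊓n≡m (≤-trans (m⊓n≤m _ m) (m⊓n≤n _ n))))))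

  data View (tbl : Data) : Set where
    skip  : upd tbl ≡ tbl → ¬ ((! ok) × ∃[ m₁ ] ((l ≡ some m₁) × ∃[ m₂ ] (r ≡ some m₂))) → View tbl
    write : ∀ {m₁ m₂} → l ≡ some m₁ → r ≡ some m₂ → Q κT (total m₁ m₂) →
            upd tbl ≡ setD (encodeKey κT) (newEntry n count (some m₁) (some m₂) (at tbl κT)) tbl → View tbl

  view : ∀ tbl → View tbl
  view tbl = go (!? ok) l-ok r-ok
    where
    go : Dec (! ok) → (l ≡ nil) ⊎ ∃[ m ] (l ≡ some m × QL m) → (r ≡ nil) ⊎ ∃[ m ] (r ≡ some m × QR m) → View tbl
    go (no ¬ok) _ _ = skip (cong (λ b → writeEntry b count κT l r tbl) (¬!⇒false ¬ok)) λ p → ¬ok (proj₁ p)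
    go (yes k) (inj₁ l≡) _ = skip (cong₂ (λ b x → writeEntry b count κT x r tbl) k l≡)
      λ { (_ , _ , e , _) → some≢nil (trans (sym e) l≡) }
    go (yes k) (inj₂ (m₁ , l≡ , _)) (inj₁ r≡) =
      skip (trans (cong₂ (λ b x → writeEntry b count κT x r tbl) k l≡) (cong (λ x → writeEntry true count κT
            (some m₁) x tbl) r≡))
      λ { (_ , _ , _ , _ , e) → some≢nil (trans (sym e) r≡) }
    go (yes k) (inj₂ (m₁ , l≡ , p₁)) (inj₂ (m₂ , r≡ , p₂)) = write l≡ r≡ (q k p₁ p₂)
      (trans (cong₂ (λ b x → writeEntry b count κT x r tbl) k l≡) (cong (λ x → writeEntry true count κT (some
            m₁) x tbl) r≡))

  upd-sound : ∀ {tbl} → Sound tbl → Sound (upd tbl)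
  upd-sound {tbl} s κ with view tbl
  ... | skip eq _ rewrite eq = s κ
  ... | write {m₁} {m₂} l≡ r≡ p eq rewrite eq with ≟D (encodeKey κ) (encodeKey κT)
  ...   | no ≢ rewrite get-set-≢ (encodeKey κT) (encodeKey κ) (newEntry n count (some m₁) (some m₂) (at tbl
        κT)) tbl ≢ = s κ
  ...   | yes ≡k with encodeKey-injective κ κT ≡k
  ...     | refl rewrite get-set (encodeKey κ) (newEntry n count (some m₁) (some m₂) (at tbl κT)) tbl with s κT
  ...       | inj₁ o≡ = inj₂ (_ , new-nil m₁ m₂ o≡ , p)
  ...       | inj₂ (m , o≡ , p′) = inj₂ (_ , new-some m₁ m₂ o≡ , pick (⊓-sel (total m₁ m₂) m))
    where
    pick : (total m₁ m₂ ⊓ m ≡ total m₁ m₂) ⊎ (total m₁ m₂ ⊓ m ≡ m) → Q κT (total m₁ m₂ ⊓ m)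
    pick (inj₁ e) = subst (Q κT) (sym e) p
    pick (inj₂ e) = subst (Q κT) (sym e) p′

  upd-mono : ∀ {tbl} → Refines n tbl (upd tbl)
  upd-mono {tbl} {κ} {m} h with view tbl
  ... | skip eq _ rewrite eq = m , ≤-refl , h
  ... | write {m₁} {m₂} l≡ r≡ p eq rewrite eq with ≟D (encodeKey κ) (encodeKey κT)
  ...   | no ≢ rewrite get-set-≢ (encodeKey κT) (encodeKey κ) (newEntry n count (some m₁) (some m₂) (at tbl
        κT)) tbl ≢ = m , ≤-refl , h
  ...   | yes ≡k with encodeKey-injective κ κT ≡k
  ...     | refl rewrite get-set (encodeKey κ) (newEntry n count (some m₁) (some m₂) (at tbl κT)) tbl =
    _ , m⊓n≤n (total m₁ m₂) m , new-some m₁ m₂ h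

  upd-adds : ∀ {tbl} → Sound tbl → ∀ {m₁ m₂} → ! ok → l ≡ some m₁ → r ≡ some m₂ →
             ∃[ m ] (m ≤ total m₁ m₂ × at (upd tbl) κT ≡ some m)
  upd-adds {tbl} s {m₁} {m₂} k l≡ r≡ with view tbl
  ... | skip _ ¬p = ⊥-elim (¬p (k , _ , l≡ , _ , r≡))
  ... | write {m₁′} {m₂′} l≡′ r≡′ _ eq rewrite eq
      | some-injective (trans (sym l≡) l≡′) | some-injective (trans (sym r≡) r≡′)
      | get-set (encodeKey κT) (newEntry n count (some m₁′) (some m₂′) (at tbl κT)) tbl with s κT
  ...   | inj₁ o≡ = _ , ≤-refl , new-nil m₁′ m₂′ o≡
  ...   | inj₂ (m , o≡ , _) = _ , m⊓n≤m (total m₁′ m₂′) m , new-some m₁′ m₂′ o≡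

module DP {n} (G : Vec (Vec Bool n) n) (t : Vec ℕ n) where
  open Reachability G t public
  open Sem G t reachMatrices public
  open System signature public

  options : Subset n → Subset n → Subset n → Fin n → List (Vec Bool 9)
  options X B C u = labelsFor (lookup X u ∨ (lookup B u ∨ lookup C u)) (iso u) (o u)

  open Traces options public

  opaque
    update : Subset n → Subset n → Data → Subset n → Data → Label n → Data → Data
    update X B tB C tC c tbl = eval updateᵉ (tbl ∷ tB ∷ tC ∷ G ∷ t ∷ reachMatrices ∷ X ∷ B ∷ C ∷ c ∷ [])

  opaque
    unfolding update
    update-eval : ∀ X B tB C tC c tbl → update X B tB C tC c tbl ≡
      eval updateᵉ (tbl ∷ tB ∷ tC ∷ G ∷ t ∷ reachMatrices ∷ X ∷ B ∷ C ∷ c ∷ [])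
    update-eval X B tB C tC c tbl = refl

    update-write : ∀ X B tB C tC c tbl → let open Bags X B C c in
      update X B tB C tC c tbl ≡ writeEntry check (countF forgotten) keyT (at tB keyL) (at tC keyR) tbl
    update-write X B tB C tC c tbl = refl

  updates : Subset n → Subset n → Data → Subset n → Data → List (Label n) → Data → Data
  updates X B tB C tC []       tbl = tbl
  updates X B tB C tC (c ∷ cs) tbl = updates X B tB C tC cs (update X B tB C tC c tbl)

  optionLists : Subset n → Subset n → Subset n → Vec (List (Vec Bool 9)) n
  optionLists X B C = tabulate (options X B C)

  combine : Subset n → Subset n → Data → Subset n → Data → Data
  combine X B tB C tC = updates X B tB C tC (choices (optionLists X B C)) nil

  leafTable : Data
  leafTable = setD (encodeKey {n} emptyKey) (some 0) nil

  solve : BT n → Data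
  solve leaf         = leafTable
  solve (node X L R) = combine X (topBag L) (solve L) (topBag R) (solve R)

  Sound Complete : BT n → Data → Set
  Sound T d = ∀ κ → (at d κ ≡ nil) ⊎ (∃[ m ] (at d κ ≡ some m × Trace T κ m))
  Complete T d = ∀ {κ m} → Trace T κ m → ∃[ m′ ] (m′ ≤ m × at d κ ≡ some m′)

  module AtNode (X : Subset n) (L R : BT n) (tL tR : Data) (sL : Sound L tL) (sR : Sound R tR) where

    private
      B C : Subset n
      B = topBag L
      C = topBag R

    module _ {c : Label n} (al : Allowed (options X B C) c) where
      open Bags X B C c using (check; forgotten; keyT; keyL; keyR)
      private
        module E = Entries check (countF forgotten) keyT (at tL keyL) (at tR keyR) (Trace L keyL) (Trace R
              keyR) (Trace (node X L R))
          (sL keyL) (sR keyR) (node c al)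
        eq : ∀ tbl → update X B tL C tR c tbl ≡ E.upd tbl
        eq = update-write X B tL C tR c

      upd-sound : ∀ {tbl} → Sound (node X L R) tbl → Sound (node X L R) (update X B tL C tR c tbl)
      upd-sound {tbl} s = subst (Sound (node X L R)) (sym (eq tbl)) (E.upd-sound {tbl} s)

      upd-mono : ∀ {tbl} → Refines n tbl (update X B tL C tR c tbl)
      upd-mono {tbl} {κ} = subst (λ d → ∀ {m} → at tbl κ ≡ some m → ∃[ m′ ] (m′ ≤ m × at d κ ≡ some m′)) (sym
            (eq tbl)) (E.upd-mono {tbl} {κ})

      upd-adds : ∀ {tbl} → Sound (node X L R) tbl → ∀ {m₁ m₂} → ! check → at tL keyL ≡ some m₁ → at tR keyR ≡
            some m₂ →
                 ∃[ m ] (m ≤ E.total m₁ m₂ × at (update X B tL C tR c tbl) keyT ≡ some m)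
      upd-adds {tbl} s ch l≡ r≡ = subst (λ d → ∃[ m ] (m ≤ _ × at d keyT ≡ some m)) (sym (eq tbl)) (E.upd-adds
            {tbl} s ch l≡ r≡)

    upds : List (Label n) → Data → Data
    upds = updates X (topBag L) tL (topBag R) tR

    upds-sound : ∀ cs → (∀ {c} → c ∈ cs → Allowed (options X (topBag L) (topBag R)) c) → ∀ {tbl} →
                 Sound (node X L R) tbl → Sound (node X L R) (upds cs tbl)
    upds-sound []       al s = s
    upds-sound (c ∷ cs) al {tbl} s = upds-sound cs (al ∘ there) (upd-sound (al (here refl)) {tbl} s)

    upds-mono : ∀ cs → (∀ {c} → c ∈ cs → Allowed (options X B C) c) → ∀ {tbl} → Refines n tbl (upds cs tbl)
    upds-mono []       al h = _ , ≤-refl , h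
    upds-mono (c ∷ cs) al {tbl} {κ} h with upd-mono (al (here refl)) {tbl} {κ} h
    ... | m , le , q with upds-mono cs (al ∘ there) {update X B tL C tR c tbl} {κ} q
    ...   | m′ , le′ , r = m′ , ≤-trans le′ le , r

    upds-adds : ∀ cs → (∀ {c} → c ∈ cs → Allowed (options X (topBag L) (topBag R)) c) → ∀ {tbl} → Sound (node X
          L R) tbl →
                ∀ {c} → c ∈ cs → ! Bags.check X (topBag L) (topBag R) c → ∀ {m₁ m₂} →
                at tL (Bags.keyL X (topBag L) (topBag R) c) ≡ some m₁ → at tR (Bags.keyR X (topBag L) (topBag
                      R) c) ≡ some m₂ →
                ∃[ m ] (m ≤ (((countF (Bags.forgotten X (topBag L) (topBag R) c) + m₁) ⊓ n) + m₂) ⊓ n × at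
                      (upds cs tbl) (Bags.keyT X (topBag L) (topBag R) c) ≡ some m)
    upds-adds (c ∷ cs) al {tbl} s {.c} (here refl) ch l≡ r≡ with upd-adds {c} (al (here refl)) {tbl} s ch l≡ r≡
    ... | m , le , q with upds-mono cs (al ∘ there) {update X B tL C tR c tbl} {Bags.keyT X (topBag L) (topBag R) c} q
    ...   | m′ , le′ , r = m′ , ≤-trans le′ le , r
    upds-adds (c ∷ cs) al {tbl} s {c₀} (there p) ch l≡ r≡ =
      upds-adds cs (al ∘ there) (upd-sound (al (here refl)) {tbl} s) {c₀} p ch l≡ r≡

  getD-nil : ∀ k → getD k nil ≡ nil
  getD-nil nil        = refl
  getD-nil (cons a b) = trans (cong (getD b) (getD-nil a)) (getD-nil b)

  allowed⁻ : ∀ X B C {c} → c ∈ choices (optionLists X B C) → Allowed (options X B C) c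
  allowed⁻ X B C {c} p u = subst (lookup c u ∈_) (lookup∘tabulate (options X B C) u) (∈-choices⁻ (optionLists X
        B C) p u)

  allowed⁺ : ∀ X B C {c} → Allowed (options X B C) c → c ∈ choices (optionLists X B C)
  allowed⁺ X B C {c} h = ∈-choices⁺ (optionLists X B C) λ u → subst (lookup c u ∈_) (sym (lookup∘tabulate
        (options X B C) u)) (h u)

  nil-sound : ∀ T → Sound T nil
  nil-sound T κ = inj₁ (getD-nil (encodeKey κ))

  solve-sound : ∀ T → Sound T (solve T)
  solve-sound leaf κ with ≟D (encodeKey κ) (encodeKey {n} emptyKey)
  ... | no ≢ = inj₁ (trans (get-set-≢ (encodeKey {n} emptyKey) (encodeKey κ) (some 0) nil ≢) (getD-nil (encodeKey κ)))
  ... | yes ≡k with encodeKey-injective κ emptyKey ≡k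
  ...   | refl = inj₂ (0 , get-set (encodeKey κ) (some 0) nil , leaf)
  solve-sound (node X L R) =
    AtNode.upds-sound X L R (solve L) (solve R) (solve-sound L) (solve-sound R) _
      (allowed⁻ X (topBag L) (topBag R)) (nil-sound (node X L R))

  solve-complete : ∀ T → Complete T (solve T)
  solve-complete leaf leaf = 0 , ≤-refl , get-set (encodeKey {n} emptyKey) (some 0) nil
  solve-complete (node X L R) (node c al ch tr₁ tr₂) with solve-complete L tr₁ | solve-complete R tr₂
  ... | m₁ , le₁ , l≡ | m₂ , le₂ , r≡
    with AtNode.upds-adds X L R (solve L) (solve R) (solve-sound L) (solve-sound R) (choices (optionLists X
          (topBag L) (topBag R)))
           (allowed⁻ X (topBag L) (topBag R)) {nil} (nil-sound (node X L R)) {c} (allowed⁺ X (topBag L) (topBag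
                 R) al) ch l≡ r≡
  -- The truncated sum is monotone, so better entries of the children can only improve the entry of
  -- the node.
  ...   | m , le , q = m , ≤-trans le (⊓-monoˡ-≤ n (+-mono-≤ (⊓-monoˡ-≤ n (+-monoʳ-≤ _ le₁)) le₂)) , q

-- The program and its running time

foldStep : Tm true 13
foldStep = selfʳ (call (toTm updateᵉ)
  (var #3 ∷ var #2 ∷ var #9 ∷ var (suc (suc #9)) ∷ var #4 ∷ var #5 ∷ var #6 ∷ var #7 ∷ var #8 ∷ var (suc #9) ∷
        var #0 ∷ []))

foldTm : Tm false 10
foldTm = rec (var #9) nil (var #0) foldStep

opaque
  combineTm : Tm false 8
  combineTm = call foldTm
    (var #0 ∷ var #1 ∷ var #2 ∷ call (toTm matricesᵉ) (var #0 ∷ var #1 ∷ var #2 ∷ []) ∷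
     var #3 ∷ var #4 ∷ var #5 ∷ var #6 ∷ var #7 ∷
     call choicesTm (call (toTm optionsᵉ) (var #0 ∷ var #1 ∷ var #2 ∷ var #3 ∷ var #4 ∷ var #6 ∷ []) ∷ []) ∷ [])

-- The bag and the table of `leaf`, supplied wherever a node lacks a child.
emptyChildᵉ : Ex [] (set ⊗ raw)
emptyChildᵉ = prim pairP (tab falseᵉ ∷
  prim setP (emptyKeyᵉ ∷ prim (constP raw (some 0) (some 0) refl) [] ∷ prim (constP raw nil nil refl) [] ∷ []) ∷ [])

firstTm secondTm : Tm false 2
firstTm  = match (var #1) (call (toTm emptyChildᵉ) (var #0 ∷ [])) (var #0)
secondTm = match (var #1) (call (toTm emptyChildᵉ) (var #0 ∷ []))
  (match (var #1) (call (toTm emptyChildᵉ) (var #2 ∷ [])) (var #0))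

opaque
  joinTm : Tm false 6
  joinTm = cons (var #3) (call combineTm
    (var #0 ∷ var #1 ∷ var #2 ∷ var #3 ∷ hd (var #4) ∷ tl (var #4) ∷ hd (var #5) ∷ tl (var #5) ∷ []))

nodeTm : Tm false 5
nodeTm = call joinTm
  (var #0 ∷ var #1 ∷ var #2 ∷ var #3 ∷ call firstTm (var #0 ∷ var #4 ∷ []) ∷ call secondTm (var #0 ∷ var #4 ∷
        []) ∷ [])

-- The parameter of this loop tells whether the current cell encodes a tree
-- (nil) or a list of trees.
treeStep : Tm true 7
treeStep = match (var #2)
  (call nodeTm (var #3 ∷ var #4 ∷ var #5 ∷ var #0 ∷ selfʳ (cons nil nil) ∷ []))
  (cons (selfˡ nil) (selfʳ (cons nil nil)))

treeTm : Tm false 4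
treeTm = rec (var #3) nil nil treeStep

conv : ∀ {n} → BagTree n → BT n
conv (node₀ X)     = node X leaf leaf
conv (node₁ X T)   = node X (conv T) leaf
conv (node₂ X T U) = node X (conv T) (conv U)

-- Labels range over the union of a bag and the bags of its children, so this union has to be small,
-- not just each bag.
Width≤ : ∀ {n} → ℕ → BT n → Set
Width≤ m leaf         = ⊤
Width≤ m (node X L R) =
  (countF (λ u → lookup X u ∨ (lookup (topBag L) u ∨ lookup (topBag R) u)) ≤ m) × Width≤ m L × Width≤ m R

emptyChildBound combineBase : ℕ → ℕ
emptyChildBound = bnd emptyChildᵉ
combineBase n = 170 + (bnd matricesᵉ n + (bnd optionsᵉ n + (8 + 5)))

-- `W` bounds the number of labels. Each of them costs `n * 3000` for its enumeration, besides one
-- update; what remains is polynomial in n.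
combineBound : ℕ → ℕ → ℕ
combineBound W n = combineBase n + W * (n * 3000 + (131 + bnd updateᵉ n))

nodeBound : ℕ → ℕ → ℕ
nodeBound W n = 326 + (2 * emptyChildBound n + combineBound W n)

module Execution {n} (G : Vec (Vec Bool n) n) (t : Vec ℕ n) where
  open DP G t

  Gᵈ tᵈ : Data
  Gᵈ = enc matrix G
  tᵈ = enc (vec nat) t

  setᵈ : Subset n → Data
  setᵈ = enc set

  labelsᵈ : List (Label n) → Data
  labelsᵈ = encodeList (encodeVec (encodeVec encodeBool))

  R : Matrices
  R = reachMatrices

  module _ (X B : Subset n) (tB : Data) (C : Subset n) (tC : Data) where

    private
      env : Data → Vec Data 10
      env d = indices n ∷ Gᵈ ∷ tᵈ ∷ enc matrices R ∷ setᵈ X ∷ setᵈ B ∷ tB ∷ setᵈ C ∷ tC ∷ d ∷ []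

      args : Label n → Data → Env n (raw ∷ raw ∷ raw ∷ Bagsᵉ)
      args c tbl = tbl ∷ tB ∷ tC ∷ G ∷ t ∷ R ∷ X ∷ B ∷ C ∷ c ∷ []

    matrices-ok : ⟦ toTm matricesᵉ ⟧ (indices n ∷ Gᵈ ∷ tᵈ ∷ []) tt ≡ enc matrices R
    matrices-ok = trans (toTm-ok matricesᵉ (G ∷ t ∷ [])) (cong (enc matrices) reachMatrices-eval)

    fold-ok : ∀ {d} cs tbl → recV (var #0) foldStep (env d) (labelsᵈ cs) tbl ≡ updates X B tB C tC cs tbl
    fold-ok []       tbl = refl
    fold-ok {d} (c ∷ cs) tbl = trans
      (cong (recV (var #0) foldStep (env d) (labelsᵈ cs))
        (trans (toTm-ok updateᵉ (args c tbl)) (sym (update-eval X B tB C tC c tbl))))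
      (fold-ok {d} cs _)

    fold-cost : ∀ {d} cs tbl → recC (var #0) foldStep (env d) (labelsᵈ cs) tbl ≤ 5 + length cs * (131 + bnd updateᵉ n)
    fold-cost []       tbl = ≤-refl
    fold-cost {d} (c ∷ cs) tbl = begin
      _                 ≡⟨ eq u zs ⟩
      (131 + u) + zs     ≤⟨ +-mono-≤ (+-monoʳ-≤ 131 (bnd-ok updateᵉ (args c tbl))) (fold-cost {d} cs y) ⟩
      (131 + b) + (5 + length cs * (131 + b)) ≡⟨ eq′ (131 + b) (length cs * (131 + b)) ⟩
      5 + ((131 + b) + length cs * (131 + b)) ∎
      where
      open ≤-Reasoning
      b = bnd updateᵉ n
      u = cost (toTm updateᵉ) (indices n ∷ encs (args c tbl)) tt tt
      y = ⟦ toTm updateᵉ ⟧ (indices n ∷ encs (args c tbl)) tt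
      zs = recC (var #0) foldStep (env d) (labelsᵈ cs) y
      eq : ∀ u z → 7 + (1 + ((1 + ((1 + ((1 + ((1 + ((1 + ((1 + ((1 + ((1 + ((1 + ((1 + ((1 + ((1 + (1 + (1 +
            (2 + 1)))) + (1 + (12 + 1)))) + (1 + (10 + 1)))) + (1 + (9 + 1)))) + (1 + (8 + 1)))) + (1 + (7 +
            1)))) + (1 + (6 + 1)))) + (1 + (13 + 1)))) + (1 + (11 + 1)))) + (1 + (4 + 1)))) + (1 + (5 + 1)))) +
            u)) + (1 + z))) ≡ (131 + u) + z
      eq = solve-∀
      eq′ : ∀ x y → x + (5 + y) ≡ 5 + (x + y)
      eq′ = solve-∀

    optionsᵈ : Data
    optionsᵈ = encodeVec encodeLabels (optionLists X B C)

    encodeVec-tabulate : ∀ {A : Set} {l} (f : A → Data) (g : Fin l → A) (h : Fin l → Data) → (∀ u → h u ≡ f (g u)) →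
                         encodeVec id (tabulate h) ≡ encodeVec f (tabulate g)
    encodeVec-tabulate {l = zero}  f g h e = refl
    encodeVec-tabulate {l = suc l} f g h e = cong₂ cons (e zero) (encodeVec-tabulate f (g ∘ suc) (h ∘ suc) (e ∘ suc))

    options-ok : ⟦ toTm optionsᵉ ⟧ (indices n ∷ Gᵈ ∷ tᵈ ∷ setᵈ X ∷ setᵈ B ∷ setᵈ C ∷ []) tt ≡ optionsᵈ
    options-ok = trans (toTm-ok optionsᵉ (G ∷ t ∷ X ∷ B ∷ C ∷ []))
      (encodeVec-tabulate encodeLabels (options X B C) _ λ u → push (lookup X u ∨ (lookup B u ∨ lookup C u))
            (iso u) (o u))
      where
      push : ∀ i j k → (if i then (if j then encodeLabels (validLabels true true)
                          else (if k then encodeLabels (validLabels true false) else encodeLabels (validLabels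
                                false false)))
                        else encodeLabels (noBits ∷ [])) ≡ encodeLabels (labelsFor i j k)
      push false _     _     = refl
      push true  true  _     = refl
      push true  false true  = refl
      push true  false false = refl

    private
      ρ : Vec Data 8
      ρ = indices n ∷ Gᵈ ∷ tᵈ ∷ setᵈ X ∷ setᵈ B ∷ tB ∷ setᵈ C ∷ tC ∷ []
      oᵈ = ⟦ toTm optionsᵉ ⟧ (indices n ∷ Gᵈ ∷ tᵈ ∷ setᵈ X ∷ setᵈ B ∷ setᵈ C ∷ []) tt
      cs = choices (optionLists X B C)
      csᵈ = recV (cons nil nil) choicesStep (oᵈ ∷ []) oᵈ nil
      Rᵈ = ⟦ toTm matricesᵉ ⟧ (indices n ∷ Gᵈ ∷ tᵈ ∷ []) tt

      choices≡ : csᵈ ≡ labelsᵈ cs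
      choices≡ = trans (cong (λ d → recV (cons nil nil) choicesStep (oᵈ ∷ []) d nil) options-ok)
                       (choices-ok (encodeVec encodeBool) {ρ = oᵈ ∷ []} (optionLists X B C))

    opaque
      unfolding combineTm

      combine-ok : ⟦ combineTm ⟧ ρ tt ≡ combine X B tB C tC
      combine-ok = trans
        (cong₂ (λ r d → recV (var #0) foldStep (indices n ∷ Gᵈ ∷ tᵈ ∷ r ∷ setᵈ X ∷ setᵈ B ∷ tB ∷ setᵈ C ∷ tC ∷
              csᵈ ∷ []) d nil)
               matrices-ok choices≡)
        (fold-ok {csᵈ} cs nil)

      combine-cost : ∀ W → length cs ≤ W → cost combineTm ρ tt tt ≤ combineBound W n
      combine-cost W le = begin
        _ ≡⟨ eq pm po rc rf ⟩
        170 + (pm + (po + (rc + rf))) ≤⟨ +-monoʳ-≤ 170 (+-mono-≤ (bnd-ok matricesᵉ (G ∷ t ∷ [])) (+-mono-≤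
              (bnd-ok optionsᵉ (G ∷ t ∷ X ∷ B ∷ C ∷ [])) (+-mono-≤ rc≤ rf≤))) ⟩
        170 + (bm + (bo + ((8 + n * (3000 * W)) + (5 + W * (131 + bu))))) ≡⟨ eq′ bm bo bu W n ⟩
        combineBound W n ∎
        where
        open ≤-Reasoning
        bm : ℕ
        bm = bnd matricesᵉ n
        bo : ℕ
        bo = bnd optionsᵉ n
        bu : ℕ
        bu = bnd updateᵉ n
        pm : ℕ
        pm = cost (toTm matricesᵉ) (indices n ∷ Gᵈ ∷ tᵈ ∷ []) tt tt
        po : ℕ
        po = cost (toTm optionsᵉ) (indices n ∷ Gᵈ ∷ tᵈ ∷ setᵈ X ∷ setᵈ B ∷ setᵈ C ∷ []) tt tt
        rc : ℕ
        rc = recC (cons nil nil) choicesStep (oᵈ ∷ []) oᵈ nil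
        rf : ℕ
        rf = recC (var #0) foldStep (indices n ∷ Gᵈ ∷ tᵈ ∷ Rᵈ ∷ setᵈ X ∷ setᵈ B ∷ tB ∷ setᵈ C ∷ tC ∷ csᵈ ∷ []) csᵈ nil
        len : ∀ u → length (lookup (optionLists X B C) u) ≤ (if lookup X u ∨ (lookup B u ∨ lookup C u) then 32 else 1)
        len u = subst (λ x → length x ≤ _) (sym (lookup∘tabulate (options X B C) u)) (labelsFor-length (lookup
              X u ∨ (lookup B u ∨ lookup C u)) (iso u) (o u))
        len32 : ∀ u → length (lookup (optionLists X B C) u) ≤ 32
        len32 u = ≤-trans (len u) (bool≤ (lookup X u ∨ (lookup B u ∨ lookup C u)))
          where
          bool≤ : ∀ b → (if b then 32 else 1) ≤ 32
          bool≤ true  = ≤-refl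
          bool≤ false = s≤s z≤n
        rc≤ : rc ≤ 8 + n * (3000 * W)
        rc≤ = subst (λ d → recC (cons nil nil) choicesStep (oᵈ ∷ []) d nil ≤ 8 + n * (3000 * W)) (sym options-ok)
          (choices-cost (encodeVec encodeBool) {ρ = oᵈ ∷ []} W (optionLists X B C)
            (λ u → subst (λ x → 1 ≤ length x) (sym (lookup∘tabulate (options X B C) u)) (labelsFor-nonempty
                  (lookup X u ∨ (lookup B u ∨ lookup C u)) (iso u) (o u)))
            len32 le)
        rf≤ : rf ≤ 5 + W * (131 + bu)
        rf≤ = subst₂ (λ r d → recC (var #0) foldStep (indices n ∷ Gᵈ ∷ tᵈ ∷ r ∷ setᵈ X ∷ setᵈ B ∷ tB ∷ setᵈ C ∷
              tC ∷ csᵈ ∷ []) d nil ≤ 5 + W * (131 + bu))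
          (sym matrices-ok) (sym choices≡)
          (≤-trans (fold-cost {csᵈ} cs nil) (+-monoʳ-≤ 5 (*-monoˡ-≤ (131 + bu) le)))
        eq : ∀ pm o rc rf → (1 + ((1 + ((1 + ((1 + ((1 + ((1 + ((1 + ((1 + ((1 + ((1 + ((1 + (1 + (1 + ((1 +
              ((1 + (1 + (1 + ((1 + ((1 + ((1 + ((1 + ((1 + ((1 + ((1 + (1 + (1 + (8 + 1)))) + (1 + (6 + 1))))
              + (1 + (5 + 1)))) + (1 + (4 + 1)))) + (1 + (3 + 1)))) + (1 + (2 + 1)))) + o)) + 1)))) + (1 + (2 +
              (1 + (1 + (1 + rc))))))) + 1)))) + (1 + (9 + 1)))) + (1 + (8 + 1)))) + (1 + (7 + 1)))) + (1 + (6
              + 1)))) + (1 + (5 + 1)))) + (1 + ((1 + ((1 + ((1 + ((1 + (1 + (1 + (4 + 1)))) + (1 + (3 + 1)))) +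
              (1 + (2 + 1)))) + pm)) + 1)))) + (1 + (4 + 1)))) + (1 + (3 + 1)))) + (1 + (2 + 1)))) + (1 + (11 +
              (1 + (1 + (1 + rf))))))) ≡ 170 + (pm + (o + (rc + rf)))
        eq = solve-∀
        eq′ : ∀ a b u W n → 170 + (a + (b + ((8 + n * (3000 * W)) + (5 + W * (131 + u))))) ≡
              (170 + (a + (b + (8 + 5)))) + W * (n * 3000 + (131 + u))
        eq′ = solve-∀

  length-choices≤ : ∀ m X B C → countF (λ u → lookup X u ∨ (lookup B u ∨ lookup C u)) ≤ m →
                    length (choices (optionLists X B C)) ≤ 32 ^ m
  length-choices≤ m X B C h = ≤-trans
    (length-choices 32 (λ u → lookup X u ∨ (lookup B u ∨ lookup C u)) (optionLists X B C) λ u →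
      subst (λ x → length x ≤ (if lookup X u ∨ (lookup B u ∨ lookup C u) then 32 else 1))
        (sym (lookup∘tabulate (options X B C) u)) (labelsFor-length (lookup X u ∨ (lookup B u ∨ lookup C u))
              (iso u) (o u)))
    (^-monoʳ-≤ 32 h)

  childᵈ : BT n → Data
  childᵈ T = cons (setᵈ (topBag T)) (solve T)

  emptyChild-ok : ⟦ toTm emptyChildᵉ ⟧ (indices n ∷ []) tt ≡ childᵈ leaf
  emptyChild-ok = toTm-ok {n = n} emptyChildᵉ []

  inputs : Data → Vec Data 4
  inputs d = indices n ∷ Gᵈ ∷ tᵈ ∷ d ∷ []

  opaque
    unfolding joinTm

    join-ok : ∀ X L R → ⟦ joinTm ⟧ (indices n ∷ Gᵈ ∷ tᵈ ∷ setᵈ X ∷ childᵈ L ∷ childᵈ R ∷ []) tt ≡ childᵈ (node X L R)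
    join-ok X L R = cong (cons (setᵈ X)) (combine-ok X (topBag L) (solve L) (topBag R) (solve R))

    join-cost : ∀ m X L R → countF (λ u → lookup X u ∨ (lookup (topBag L) u ∨ lookup (topBag R) u)) ≤ m →
      cost joinTm (indices n ∷ Gᵈ ∷ tᵈ ∷ setᵈ X ∷ childᵈ L ∷ childᵈ R ∷ []) tt tt ≤ 108 + combineBound (32 ^ m) n
    join-cost m X L R w = ≤-trans (≤-reflexive (eq c)) (+-monoʳ-≤ 108
      (combine-cost X (topBag L) (solve L) (topBag R) (solve R) (32 ^ m) (length-choices≤ m X (topBag L)
            (topBag R) w)))
      where
      c : ℕ
      c = cost combineTm (indices n ∷ Gᵈ ∷ tᵈ ∷ setᵈ X ∷ setᵈ (topBag L) ∷ solve L ∷ setᵈ (topBag R) ∷ solve R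
            ∷ []) tt tt
      eq : ∀ c → (1 + (5 + (1 + ((1 + ((1 + ((1 + ((1 + ((1 + ((1 + ((1 + ((1 + ((1 + (1 + (1 + ((1 + (7 + (1 +
            (4 + 3)))) + 1)))) + (1 + ((1 + (7 + (1 + (4 + 2)))) + 1)))) + (1 + ((1 + (6 + (1 + (4 + 3)))) +
            1)))) + (1 + ((1 + (6 + (1 + (4 + 2)))) + 1)))) + (1 + (5 + 1)))) + (1 + (4 + 1)))) + (1 + (3 +
            1)))) + (1 + (2 + 1)))) + c)) + 1)))) ≡ 108 + c
      eq = solve-∀

  emptyᵈ : Data
  emptyᵈ = ⟦ toTm emptyChildᵉ ⟧ (indices n ∷ []) tt

  treeᵈ : Data → BagTree n → Data
  treeᵈ d T = recV nil treeStep (inputs d) (encodeTree T) nil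

  joinᵈ : Subset n → Data → Data → Data
  joinᵈ X k k′ = ⟦ joinTm ⟧ (indices n ∷ Gᵈ ∷ tᵈ ∷ setᵈ X ∷ k ∷ k′ ∷ []) tt

  tree-ok : ∀ {d} T → treeᵈ d T ≡ childᵈ (conv T)
  tree-ok (node₀ X) = trans
    (cong (λ k → joinᵈ X k k) {emptyᵈ} {childᵈ leaf} emptyChild-ok) (join-ok X leaf leaf)
  tree-ok {d} (node₁ X T) = trans
    (cong₂ (joinᵈ X) {treeᵈ d T} {childᵈ (conv T)} {emptyᵈ} {childᵈ leaf} (tree-ok {d} T) emptyChild-ok)
          (join-ok X (conv T) leaf)
  tree-ok {d} (node₂ X T T′) = trans
    (cong₂ (joinᵈ X) {treeᵈ d T} {childᵈ (conv T)} {treeᵈ d T′} {childᵈ (conv T′)} (tree-ok {d} T) (tree-ok {d} T′))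
    (join-ok X (conv T) (conv T′))

  private
    e = cost (toTm emptyChildᵉ) (indices n ∷ []) tt tt

    e≤ : e ≤ emptyChildBound n
    e≤ = bnd-ok {n = n} emptyChildᵉ []

    joinCost : Subset n → Data → Data → ℕ
    joinCost X k k′ = cost joinTm (indices n ∷ Gᵈ ∷ tᵈ ∷ setᵈ X ∷ k ∷ k′ ∷ []) tt tt

  -- The constant 326 of `nodeBound` is 218 + 108: the overhead of a node with two children and that
  -- of `joinTm`. Nodes with fewer children have less overhead but compute the empty child once or
  -- twice.
  tree-cost : ∀ {d} m T → Width≤ m (conv T) → recC nil treeStep (inputs d) (encodeTree T) nil ≤ order T *
        nodeBound (32 ^ m) n
  tree-cost m (node₀ X) (w , _) = begin
    _ ≡⟨ cong (λ k → 7 + (1 + (4 + (1 + (1 + ((1 + ((1 + ((1 + ((1 + ((1 + (1 + (1 + ((1 + ((1 + (1 + (1 + (1 +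
          1)))) + (1 + 4))) + 1)))) + (1 + (2 + 1)))) + (1 + (7 + 1)))) + (1 + (6 + 1)))) + (1 + (5 + 1)))) +
          (1 + ((1 + ((1 + ((1 + ((1 + ((1 + ((1 + (1 + (1 + ((1 + ((1 + ((1 + (1 + (1 + (6 + 1)))) + (1 + (2 +
          1)))) + (1 + (3 + (1 + (1 + ((1 + (1 + (1 + (2 + 1)))) + e))))))) + 1)))) + (1 + ((1 + ((1 + ((1 + (1
          + (1 + (6 + 1)))) + (1 + (2 + 1)))) + (1 + (3 + (1 + (1 + ((1 + (1 + (1 + (2 + 1)))) + e))))))) +
          1)))) + (1 + (5 + 1)))) + (1 + (4 + 1)))) + (1 + (3 + 1)))) + (1 + (2 + 1)))) + joinCost X k
          k)))))))) {emptyᵈ} {childᵈ leaf} emptyChild-ok ⟩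
    _ ≡⟨ eq e j ⟩
    151 + (2 * e + j) ≤⟨ +-monoʳ-≤ 151 (+-mono-≤ (*-monoʳ-≤ 2 e≤) (join-cost m X leaf leaf w)) ⟩
    151 + (2 * emptyChildBound n + (108 + CB)) ≤⟨ ≤-by 67 (eq′ (2 * emptyChildBound n) CB) ⟩
    nodeBound (32 ^ m) n + 0 ∎
    where
    open ≤-Reasoning
    CB = combineBound (32 ^ m) n
    j = joinCost X (childᵈ leaf) (childᵈ leaf)
    eq : ∀ e j → 7 + (1 + (4 + (1 + (1 + ((1 + ((1 + ((1 + ((1 + ((1 + (1 + (1 + ((1 + ((1 + (1 + (1 + (1 +
          1)))) + (1 + 4))) + 1)))) + (1 + (2 + 1)))) + (1 + (7 + 1)))) + (1 + (6 + 1)))) + (1 + (5 + 1)))) +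
          (1 + ((1 + ((1 + ((1 + ((1 + ((1 + ((1 + (1 + (1 + ((1 + ((1 + ((1 + (1 + (1 + (6 + 1)))) + (1 + (2 +
          1)))) + (1 + (3 + (1 + (1 + ((1 + (1 + (1 + (2 + 1)))) + e))))))) + 1)))) + (1 + ((1 + ((1 + ((1 + (1
          + (1 + (6 + 1)))) + (1 + (2 + 1)))) + (1 + (3 + (1 + (1 + ((1 + (1 + (1 + (2 + 1)))) + e))))))) +
          1)))) + (1 + (5 + 1)))) + (1 + (4 + 1)))) + (1 + (3 + 1)))) + (1 + (2 + 1)))) + j))))))) ≡ 151 + (2 *
          e + j)
    eq = solve-∀
    eq′ : ∀ e c → 151 + (e + (108 + c)) + 67 ≡ 326 + (e + c) + 0
    eq′ = solve-∀
  tree-cost {d} m (node₁ X T) (w , wT , _) = begin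
    _ ≡⟨ cong₂ (λ k k′ → 7 + (1 + (4 + (1 + (1 + ((1 + ((1 + ((1 + ((1 + ((1 + (1 + (1 + ((1 + ((1 + (1 + (1 +
          (1 + 1)))) + (1 + (7 + (1 + (4 + (1 + (4 + (1 + ((1 + (1 + (1 + x))) + (1 + ((1 + ((1 + (1 + (1 + (1
          + 1)))) + (1 + 4))) + 1)))))))))))) + 1)))) + (1 + (2 + 1)))) + (1 + (7 + 1)))) + (1 + (6 + 1)))) +
          (1 + (5 + 1)))) + (1 + ((1 + ((1 + ((1 + ((1 + ((1 + ((1 + (1 + (1 + ((1 + ((1 + ((1 + (1 + (1 + (6 +
          1)))) + (1 + (2 + 1)))) + (1 + (3 + (1 + (4 + (1 + (3 + (1 + (1 + ((1 + (1 + (1 + (4 + 1)))) +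
          e))))))))))) + 1)))) + (1 + ((1 + ((1 + ((1 + (1 + (1 + (6 + 1)))) + (1 + (2 + 1)))) + (1 + (3 + (1 +
          (4 + 2)))))) + 1)))) + (1 + (5 + 1)))) + (1 + (4 + 1)))) + (1 + (3 + 1)))) + (1 + (2 + 1)))) +
          joinCost X k k′)))))))) {treeᵈ d T} {childᵈ (conv T)} {emptyᵈ} {childᵈ leaf} (tree-ok {d} T)
          emptyChild-ok ⟩
    _ ≡⟨ eq e j x ⟩
    (191 + (e + j)) + x ≤⟨ +-mono-≤ (+-monoʳ-≤ 191 (+-mono-≤ e≤ (join-cost m X (conv T) leaf w))) (tree-cost
          {d} m T wT) ⟩
    (191 + (emptyChildBound n + (108 + CB))) + order T * nodeBound (32 ^ m) n
      ≤⟨ +-monoˡ-≤ (order T * nodeBound (32 ^ m) n) (≤-by {191 + (emptyChildBound n + (108 + CB))} {nodeBound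
            (32 ^ m) n} (27 + emptyChildBound n) (eq′ (emptyChildBound n) CB)) ⟩
    nodeBound (32 ^ m) n + order T * nodeBound (32 ^ m) n ∎
    where
    open ≤-Reasoning
    CB = combineBound (32 ^ m) n
    j = joinCost X (childᵈ (conv T)) (childᵈ leaf)
    x = recC nil treeStep (inputs d) (encodeTree T) nil
    eq : ∀ e j x → 7 + (1 + (4 + (1 + (1 + ((1 + ((1 + ((1 + ((1 + ((1 + (1 + (1 + ((1 + ((1 + (1 + (1 + (1 +
          1)))) + (1 + (7 + (1 + (4 + (1 + (4 + (1 + ((1 + (1 + (1 + x))) + (1 + ((1 + ((1 + (1 + (1 + (1 +
          1)))) + (1 + 4))) + 1)))))))))))) + 1)))) + (1 + (2 + 1)))) + (1 + (7 + 1)))) + (1 + (6 + 1)))) + (1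
          + (5 + 1)))) + (1 + ((1 + ((1 + ((1 + ((1 + ((1 + ((1 + (1 + (1 + ((1 + ((1 + ((1 + (1 + (1 + (6 +
          1)))) + (1 + (2 + 1)))) + (1 + (3 + (1 + (4 + (1 + (3 + (1 + (1 + ((1 + (1 + (1 + (4 + 1)))) +
          e))))))))))) + 1)))) + (1 + ((1 + ((1 + ((1 + (1 + (1 + (6 + 1)))) + (1 + (2 + 1)))) + (1 + (3 + (1 +
          (4 + 2)))))) + 1)))) + (1 + (5 + 1)))) + (1 + (4 + 1)))) + (1 + (3 + 1)))) + (1 + (2 + 1)))) +
          j))))))) ≡ (191 + (e + j)) + x
    eq = solve-∀
    eq′ : ∀ e c → 191 + (e + (108 + c)) + (27 + e) ≡ 326 + (2 * e + c)
    eq′ = solve-∀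
  tree-cost {d} m (node₂ X T T′) (w , wT , wT′) = begin
    _ ≡⟨ cong₂ (λ k k′ → 7 + (1 + (4 + (1 + (1 + ((1 + ((1 + ((1 + ((1 + ((1 + (1 + (1 + ((1 + ((1 + (1 + (1 +
          (1 + 1)))) + (1 + (7 + (1 + (4 + (1 + (4 + (1 + ((1 + (1 + (1 + x))) + (1 + ((1 + ((1 + (1 + (1 + (1
          + 1)))) + (1 + (7 + (1 + (4 + (1 + (4 + (1 + ((1 + (1 + (1 + y))) + (1 + ((1 + ((1 + (1 + (1 + (1 +
          1)))) + (1 + 4))) + 1)))))))))))) + 1)))))))))))) + 1)))) + (1 + (2 + 1)))) + (1 + (7 + 1)))) + (1 +
          (6 + 1)))) + (1 + (5 + 1)))) + (1 + ((1 + ((1 + ((1 + ((1 + ((1 + ((1 + (1 + (1 + ((1 + ((1 + ((1 +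
          (1 + (1 + (6 + 1)))) + (1 + (2 + 1)))) + (1 + (3 + (1 + (4 + (1 + (3 + (1 + (4 + 2)))))))))) + 1))))
          + (1 + ((1 + ((1 + ((1 + (1 + (1 + (6 + 1)))) + (1 + (2 + 1)))) + (1 + (3 + (1 + (4 + 2)))))) + 1))))
          + (1 + (5 + 1)))) + (1 + (4 + 1)))) + (1 + (3 + 1)))) + (1 + (2 + 1)))) + joinCost X k k′))))))))
          {treeᵈ d T} {childᵈ (conv T)} {treeᵈ d T′} {childᵈ (conv T′)} (tree-ok {d} T) (tree-ok {d} T′) ⟩
    _ ≡⟨ eq j x y ⟩
    (218 + j) + (x + y) ≤⟨ +-mono-≤ (+-monoʳ-≤ 218 (join-cost m X (conv T) (conv T′) w)) (+-mono-≤ (tree-cost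
          {d} m T wT) (tree-cost {d} m T′ wT′)) ⟩
    (218 + (108 + CB)) + (order T * K + order T′ * K)
      ≤⟨ +-monoˡ-≤ (order T * K + order T′ * K) (≤-by {218 + (108 + CB)} {K} (2 * emptyChildBound n) (eq′
            (emptyChildBound n) CB)) ⟩
    K + (order T * K + order T′ * K) ≡⟨ cong (K +_) (*-distribʳ-+ K (order T) (order T′)) ⟨
    K + (order T + order T′) * K ∎
    where
    open ≤-Reasoning
    CB = combineBound (32 ^ m) n
    K = nodeBound (32 ^ m) n
    j = joinCost X (childᵈ (conv T)) (childᵈ (conv T′))
    x = recC nil treeStep (inputs d) (encodeTree T) nil
    y = recC nil treeStep (inputs d) (encodeTree T′) nil
    eq : ∀ j x y → 7 + (1 + (4 + (1 + (1 + ((1 + ((1 + ((1 + ((1 + ((1 + (1 + (1 + ((1 + ((1 + (1 + (1 + (1 +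
          1)))) + (1 + (7 + (1 + (4 + (1 + (4 + (1 + ((1 + (1 + (1 + x))) + (1 + ((1 + ((1 + (1 + (1 + (1 +
          1)))) + (1 + (7 + (1 + (4 + (1 + (4 + (1 + ((1 + (1 + (1 + y))) + (1 + ((1 + ((1 + (1 + (1 + (1 +
          1)))) + (1 + 4))) + 1)))))))))))) + 1)))))))))))) + 1)))) + (1 + (2 + 1)))) + (1 + (7 + 1)))) + (1 +
          (6 + 1)))) + (1 + (5 + 1)))) + (1 + ((1 + ((1 + ((1 + ((1 + ((1 + ((1 + (1 + (1 + ((1 + ((1 + ((1 +
          (1 + (1 + (6 + 1)))) + (1 + (2 + 1)))) + (1 + (3 + (1 + (4 + (1 + (3 + (1 + (4 + 2)))))))))) + 1))))
          + (1 + ((1 + ((1 + ((1 + (1 + (1 + (6 + 1)))) + (1 + (2 + 1)))) + (1 + (3 + (1 + (4 + 2)))))) + 1))))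
          + (1 + (5 + 1)))) + (1 + (4 + 1)))) + (1 + (3 + 1)))) + (1 + (2 + 1)))) + j))))))) ≡ (218 + j) + (x +
          y)
    eq = solve-∀
    eq′ : ∀ e c → 218 + (108 + c) + 2 * e ≡ 326 + (2 * e + c)
    eq′ = solve-∀

-- Tree decompositions as trees of bags

[]=-irrelevant : ∀ {X : Subset n} {u} (p q : u ∈ₛ X) → p ≡ q
[]=-irrelevant _[_]=_.here      _[_]=_.here      = refl
[]=-irrelevant (_[_]=_.there p) (_[_]=_.there q) = cong _[_]=_.there ([]=-irrelevant p q)

topBag-conv : (T : BagTree n) → topBag (conv T) ≡ rootBag T
topBag-conv (node₀ X)     = refl
topBag-conv (node₁ X T)   = refl
topBag-conv (node₂ X T U) = refl

∈⇒! : ∀ {X : Subset n} {u} → u ∈ₛ X → ! lookup X u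
∈⇒! = []=⇒lookup

!⇒∈ : ∀ {X : Subset n} {u} → ! lookup X u → u ∈ₛ X
!⇒∈ {X = X} {u} = lookup⇒[]= u X

occurs⇒inT : ∀ {T : BagTree n} {u} (t : Node T) → u ∈ₛ bag t → ! inT (conv T) u
occurs⇒inT {T = T} {u} root p = top⇒inT (conv T) (subst (λ X → ! lookup X u) (sym (topBag-conv T)) (∈⇒! p))
occurs⇒inT {T = node₁ X T} {u} (only t) p = ∨-i₂ {lookup X u} (∨-i₁ (occurs⇒inT t p))
occurs⇒inT {T = node₂ X T U} {u} (left t) p = ∨-i₂ {lookup X u} (∨-i₁ (occurs⇒inT t p))
occurs⇒inT {T = node₂ X T U} {u} (right t) p = ∨-i₂ {lookup X u} (∨-i₂ {inT (conv T) u} (occurs⇒inT t p))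

inT⇒occurs : ∀ (T : BagTree n) {u} → ! inT (conv T) u → Occurrence T u
inT⇒occurs (node₀ X) {u} h with ∨-e {lookup X u} h
... | inj₁ p = root , !⇒∈ p
inT⇒occurs (node₁ X T) {u} h with ∨-e {lookup X u} h
... | inj₁ p = root , !⇒∈ p
... | inj₂ q with ∨-e {inT (conv T) u} q
...   | inj₁ r with inT⇒occurs T r
...     | t , p = only t , p
inT⇒occurs (node₂ X T U) {u} h with ∨-e {lookup X u} h
... | inj₁ p = root , !⇒∈ p
... | inj₂ q with ∨-e {inT (conv T) u} q
...   | inj₁ r with inT⇒occurs T r
...     | t , p = left t , p
inT⇒occurs (node₂ X T U) {u} h | inj₂ q | inj₂ r with inT⇒occurs U r
...     | t , p = right t , p

covered : ∀ {T : BagTree n} {u v} (t : Node T) → u ∈ₛ bag t → v ∈ₛ bag t → Covered u v (conv T)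
covered {T = node₀ X}     root p q = here (∈⇒! p) (∈⇒! q)
covered {T = node₁ X T}   root p q = here (∈⇒! p) (∈⇒! q)
covered {T = node₂ X T U} root p q = here (∈⇒! p) (∈⇒! q)
covered (only t)  p q = left (covered t p q)
covered (left t)  p q = left (covered t p q)
covered (right t) p q = right (covered t p q)

data Step {S T : BagTree n} (a : Node T) : Maybe (Node S) → Maybe (Node S) → Set where
  inside  : ∀ {s t} → ParentOf s t → Step a (just s) (just t)
  outside : Step a nothing nothing
  enter   : a ≡ root → Step a nothing (just root)

-- S is the subtree of T below one of the children of the root.
record Child {n} (S T : BagTree n) : Set where
  field
    inj      : Node S → Node T
    prj      : Node T → Maybe (Node S)
    prj-inj  : ∀ s → prj (inj s) ≡ just s
    prj-root : prj root ≡ nothing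
    bag-prj  : ∀ {a s} → prj a ≡ just s → bag a ≡ bag s
    step     : ∀ {a b} → ParentOf a b → Step a (prj a) (prj b)

onlyChild : ∀ {X} {T : BagTree n} → Child T (node₁ X T)
onlyChild {X = X} {T} = record { inj = only ; prj = prj ; prj-inj = λ _ → refl ; prj-root = refl ; bag-prj =
      bag-prj ; step = step }
  where
  prj : Node (node₁ X T) → Maybe (Node T)
  prj root     = nothing
  prj (only t) = just t
  bag-prj : ∀ {a s} → prj a ≡ just s → bag a ≡ bag s
  bag-prj {only t} refl = refl
  step : ∀ {a b} → ParentOf a b → Step a (prj a) (prj b)
  step root-only = enter refl
  step (only p)  = inside p

leftChild : ∀ {X} {T U : BagTree n} → Child T (node₂ X T U)
leftChild {X = X} {T} {U} = record { inj = left ; prj = prj ; prj-inj = λ _ → refl ; prj-root = refl ; bag-prj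
      = bag-prj ; step = step }
  where
  prj : Node (node₂ X T U) → Maybe (Node T)
  prj root      = nothing
  prj (left t)  = just t
  prj (right t) = nothing
  bag-prj : ∀ {a s} → prj a ≡ just s → bag a ≡ bag s
  bag-prj {left t} refl = refl
  step : ∀ {a b} → ParentOf a b → Step a (prj a) (prj b)
  step root-left  = enter refl
  step root-right = outside
  step (left p)   = inside p
  step (right p)  = outside

rightChild : ∀ {X} {T U : BagTree n} → Child U (node₂ X T U)
rightChild {X = X} {T} {U} = record { inj = right ; prj = prj ; prj-inj = λ _ → refl ; prj-root = refl ;
      bag-prj = bag-prj ; step = step }
  where
  prj : Node (node₂ X T U) → Maybe (Node U)
  prj root      = nothing
  prj (left t)  = nothing
  prj (right t) = just t
  bag-prj : ∀ {a s} → prj a ≡ just s → bag a ≡ bag s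
  bag-prj {right t} refl = refl
  step : ∀ {a b} → ParentOf a b → Step a (prj a) (prj b)
  step root-left  = outside
  step root-right = enter refl
  step (left p)   = outside
  step (right p)  = inside p

module _ {S T : BagTree n} (ch : Child S T) {u : Fin n} where
  open Child ch

  occ : Occurrence S u → Occurrence T u
  occ (s , p) = inj s , subst (u ∈ₛ_) (sym (bag-prj (prj-inj s))) p

  -- Only one tree edge joins `S` to the rest, the edge between the two roots, so a path into `S`
  -- visits both of them.
  crossing : ∀ {x y : Occurrence T u} → Linked T u x y → ∀ {s} → prj (proj₁ x) ≡ nothing → prj (proj₁ y) ≡ just s →
             (u ∈ₛ rootBag T) × (u ∈ₛ rootBag S)
  crossing ε out in′ with trans (sym out) in′
  ... | ()
  crossing {x} (_◅_ {j = z} (fwd p) ps) out in′ with prj (proj₁ x) | prj (proj₁ z) in eq | step p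
  ... | nothing | nothing | outside = crossing ps eq in′
  ... | nothing | just _ | enter refl = proj₂ x , subst (u ∈ₛ_) (bag-prj eq) (proj₂ z)
  crossing {x} (_◅_ {j = z} (bwd p) ps) out in′ with prj (proj₁ x) | prj (proj₁ z) in eq | step p
  ... | nothing | nothing | outside = crossing ps eq in′

  -- Occurrences outside S are mapped to the root of S if u occurs there; if
  -- it does not, no path enters or leaves S and their image is irrelevant.
  module _ (d : Occurrence S u) (d-root : (p : u ∈ₛ rootBag S) → d ≡ (root , p)) where

    retract : (a : Node T) → u ∈ₛ bag a → (m : Maybe (Node S)) → prj a ≡ m → Occurrence S u
    retract a p nothing  _ = d
    retract a p (just s) e = s , subst (u ∈ₛ_) (bag-prj e) p

    ret : Occurrence T u → Occurrence S u
    ret (a , p) = retract a p (prj a) refl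

    ret-occ : ∀ s → ret (occ s) ≡ s
    ret-occ (s , p) = go (prj (inj s)) refl
      where
      q : u ∈ₛ bag (inj s)
      q = proj₂ (occ (s , p))
      go : ∀ m (e : prj (inj s) ≡ m) → retract (inj s) q m e ≡ (s , p)
      go nothing e with trans (sym e) (prj-inj s)
      ... | ()
      go (just s′) e with just-injective (trans (sym e) (prj-inj s))
      ... | refl = cong (s ,_) ([]=-irrelevant _ _)

    ret-step : ∀ {x y : Occurrence T u} → ParentOf (proj₁ x) (proj₁ y) → Linked S u (ret x) (ret y)
    ret-step {a , p} {b , q} e = go (prj a) refl (prj b) refl (step e)
      where
      go : ∀ m (em : prj a ≡ m) m′ (em′ : prj b ≡ m′) → Step a m m′ → Linked S u (retract a p m em) (retract b
            q m′ em′)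
      go _ em _ em′ (inside h) = fwd h ◅ ε
      go _ em _ em′ outside = ε
      go _ em _ em′ (enter _) = subst (λ z → Linked S u d z) (d-root _) ε

    flip-linked : ∀ {x y : Occurrence S u} → Linked S u x y → Linked S u y x
    flip-linked = go ε
      where
      go : ∀ {x y z : Occurrence S u} → Linked S u x z → Linked S u x y → Linked S u y z
      go acc ε = acc
      go acc (fwd p ◅ ps) = go (bwd p ◅ acc) ps
      go acc (bwd p ◅ ps) = go (fwd p ◅ acc) ps

    ret-linked : ∀ {x y : Occurrence T u} → Linked T u x y → Linked S u (ret x) (ret y)
    ret-linked ε = ε
    ret-linked (_◅_ {i = x} {j = z} (fwd p) ps) = ret-step {x} {z} p ◅◅ ret-linked ps
    ret-linked (_◅_ {i = x} {j = z} (bwd p) ps) = flip-linked (ret-step {z} {x} p) ◅◅ ret-linked ps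

  child-linked : (∀ (s t : Occurrence T u) → Linked T u s t) → ∀ (s t : Occurrence S u) → Linked S u s t
  child-linked h s t with !? (lookup (rootBag S) u)
  ... | yes r = go (root , !⇒∈ r) (λ p → cong (root ,_) ([]=-irrelevant _ _))
    where
    go : ∀ d dr → Linked S u s t
    go d dr = subst₂ (Linked S u) (ret-occ d dr s) (ret-occ d dr t) (ret-linked d dr (h (occ s) (occ t)))
  ... | no ¬r = subst₂ (Linked S u) (ret-occ s dr s) (ret-occ s dr t) (ret-linked s dr (h (occ s) (occ t)))
    where
    dr : (p : u ∈ₛ rootBag S) → s ≡ (root , p)
    dr p = ⊥-elim (¬r (∈⇒! p))

AllLinked : BagTree n → Set
AllLinked T = ∀ u (s t : Occurrence T u) → Linked T u s t

root-child : ∀ {S T : BagTree n} (ch : Child S T) → AllLinked T → ∀ u → ! lookup (rootBag T) u → ! inT (conv S)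
      u → ! top (conv S) u
root-child {S = S} ch h u r i with crossing ch (h u (root , !⇒∈ r) (occ ch (inT⇒occurs S i))) (Child.prj-root
      ch) (Child.prj-inj ch _)
... | _ , q = subst (λ X → ! lookup X u) (sym (topBag-conv S)) (∈⇒! q)

connected-conv : (T : BagTree n) → AllLinked T → Connected (conv T)
connected-conv (node₀ X) h = record { topˡ = λ _ _ () ; topʳ = λ _ _ () ; both = λ _ () } , tt , tt
connected-conv (node₁ X T) h =
  record { topˡ = root-child onlyChild h ; topʳ = λ _ _ () ; both = λ _ _ () } ,
  connected-conv T (λ u → child-linked onlyChild (h u)) , tt
connected-conv (node₂ X T U) h =
  record { topˡ = root-child leftChild h ; topʳ = root-child rightChild h
         ; both = λ u i j → ∈⇒! (proj₁ (crossing leftChild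
             (h u (occ rightChild (inT⇒occurs U j)) (occ leftChild (inT⇒occurs T i))) refl refl)) } ,
  connected-conv T (λ u → child-linked leftChild (h u)) , connected-conv U (λ u → child-linked rightChild (h u))

nice-conv : ∀ {T : BagTree n} → Nice T → NiceBT (conv T)
nice-conv (leaf _) = unary leaf
nice-conv (join {T = T} {U} p q nT nU) = join (trans p (sym (topBag-conv T))) (trans q (sym (topBag-conv U)))
      (nice-conv nT) (nice-conv nU)
nice-conv (introduce _ _ nT) = unary (nice-conv nT)
nice-conv (forget _ _ nT) = unary (nice-conv nT)

countF-lookup : (X : Subset n) → countF (lookup X) ≡ ∣ X ∣
countF-lookup []          = refl
countF-lookup (true ∷ X)  = cong suc (countF-lookup X)
countF-lookup (false ∷ X) = countF-lookup X

─-empty : (X Y : Subset n) → ∣ X ─ Y ∣ ≡ 0 → ∀ u → ! lookup X u → ! lookup Y u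
─-empty (true ∷ X)  (true ∷ Y)  h zero    _ = refl
─-empty (true ∷ X)  (true ∷ Y)  h (suc u) p = ─-empty X Y h u p
─-empty (false ∷ X) (true ∷ Y)  h (suc u) p = ─-empty X Y h u p
─-empty (false ∷ X) (false ∷ Y) h (suc u) p = ─-empty X Y h u p

bagUnion : Subset n → Subset n → Subset n → Fin n → Bool
bagUnion X B C u = lookup X u ∨ (lookup B u ∨ lookup C u)

union-⊆ : ∀ (X B C Y : Subset n) → (∀ u → ! lookup X u → ! lookup Y u) → (∀ u → ! lookup B u → ! lookup Y u) →
          (∀ u → ! lookup C u → ! lookup Y u) → ∀ {m} → ∣ Y ∣ ≤ m → countF (bagUnion X B C) ≤ m
union-⊆ X B C Y f g h {m} le = ≤-trans (countF-mono sub⊆) (≤-trans (≤-reflexive (countF-lookup Y)) le)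
  where
  sub⊆ : ∀ u → ! bagUnion X B C u → ! lookup Y u
  sub⊆ u p with ∨-e {lookup X u} p
  ... | inj₁ q = f u q
  ... | inj₂ q with ∨-e {lookup B u} q
  ...   | inj₁ r = g u r
  ...   | inj₂ r = h u r

leaf-⊆ : ∀ (Y : Subset n) u → ! top leaf u → ! lookup Y u
leaf-⊆ Y u h = ⊥-elim (¬top-leaf {u = u} h)

width-mono : ∀ {m m′} → m ≤ m′ → (T : BT n) → Width≤ m T → Width≤ m′ T
width-mono le leaf _ = tt
width-mono le (node X L R) (p , q , r) = ≤-trans p le , width-mono le L q , width-mono le R r

-- In a nice decomposition the union is itself a bag: that of the child at a forget node and that of
-- the node in all other cases.
width-conv : ∀ {T : BagTree n} → Nice T → Width≤ (maxBag T) (conv T)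
width-conv {T = node₀ X} (leaf _) = union-⊆ X (topBag leaf) (topBag leaf) X (λ _ p → p) (leaf-⊆ X) (leaf-⊆ X)
      ≤-refl , tt , tt
width-conv {T = node₂ X T U} (join p q nT nU) =
  union-⊆ X (topBag (conv T)) (topBag (conv U)) X (λ _ p → p) (λ u → subst (λ Z → ! lookup Z u) (trans
        (topBag-conv T) (sym p)))
    (λ u → subst (λ Z → ! lookup Z u) (trans (topBag-conv U) (sym q))) (m≤m⊔n _ _) ,
  width-mono (≤-trans (m≤m⊔n _ _) (m≤n⊔m ∣ X ∣ _)) (conv T) (width-conv nT) ,
  width-mono (≤-trans (m≤n⊔m (maxBag T) _) (m≤n⊔m ∣ X ∣ _)) (conv U) (width-conv nU)
width-conv {T = node₁ X T} (introduce _ e nT) =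
  union-⊆ X (topBag (conv T)) (topBag leaf) X (λ _ p → p) (λ u p → ─-empty (rootBag T) X e u (subst (λ Z → !
        lookup Z u) (topBag-conv T) p)) (leaf-⊆ X) (m≤m⊔n _ _) ,
  width-mono (m≤n⊔m ∣ X ∣ _) (conv T) (width-conv nT) , tt
width-conv {T = node₁ X T} (forget _ e nT) =
  union-⊆ X (topBag (conv T)) (topBag leaf) (rootBag T) (─-empty X (rootBag T) e) (λ u → subst (λ Z → ! lookup
        Z u) (topBag-conv T)) (leaf-⊆ (rootBag T))
    (≤-trans (root≤ T) (m≤n⊔m ∣ X ∣ _)) ,
  width-mono (m≤n⊔m ∣ X ∣ _) (conv T) (width-conv nT) , tt
  where
  root≤ : (T : BagTree _) → ∣ rootBag T ∣ ≤ maxBag T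
  root≤ (node₀ X)     = ≤-refl
  root≤ (node₁ X T)   = m≤m⊔n _ _
  root≤ (node₂ X T U) = m≤m⊔n _ _

-- The main program and its time bound

idxStep : Tm true 4
idxStep = cons (var #2) (selfʳ (cons nil (var #2)))

-- Numbering the rows of the adjacency matrix produces the vertex list on which the expressions
-- depend.
idxTm : Tm false 1
idxTm = rec (var #0) nil nil idxStep

answerᵉ : Ex (raw ∷ []) raw
answerᵉ = prim tlP (prim getP (sub emptyKeyᵉ [] ∷ v0 ∷ []) ∷ [])

finishTm : Tm false 4
finishTm = call (toTm answerᵉ) (var #0 ∷ tl (call joinTm
  (var #0 ∷ var #1 ∷ var #2 ∷ hd (call (toTm emptyChildᵉ) (var #0 ∷ [])) ∷
   call treeTm (var #0 ∷ var #1 ∷ var #2 ∷ var #3 ∷ []) ∷ call (toTm emptyChildᵉ) (var #0 ∷ []) ∷ [])) ∷ [])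

mainTm : Tm false 1
mainTm = call (call finishTm (call idxTm (var #0 ∷ []) ∷ var #0 ∷ var #1 ∷ var #2 ∷ []))
  (hd (var #0) ∷ hd (tl (var #0)) ∷ tl (tl (var #0)) ∷ [])

idx-ok : ∀ {ρ : Vec Data 1} {A : Set} {f : A → Data} (xs : Vec A l) (g : Fin l → Fin n) j → (∀ i → toℕ (g i) ≡
      j + toℕ i) →
         recV nil idxStep ρ (encodeVec f xs) (encodeℕ j) ≡ encodeVec (enc {n} fin) (tabulate g)
idx-ok []       g j h = refl
idx-ok {ρ = ρ} (x ∷ xs) g j h = cong₂ cons (cong encodeℕ (sym (trans (h zero) (+-identityʳ j))))
  (idx-ok {ρ = ρ} xs (g ∘ suc) (suc j) λ i → trans (h (suc i)) (+-suc j (toℕ i)))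

idx-cost : ∀ {ρ : Vec Data 1} {A : Set} {f : A → Data} (xs : Vec A l) p → recC nil idxStep ρ (encodeVec f xs) p
      ≤ 4 + l * 24
idx-cost []       p = ≤-refl
idx-cost {l = suc l} {ρ} {f = f} (x ∷ xs) p = begin
  _                    ≡⟨ eq zs ⟩
  24 + zs              ≤⟨ +-monoʳ-≤ 24 (idx-cost {ρ = ρ} xs (cons nil p)) ⟩
  24 + (4 + l * 24)    ≡⟨ eq′ (l * 24) ⟩
  4 + (24 + l * 24)    ∎
  where
  open ≤-Reasoning
  zs = recC nil idxStep ρ (encodeVec f xs) (cons nil p)
  eq : ∀ z → 7 + (1 + (4 + (1 + ((1 + ((1 + (1 + (1 + (4 + 1)))) + (1 + z))) + 1)))) ≡ 24 + z
  eq = solve-∀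
  eq′ : ∀ x → 24 + (4 + x) ≡ 4 + (24 + x)
  eq′ = solve-∀

-- In `mainBound` the factor 32 = 2 ^ 5 accounts for bags of size w + 1 instead of w, and the factor
-- 2 adds one share for the additional root to the share of the tree.
labelBound nodeBase fixedBound mainBound : ℕ → ℕ
labelBound n = n * 3000 + (131 + bnd updateᵉ n)
nodeBase n = 326 + (2 * emptyChildBound n + combineBase n)
fixedBound n = 4 + (311 + ((4 + n * 24) + (2 * emptyChildBound n + bnd answerᵉ n)))
mainBound n = fixedBound n + 2 * (nodeBase n + 32 * labelBound n)

mainBound-poly : Poly mainBound
mainBound-poly = poly+ (poly+ (polyConst 4) (poly+ (polyConst 311) (poly+ (linear 4 24)
    (poly+ (poly* (polyConst 2) emptyPoly) (bnd-poly answerᵉ)))))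
  (poly* (polyConst 2) (poly+
    (poly+ (polyConst 326) (poly+ (poly* (polyConst 2) emptyPoly)
      (poly+ (polyConst 170) (poly+ (bnd-poly matricesᵉ) (poly+ (bnd-poly optionsᵉ) (polyConst 13))))))
    (poly* (polyConst 32) (poly+ (poly* polyId (polyConst 3000)) (poly+ (polyConst 131) (bnd-poly updateᵉ))))))
  where
  emptyPoly : Poly emptyChildBound
  emptyPoly = bnd-poly emptyChildᵉ

-- The root bag of a nice decomposition may be nonempty. An empty bag above it makes every vertex
-- forgotten, hence counted, and leaves no bag to which demands could be deferred.
rootOver : BagTree n → BT n
rootOver T = node (topBag leaf) (conv T) leaf

adjacency : Graph n → Vec (Vec Bool n) n
adjacency G = tabulate (N G)

thresholds : Threshold n → Vec ℕ n
thresholds τ = tabulate τ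

module Main {n} (G : Graph n) (τ : Threshold n) where
  open DP (adjacency G) (thresholds τ) using (solve; leafTable)
  open Execution (adjacency G) (thresholds τ)

  input : BagTree n → Data
  input T = encodeInput G τ T

  idx≡ : ⟦ idxTm ⟧ (Gᵈ ∷ []) tt ≡ indices n
  idx≡ = idx-ok {ρ = Gᵈ ∷ []} (adjacency G) id 0 λ i → refl

  answerOf : Data → Data
  answerOf d = tlD (getD (encodeKey {n} emptyKey) d)

  finish-ok : ∀ T → ⟦ finishTm ⟧ (indices n ∷ Gᵈ ∷ tᵈ ∷ encodeTree T ∷ []) tt ≡ answerOf (solve (rootOver T))
  finish-ok T = trans
    (cong₂ (λ k e → answer (⟦ joinTm ⟧ (indices n ∷ Gᵈ ∷ tᵈ ∷ hdD e ∷ k ∷ e ∷ []) tt))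
      {treeᵈ (encodeTree T) T} {childᵈ (conv T)} {emptyᵈ} {childᵈ leaf} (tree-ok {encodeTree T} T) emptyChild-ok)
    (trans (cong answer (join-ok (topBag leaf) (conv T) leaf)) (toTm-ok {n = n} answerᵉ (solve (rootOver T) ∷ [])))
    where
    answer : Data → Data
    answer d = ⟦ toTm answerᵉ ⟧ (indices n ∷ tlD d ∷ []) tt

  main-ok : ∀ T → ⟦ mainTm ⟧ (input T ∷ []) tt ≡ answerOf (solve (rootOver T))
  main-ok T = trans (cong (λ i → ⟦ finishTm ⟧ (i ∷ Gᵈ ∷ tᵈ ∷ encodeTree T ∷ []) tt) idx≡) (finish-ok T)

  main-cost : ∀ m T → Width≤ m (conv T) → Width≤ m (rootOver T) →
              cost mainTm (input T ∷ []) tt tt ≤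
              311 + ((4 + n * 24) + (2 * emptyChildBound n + bnd answerᵉ n)) +
              (order T * nodeBound (32 ^ m) n + combineBound (32 ^ m) n)
  main-cost m T w (w′ , _) = begin
    _ ≡⟨ cong outer {⟦ idxTm ⟧ (Gᵈ ∷ []) tt} {indices n} idx≡ ⟩
    _ ≡⟨ cong₂ inner {treeᵈ (encodeTree T) T} {childᵈ (conv T)} {emptyᵈ} {childᵈ leaf} (tree-ok {encodeTree T}
          T) emptyChild-ok ⟩
    _ ≡⟨ cong (λ d → (1 + ((1 + ((1 + ((1 + (1 + (1 + ((1 + ((1 + (2 + (1 + (4 + 3)))) + (1 + (4 + 3)))) +
          1)))) + (1 + ((1 + ((1 + (2 + (1 + (4 + 3)))) + (1 + (4 + 2)))) + 1)))) + (1 + ((1 + (2 + (1 + (4 +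
          2)))) + 1)))) + (1 + ((1 + ((1 + ((1 + ((1 + (1 + (1 + (4 + 1)))) + (1 + (3 + 1)))) + (1 + (2 + 1))))
          + (1 + ((1 + ((1 + (1 + (1 + (2 + 1)))) + (1 + (2 + (1 + (1 + (1 + i))))))) + 1)))) + (1 + ((1 + ((1
          + (1 + (1 + ((1 + ((1 + ((1 + ((1 + ((1 + ((1 + ((1 + ((1 + (1 + (1 + ((1 + ((1 + (1 + (1 + (2 +
          1)))) + e)) + 1)))) + (1 + ((1 + ((1 + ((1 + ((1 + ((1 + (1 + (1 + (5 + 1)))) + (1 + (4 + 1)))) + (1
          + (3 + 1)))) + (1 + (2 + 1)))) + (1 + (5 + (1 + (1 + (1 + x))))))) + 1)))) + (1 + ((1 + ((1 + ((1 +
          (1 + (1 + (2 + 1)))) + e)) + (1 + (4 + 2)))) + 1)))) + (1 + (4 + 1)))) + (1 + (3 + 1)))) + (1 + (2 +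
          1)))) + j)) + (1 + matchD d 1 λ a b → 4 + 3))) + 1)))) + (1 + (2 + 1)))) + cost (toTm answerᵉ)
          (indices n ∷ tlD d ∷ []) tt tt))))))) {joinD} {childᵈ (rootOver T)} (join-ok (topBag leaf) (conv T)
          leaf) ⟩
    _ ≡⟨ eq j e s x i ⟩
    203 + (i + (2 * e + s)) + (x + j) ≤⟨ +-mono-≤ (+-monoʳ-≤ 203 (+-mono-≤ (idx-cost {ρ = Gᵈ ∷ []} (adjacency G) nil)
          (+-mono-≤ (*-monoʳ-≤ 2 (bnd-ok {n = n} emptyChildᵉ [])) (bnd-ok {n = n} answerᵉ (solve (rootOver T) ∷
                [])))))
        (+-mono-≤ (tree-cost {encodeTree T} m T w) (join-cost m (topBag leaf) (conv T) leaf w′)) ⟩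
    203 + F + (K + (108 + CB)) ≡⟨ eq′ F K CB ⟩
    311 + F + (K + CB) ∎
    where
    open ≤-Reasoning
    F = (4 + n * 24) + (2 * emptyChildBound n + bnd answerᵉ n)
    K = order T * nodeBound (32 ^ m) n
    CB = combineBound (32 ^ m) n
    joinD : Data
    joinD = ⟦ joinTm ⟧ (indices n ∷ Gᵈ ∷ tᵈ ∷ setᵈ (topBag leaf) ∷ childᵈ (conv T) ∷ childᵈ leaf ∷ []) tt
    e = cost (toTm emptyChildᵉ) (indices n ∷ []) tt tt
    s = cost (toTm answerᵉ) (indices n ∷ solve (rootOver T) ∷ []) tt tt
    x = recC nil treeStep (inputs (encodeTree T)) (encodeTree T) nil
    i = recC nil idxStep (Gᵈ ∷ []) Gᵈ nil
    finishCost : Data → ℕ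
    finishCost d = cost finishTm (d ∷ Gᵈ ∷ tᵈ ∷ encodeTree T ∷ []) tt tt
    outer : Data → ℕ
    outer d = (1 + ((1 + ((1 + ((1 + (1 + (1 + ((1 + ((1 + (2 + (1 + (4 + 3)))) + (1 + (4 + 3)))) + 1)))) + (1
          + ((1 + ((1 + (2 + (1 + (4 + 3)))) + (1 + (4 + 2)))) + 1)))) + (1 + ((1 + (2 + (1 + (4 + 2)))) +
          1)))) + (1 + ((1 + ((1 + ((1 + ((1 + (1 + (1 + (4 + 1)))) + (1 + (3 + 1)))) + (1 + (2 + 1)))) + (1 +
          ((1 + ((1 + (1 + (1 + (2 + 1)))) + (1 + (2 + (1 + (1 + (1 + i))))))) + 1)))) + finishCost d))))
    joinCost : Data → Data → ℕ
    joinCost k e = cost joinTm (indices n ∷ Gᵈ ∷ tᵈ ∷ hdD e ∷ k ∷ e ∷ []) tt tt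
    j = joinCost (childᵈ (conv T)) (childᵈ leaf)
    inner : Data → Data → ℕ
    inner k d = (1 + ((1 + ((1 + ((1 + (1 + (1 + ((1 + ((1 + (2 + (1 + (4 + 3)))) + (1 + (4 + 3)))) + 1)))) +
          (1 + ((1 + ((1 + (2 + (1 + (4 + 3)))) + (1 + (4 + 2)))) + 1)))) + (1 + ((1 + (2 + (1 + (4 + 2)))) +
          1)))) + (1 + ((1 + ((1 + ((1 + ((1 + (1 + (1 + (4 + 1)))) + (1 + (3 + 1)))) + (1 + (2 + 1)))) + (1 +
          ((1 + ((1 + (1 + (1 + (2 + 1)))) + (1 + (2 + (1 + (1 + (1 + i))))))) + 1)))) + (1 + ((1 + ((1 + (1 +
          (1 + ((1 + ((1 + ((1 + ((1 + ((1 + ((1 + ((1 + ((1 + (1 + (1 + ((1 + ((1 + (1 + (1 + (2 + 1)))) + e))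
          + 1)))) + (1 + ((1 + ((1 + ((1 + ((1 + ((1 + (1 + (1 + (5 + 1)))) + (1 + (4 + 1)))) + (1 + (3 + 1))))
          + (1 + (2 + 1)))) + (1 + (5 + (1 + (1 + (1 + x))))))) + 1)))) + (1 + ((1 + ((1 + ((1 + (1 + (1 + (2 +
          1)))) + e)) + (1 + matchD d 1 λ a b → 4 + 2))) + 1)))) + (1 + (4 + 1)))) + (1 + (3 + 1)))) + (1 + (2
          + 1)))) + joinCost k d)) + (1 + matchD (⟦ joinTm ⟧ (indices n ∷ Gᵈ ∷ tᵈ ∷ hdD d ∷ k ∷ d ∷ []) tt) 1 λ
          a b → 4 + 3))) + 1)))) + (1 + (2 + 1)))) + cost (toTm answerᵉ) (indices n ∷ tlD (⟦ joinTm ⟧ (indices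
          n ∷ Gᵈ ∷ tᵈ ∷ hdD d ∷ k ∷ d ∷ []) tt) ∷ []) tt tt))))))
    eq : ∀ j e s x i → (1 + ((1 + ((1 + ((1 + (1 + (1 + ((1 + ((1 + (2 + (1 + (4 + 3)))) + (1 + (4 + 3)))) +
          1)))) + (1 + ((1 + ((1 + (2 + (1 + (4 + 3)))) + (1 + (4 + 2)))) + 1)))) + (1 + ((1 + (2 + (1 + (4 +
          2)))) + 1)))) + (1 + ((1 + ((1 + ((1 + ((1 + (1 + (1 + (4 + 1)))) + (1 + (3 + 1)))) + (1 + (2 + 1))))
          + (1 + ((1 + ((1 + (1 + (1 + (2 + 1)))) + (1 + (2 + (1 + (1 + (1 + i))))))) + 1)))) + (1 + ((1 + ((1
          + (1 + (1 + ((1 + ((1 + ((1 + ((1 + ((1 + ((1 + ((1 + ((1 + (1 + (1 + ((1 + ((1 + (1 + (1 + (2 +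
          1)))) + e)) + 1)))) + (1 + ((1 + ((1 + ((1 + ((1 + ((1 + (1 + (1 + (5 + 1)))) + (1 + (4 + 1)))) + (1
          + (3 + 1)))) + (1 + (2 + 1)))) + (1 + (5 + (1 + (1 + (1 + x))))))) + 1)))) + (1 + ((1 + ((1 + ((1 +
          (1 + (1 + (2 + 1)))) + e)) + (1 + (4 + 2)))) + 1)))) + (1 + (4 + 1)))) + (1 + (3 + 1)))) + (1 + (2 +
          1)))) + j)) + (1 + (4 + 3)))) + 1)))) + (1 + (2 + 1)))) + s)))))) ≡ 203 + (i + (2 * e + s)) + (x + j)
    eq = solve-∀
    eq′ : ∀ F K c → 203 + F + (K + (108 + c)) ≡ 311 + F + (K + c)
    eq′ = solve-∀

-- The activation process

countF-positive : ∀ {p : Fin n → Bool} u → ! p u → 1 ≤ countF p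
countF-positive {p = p} zero h with p zero
... | true = s≤s z≤n
countF-positive {suc n} {p} (suc u) h with p zero
... | true = s≤s z≤n
... | false = countF-positive {n} u h

countF-witness : ∀ {p : Fin n → Bool} → 1 ≤ countF p → ∃[ u ] (! p u)
countF-witness {zero} ()
countF-witness {suc n} {p} h with p zero in e
... | true = zero , e
... | false with countF-witness {n} h
...   | u , q = suc u , q

lookup-extensional : ∀ {X Y : Subset n} → (∀ u → lookup X u ≡ lookup Y u) → X ≡ Y
lookup-extensional {X = X} {Y} h = trans (sym (tabulate∘lookup X)) (trans (tabulate-cong h) (tabulate∘lookup Y))

module Activation {n} (G : Graph n) (τ : Threshold n) (res : Restricted G τ) where
  open Restricted res

  open DP (adjacency G) (thresholds τ) public

  adj≡ : ∀ u v → adj u v ≡ lookup (N G u) v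
  adj≡ u v = cong (λ X → lookup X v) (lookup∘tabulate (N G) u)

  adj-sym : ∀ {u v} → ! adj u v → ! adj v u
  adj-sym {u} {v} h = trans (adj≡ v u) (∈⇒! (Graph.sym G (!⇒∈ (trans (sym (adj≡ u v)) h))))

  z⇒ : ∀ {u} → ! z u → τ u ≡ 0
  z⇒ {u} h with lookup (thresholds τ) u | lookup∘tabulate τ u
  ... | zero | e = sym e

  o⇒ : ∀ {u} → ! o u → τ u ≡ 1
  o⇒ {u} h with lookup (thresholds τ) u | lookup∘tabulate τ u
  ... | suc zero | e = sym e

  cls : ∀ u → (! z u) ⊎ (! o u) ⊎ (! a u)
  cls u with lookup (thresholds τ) u
  ... | zero        = inj₁ refl
  ... | suc zero    = inj₂ (inj₁ refl)
  ... | suc (suc _) = inj₂ (inj₂ refl)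

  o¬z : ∀ {u} → ! o u → ! z u → ⊥
  o¬z {u} h h′ with lookup (thresholds τ) u
  o¬z h () | suc _

  o¬a : ∀ {u} → ! o u → ! a u → ⊥
  o¬a {u} h h′ with lookup (thresholds τ) u
  o¬a h () | suc zero

  a⇒ : ∀ {u} → ! a u → τ u ≡ deg G u
  a⇒ {u} h with values u | lookup (thresholds τ) u | lookup∘tabulate τ u
  ... | inj₁ e        | suc (suc k) | e′ = contradiction (trans e′ e) λ ()
  ... | inj₂ (inj₁ e) | suc (suc k) | e′ = contradiction (trans e′ e) λ ()
  ... | inj₂ (inj₂ e) | _           | _  = e

  active : Subset n → ℕ → Fin n → Bool
  active X s u = lookup (activation G τ X s) u

  activeNbr : Subset n → ℕ → Fin n → Fin n → Bool
  activeNbr X s u v = adj u v ∧ active X s v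

  count-active : ∀ X s u → ∣ N G u ∩ activation G τ X s ∣ ≡ countF (activeNbr X s u)
  count-active X s u = trans (sym (countF-lookup (N G u ∩ activation G τ X s)))
    (countF-cong λ v → trans (lookup-zipWith _∧_ v (N G u) (activation G τ X s)) (cong (_∧ active X s v) (sym
          (adj≡ u v))))

  active-suc⁺ : ∀ {X s u} → τ u ≤ countF (activeNbr X s u) → ! active X (suc s) u
  active-suc⁺ {X} {s} {u} h = trans (lookup∘tabulate _ u)
    (Equivalence.to T-≡ (fromWitness {a? = τ u ≤? ∣ N G u ∩ activation G τ X s ∣} (≤-trans h (≤-reflexive (sym
          (count-active X s u))))))

  active-suc⁻ : ∀ {X s u} → ! active X (suc s) u → τ u ≤ countF (activeNbr X s u)
  active-suc⁻ {X} {s} {u} h = ≤-trans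
    (toWitness {a? = τ u ≤? ∣ N G u ∩ activation G τ X s ∣} (Equivalence.from T-≡ (trans (sym (lookup∘tabulate
          _ u)) h)))
    (≤-reflexive (count-active X s u))

  deg≡ : ∀ u → deg G u ≡ countF (adj u)
  deg≡ u = trans (sym (countF-lookup (N G u))) (countF-cong λ v → sym (adj≡ u v))

  module _ (X : Subset n) where

    act-z : ∀ {s u} → ! z u → ! active X (suc s) u
    act-z {s} {u} h = active-suc⁺ {X} {s} (subst (_≤ countF (activeNbr X s u)) (sym (z⇒ h)) z≤n)

    act-o : ∀ {s u v} → ! o u → ! adj u v → ! active X s v → ! active X (suc s) u
    act-o {s} {u} {v} h e k = active-suc⁺ {X} {s} (subst (_≤ countF (activeNbr X s u)) (sym (o⇒ h))
          (countF-positive v (∧-i e k)))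

    act-o⁻¹ : ∀ {s u} → ! o u → ! active X (suc s) u → ∃[ v ] ((! adj u v) × (! active X s v))
    act-o⁻¹ {s} {u} h k with countF-witness (subst (_≤ countF (activeNbr X s u)) (o⇒ h) (active-suc⁻ {X} {s} k))
    ... | v , p = v , ∧-e₁ p , ∧-e₂ {adj u v} p

    act-a : ∀ {s u} → ! a u → (∀ v → ! adj u v → ! active X s v) → ! active X (suc s) u
    act-a {s} {u} h k = active-suc⁺ {X} {s}
      (subst (_≤ countF (activeNbr X s u)) (sym (trans (a⇒ h) (deg≡ u))) (countF-mono λ v e → ∧-i e (k v e)))

    -- The active neighbours are a subset of all neighbours with at least as many elements.
    act-a⁻¹ : ∀ {s u} → ! a u → ! active X (suc s) u → ∀ v → ! adj u v → ! active X s v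
    act-a⁻¹ {s} {u} h k v e with countF-≤-or-< {p = activeNbr X s u} {adj u} (λ v p → ∧-e₁ p)
    ... | inj₁ f = ∧-e₂ {adj u v} (f v e)
    ... | inj₂ lt = contradiction (subst (_≤ countF (activeNbr X s u)) (trans (a⇒ h) (deg≡ u)) (active-suc⁻ {X}
          {s} k)) (<⇒≱ lt)

  -- There is a target set at all, so the final table has an entry. An OR vertex stays active
  -- because its threshold 1 is at most its degree, which gives it a neighbour.
  full-active : ∀ s u → ! active full s u
  full-active zero    u = lookup-replicate u true
  full-active (suc s) u with cls u
  ... | inj₁ zu = act-z full {s} zu
  ... | inj₂ (inj₂ au) = act-a full {s} au λ v _ → full-active s v
  ... | inj₂ (inj₁ ou) with countF-witness {p = adj u} (≤-trans (subst (_≤ deg G u) (o⇒ ou) (≤-deg u))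
        (≤-reflexive (deg≡ u)))
  ...   | v , e = act-o full {s} ou e (full-active s v)

  target⇒ : ∀ {X} → IsTargetSet G τ X → Eventually λ s → ∀ u → ! active X s u
  target⇒ (s₀ , h) = s₀ , λ s le u → trans (cong (λ Y → lookup Y u) (h s le)) (lookup-replicate u true)

  target⇐ : ∀ {X} → (Eventually λ s → ∀ u → ! active X s u) → IsTargetSet G τ X
  target⇐ (s₀ , h) = s₀ , λ s le → lookup-extensional λ u → trans (h s le u) (sym (lookup-replicate u true))

  open Walks adj o

  reach≡ : ∀ j u v → reach j u v ≡ within (n + n) j u v
  reach≡ false u v = reachMatrices-within false u v
  reach≡ true  u v = reachMatrices-within true u v

  reach-e : ∀ {j u v} → ! reach j u v → Reach j u v
  reach-e {j} {u} {v} h = within-sound (n + n) j (trans (sym (reach≡ j u v)) h)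

  reach-i : ∀ {j u v} → Reach j u v → ! reach j u v
  reach-i {j} {u} {v} r = trans (reach≡ j u v) (within-complete r)

  opt-out : ∀ {X B C u} → bagUnion X B C u ≡ false → noBits ∈ options X B C u
  opt-out {X} {B} {C} {u} h = subst (noBits ∈_) (cong (λ b → labelsFor b (iso u) (o u)) (sym h)) (here refl)

  opt-in : ∀ {X B C u bs} → ! bagUnion X B C u → ! valid (o u) (iso u) bs → bs ∈ options X B C u
  opt-in {X} {B} {C} {u} {bs} h v = subst (bs ∈_) (cong (λ b → labelsFor b (iso u) (o u)) (sym h)) (go (o u)
        (iso u) refl refl v)
    where
    go : ∀ i j → o u ≡ i → iso u ≡ j → ! valid i j bs → bs ∈ labelsFor true j i
    go false true  p q _ = contradiction (trans (sym p) (∧-e₁ q)) λ ()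
    go true  true  _ _ v = ∈-validLabels true true v
    go true  false _ _ v = ∈-validLabels true false v
    go false false _ _ v = ∈-validLabels false false v

  process : Subset n → Process n
  process X = record
    { signature = signature ; adj-sym = adj-sym ; cls = cls ; o¬z = o¬z ; o¬a = o¬a ; act = active X
    ; act-z = λ {s} → act-z X {s} ; act-o = λ {s} → act-o X {s} ; act-o⁻¹ = λ {s} → act-o⁻¹ X {s}
    ; act-a = λ {s} → act-a X {s} ; act-a⁻¹ = λ {s} → act-a⁻¹ X {s} ; reach-e = reach-e ; reach-i = reach-i }

  key-empty : ∀ f g → key (topBag {n} leaf) f g ≡ emptyKey
  key-empty f g = tabulate-cong λ u → go u
    where
    go : ∀ u → row (topBag leaf) f g u ≡ false ∷ false ∷ false ∷ false ∷ false ∷ false ∷ []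
    go u rewrite lookup∘tabulate (λ (_ : Fin n) → false) u = refl

  module Decomposition (T : BagTree n) (td : IsTreeDecomposition G T) (nice : Nice T) where
    open IsTreeDecomposition td

    T⁺ : BT n
    T⁺ = rootOver T

    conn : Connected T⁺
    conn = record { topˡ = λ u h _ → ⊥-elim (¬top-leaf {u = u} h) ; topʳ = λ _ _ () ; both = λ _ _ () } ,
           connected-conv T connected , tt

    full-T : ∀ u → ! inT T⁺ u
    full-T u with nonempty u
    ... | t , p = ∨-i₂ {lookup (topBag leaf) u} (∨-i₁ (occurs⇒inT t p))

    cov : ∀ {u v} → ! adj u v → Covered u v T⁺
    cov {u} {v} e with edges (!⇒∈ (trans (sym (adj≡ u v)) e))
    ... | t , p , q = left (covered t p q)

    below-root : ∀ x → countF (below x T⁺) ≡ countF x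
    below-root x = countF-cong λ u → ≡-i ∧-e₁ λ h → ∧-i h (∧-i (full-T u) (not-i (¬top-leaf {u = u})))

    target⇒trace : ∀ X → IsTargetSet G τ X → Trace T⁺ emptyKey ∣ X ∣
    target⇒trace X tX = subst₂ (Trace T⁺) (key-empty C.f (C.slot λ _ _ → false)) (trans (below-root (C.f #0))
          (countF-lookup X))
      -- Nothing lies above the additional root, so no demand is requested from its tree.
      (C.trace T⁺ (unary (nice-conv nice)) conn (λ e _ _ → cov e) (λ _ _ → false) (λ _ _ _ _ _ → refl) λ _ _ _ ())
      where
      good : Characterization.Good (process X)
      good = Characterization.Necessary.good (process X) (target⇒ tX)
      module C = Correctness.Completeness (process X) options good (λ {X} {B} {C} → opt-out {X} {B} {C}) (λ {X}
            {B} {C} → opt-in {X} {B} {C})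

    trace⇒target : ∀ {m} → Trace T⁺ emptyKey m → ∃[ X ] (IsTargetSet G τ X × ∣ X ∣ ≡ m)
    trace⇒target t with Soundness.agreement signature options conn t
    ... | f , ag = X , target⇐ (Characterization.Sufficient.eventually-active (process X) good) ,
        trans (sym (countF-lookup X)) (trans (countF-cong f₀) (trans (sym (below-root (f #0)))
          (sym (Soundness.cost-below signature options f conn t ag))))
      where
      X : Subset n
      X = tabulate (f #0)
      f₀ : ∀ u → lookup X u ≡ f #0 u
      f₀ = lookup∘tabulate (f #0)
      good : Characterization.Good (process X)
      good = Correctness.trace⇒good (process X) options f (λ u → sym (f₀ u)) t (λ u → ¬top-leaf {u = u}) full-T cov ag

    minimum : ∀ d → Sound T⁺ d → Complete T⁺ d → ∃[ k ] (IsMinimumOrder G τ k × at d (emptyKey {n}) ≡ some k)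
    minimum d sound complete = go (complete (target⇒trace full (target⇐ (0 , λ s _ → full-active s)))) (sound
          emptyKey)
      where
      go : ∀ {m} → ∃[ k ] (k ≤ m × at d (emptyKey {n}) ≡ some k) →
           (at d (emptyKey {n}) ≡ nil) ⊎ ∃[ m ] (at d (emptyKey {n}) ≡ some m × Trace T⁺ emptyKey m) →
           ∃[ k ] (IsMinimumOrder G τ k × at d (emptyKey {n}) ≡ some k)
      go (k , _ , e) (inj₁ e′) = contradiction (trans (sym e) e′) λ ()
      go (k , _ , e) (inj₂ (k′ , e′ , t)) =
        k , (trace⇒target (subst (Trace T⁺ emptyKey) (some-injective (trans (sym e′) e)) t) ,
             λ X tX → least (complete (target⇒trace X tX))) , e
        where
        least : ∀ {m} → ∃[ k′ ] (k′ ≤ m × at d (emptyKey {n}) ≡ some k′) → k ≤ m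
        least (k′ , le , e′) = subst (_≤ _) (some-injective (trans (sym e′) e)) le

    answer : ∃[ k ] (IsMinimumOrder G τ k × at (solve T⁺) (emptyKey {n}) ≡ some k)
    answer = minimum (solve T⁺) (solve-sound T⁺) (solve-complete T⁺)

    time-bound : ∀ {w} → width T ≡ w →
                 4 + cost mainTm (encodeInput G τ T ∷ []) tt tt ≤ 2 ^ (5 * w) * order T * mainBound n
    time-bound {w} refl = begin
      4 + cost mainTm (encodeInput G τ T ∷ []) tt tt
        ≤⟨ +-monoʳ-≤ 4 (Main.main-cost G τ mx T wd (root≤ , wd , tt)) ⟩
      4 + (Q′ + (order T * nodeBound (32 ^ mx) n + combineBound (32 ^ mx) n))
        ≡⟨ +-assoc 4 Q′ _ ⟨
      fixedBound n + (order T * nodeBound (32 ^ mx) n + combineBound (32 ^ mx) n)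
        ≤⟨ +-mono-≤ (scale (fixedBound n)) (+-mono-≤ tree≤ top≤) ⟩
      P * order T * fixedBound n + (P * order T * S + P * order T * S)
        ≡⟨ collect (P * order T) (fixedBound n) S ⟩
      P * order T * mainBound n ∎
      where
      open ≤-Reasoning
      mx : ℕ
      mx = maxBag T
      P = 2 ^ (5 * w)
      Q′ = 311 + ((4 + n * 24) + (2 * emptyChildBound n + bnd answerᵉ n))
      S = nodeBase n + 32 * labelBound n
      wd : Width≤ mx (conv T)
      wd = width-conv nice
      rootBag≤ : (T : BagTree n) → ∣ rootBag T ∣ ≤ maxBag T
      rootBag≤ (node₀ X)     = ≤-refl
      rootBag≤ (node₁ X T)   = m≤m⊔n _ _
      rootBag≤ (node₂ X T U) = m≤m⊔n _ _
      root≤ : countF (bagUnion (topBag leaf) (topBag (conv T)) (topBag leaf)) ≤ mx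
      root≤ = union-⊆ (topBag leaf) (topBag (conv T)) (topBag leaf) (rootBag T) (leaf-⊆ (rootBag T))
        (λ u → subst (λ Z → ! lookup Z u) (topBag-conv T)) (leaf-⊆ (rootBag T)) (rootBag≤ T)
      P≥1 : 1 ≤ P
      P≥1 = m^n>0 2 (5 * w)
      order≥1 : (T : BagTree n) → 1 ≤ order T
      order≥1 (node₀ X)     = ≤-refl
      order≥1 (node₁ X T)   = s≤s z≤n
      order≥1 (node₂ X T U) = s≤s z≤n
      scale : ∀ x → x ≤ P * order T * x
      scale x = ≤-trans (≤-reflexive (sym (*-identityˡ x))) (*-monoˡ-≤ x (*-mono-≤ P≥1 (order≥1 T)))
      -- The largest bag has at most 1 + w vertices, also where the subtraction in `width` is
      -- truncated, and 32 ^ w is 2 ^ (5 * w).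
      pow≤ : 32 ^ mx ≤ 32 * P
      pow≤ = ≤-trans (^-monoʳ-≤ 32 {mx} {suc w} (m≤n+m∸n mx 1)) (≤-reflexive (cong (32 *_) (^-*-assoc 2 5 w)))
      base≤ : nodeBase n + 32 ^ mx * labelBound n ≤ P * S
      base≤ = ≤-trans (+-mono-≤ (≤-trans (≤-reflexive (sym (*-identityˡ (nodeBase n)))) (*-monoˡ-≤ (nodeBase n) P≥1))
                                (*-monoˡ-≤ (labelBound n) pow≤)) (≤-reflexive (arr P (nodeBase n) (labelBound n)))
        where
        arr : ∀ P x y → P * x + (32 * P) * y ≡ P * (x + 32 * y)
        arr = solve-∀
      node≤ : nodeBound (32 ^ mx) n ≤ P * S
      node≤ = ≤-trans (≤-reflexive (arr (2 * emptyChildBound n) (combineBase n) (32 ^ mx * labelBound n))) base≤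
        where
        arr : ∀ x y v → 326 + (x + (y + v)) ≡ (326 + (x + y)) + v
        arr = solve-∀
      tree≤ : order T * nodeBound (32 ^ mx) n ≤ P * order T * S
      tree≤ = ≤-trans (*-monoʳ-≤ (order T) node≤) (≤-reflexive (arr (order T) P S))
        where
        arr : ∀ x y v → x * (y * v) ≡ y * x * v
        arr = solve-∀
      top≤ : combineBound (32 ^ mx) n ≤ P * order T * S
      top≤ = ≤-trans (≤-trans (m≤n+m (combineBound (32 ^ mx) n) (326 + 2 * emptyChildBound n))
               (≤-reflexive (+-assoc 326 (2 * emptyChildBound n) (combineBound (32 ^ mx) n))))
             (≤-trans (≤-trans (≤-reflexive (sym (*-identityˡ _))) (*-monoˡ-≤ (nodeBound (32 ^ mx) n) (order≥1
                   T))) tree≤)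
      collect : ∀ q x y → q * x + (q * y + q * y) ≡ q * (x + 2 * y)
      collect = solve-∀

theorem4 : Σ[ P ∈ Program ] Σ[ poly ∈ (ℕ → ℕ) ] (PolynomiallyBounded poly ×
    (∀ {n} (G : Graph n) (τ : Threshold n) → Restricted G τ →
    ∀ (T : BagTree n) → IsTreeDecomposition G T → Nice T →
    ∀ (w : ℕ) → width T ≡ w →
    ∃[ k ] ∃[ t ] (IsMinimumOrder G τ k ×
    Run P (encodeInput G τ T) (encodeℕ k) t ×
    t ≤ 2 ^ (5 * w) * order T * poly n)))
theorem4 = compile mainTm , mainBound , Poly⇒PolynomiallyBounded mainBound-poly , result
  where
  result : ∀ {n} (G : Graph n) (τ : Threshold n) → Restricted G τ →
    ∀ (T : BagTree n) → IsTreeDecomposition G T → Nice T → ∀ (w : ℕ) → width T ≡ w →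
    ∃[ k ] ∃[ t ] (IsMinimumOrder G τ k × Run (compile mainTm) (encodeInput G τ T) (encodeℕ k) t ×
                   t ≤ 2 ^ (5 * w) * order T * mainBound n)
  result {n} G τ res T td nice w eq = from (Activation.Decomposition.answer G τ res T td nice)
    where
    d : Data
    d = DP.solve (adjacency G) (thresholds τ) (rootOver T)
    time : ℕ
    time = 4 + cost mainTm (encodeInput G τ T ∷ []) tt tt
    from : ∃[ k ] (IsMinimumOrder G τ k × at d (emptyKey {n}) ≡ some k) →
           ∃[ k ] ∃[ t ] (IsMinimumOrder G τ k × Run (compile mainTm) (encodeInput G τ T) (encodeℕ k) t ×
                          t ≤ 2 ^ (5 * w) * order T * mainBound n)
    from (k , min , e) = k , time , min ,
      subst (λ d → Run (compile mainTm) (encodeInput G τ T) d time)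
        (trans (Main.main-ok G τ T) (cong tlD e)) (compile-ok mainTm (encodeInput G τ T)) ,
      Activation.Decomposition.time-bound G τ res T td nice eq
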